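{- There is a constant $C>0$ such that for every integer $n\ge 1$, $$\left\lfloor\tfrac{1}{3}n^2\right\rfloor\leq E_3(n)\leq \tfrac{3}{8}n^2+C\,n^{3/2}.$$
   Context: A set of points in $\mathbf{R}^d$ is convexly independent if it is the vertex set of its convex hull, i.e. no point of it lies in the convex hull of the others. $E_d(n)$: for a finite set $P\subset\mathbf{R}^d$, let $E(P)$ be the maximum number of (unordered) pairs of distinct points of $P$ such that the midpoints of these pairs are convexly independent (distinct pairs selected having distinct midpoints); $E_d(n)=\max\{E(P): P\subset\mathbf{R}^d, |P|=n\}$. -}

module Defs where

open import Data.Bool.Base using (if_then_else_)
open import Data.Fin.Base as Fin using (Fin; zero; suc)
import Data.Fin.Properties as Fin
open import Data.Integer.Base as ℤ using (+_)
import Data.Integer.Properties as ℤ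
open import Data.Integer.Solver using () renaming (module +-*-Solver to ℤSolver)
open import Data.Nat.Base as ℕ using (ℕ; zero; suc; s≤s; z≤n)
import Data.Nat.Properties as ℕ
open import Data.Nat.Solver using () renaming (module +-*-Solver to ℕSolver)
open import Data.Product.Base using (Σ; ∃; ∃-syntax; Σ-syntax; _×_; _,_; proj₁; proj₂)
open import Data.Rational.Base as ℚ using (ℚ; mkℚ; 0ℚ; 1ℚ; ½; ∣_∣)
import Data.Rational.Properties as ℚ
open import Data.Rational.Solver using () renaming (module +-*-Solver to ℚSolver)
open import Data.Rational.Unnormalised.Base as ℚᵘ using (mkℚᵘ)
import Data.Rational.Unnormalised.Properties as ℚᵘ
open import Data.Sum.Base using (inj₁; inj₂)
open import Data.Vec.Functional using (Vector; foldr)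
open import Function.Base using (_∘_)
open import Function.Definitions using (Injective)
open import Level using (0ℓ)
open import Relation.Binary.Definitions using (tri<; tri≈; tri>)
open import Relation.Binary.PropositionalEquality
  using (_≡_; refl; sym; trans; cong; cong₂; subst; subst₂)
open import Relation.Nullary using (¬_; yes; no; contradiction)
open import Relation.Unary using (Pred; _∈_)

private
  variable
    d n : ℕ

private

  half-sum : ∀ ε → ½ ℚ.* ε ℚ.+ ½ ℚ.* ε ≡ ε
  half-sum ε = trans (sym (ℚ.*-distribʳ-+ ε ½ ½)) (ℚ.*-identityˡ ε)

  pos*pos : ∀ {p q} → 0ℚ ℚ.< p → 0ℚ ℚ.< q → 0ℚ ℚ.< p ℚ.* q
  pos*pos {p} {q} 0<p 0<q = ℚ.positive⁻¹ (p ℚ.* q)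
    ⦃ ℚ.pos*pos⇒pos p ⦃ ℚ.positive 0<p ⦄ q ⦃ ℚ.positive 0<q ⦄ ⦄

  half>0 : ∀ {ε} → 0ℚ ℚ.< ε → 0ℚ ℚ.< ½ ℚ.* ε
  half>0 0<ε = pos*pos (ℚ.positive⁻¹ ½) 0<ε

  0<1 : 0ℚ ℚ.< 1ℚ
  0<1 = ℚ.positive⁻¹ 1ℚ

  module _ where
    open ℚSolver

    sub-+ : ∀ a b c e → (a ℚ.+ b) ℚ.- (c ℚ.+ e) ≡ (a ℚ.- c) ℚ.+ (b ℚ.- e)
    sub-+ = solve 4 (λ a b c e → (a :+ b) :- (c :+ e) := (a :- c) :+ (b :- e)) refl

    sub-* : ∀ a b c e → (a ℚ.* b) ℚ.- (c ℚ.* e) ≡ a ℚ.* (b ℚ.- e) ℚ.+ (a ℚ.- c) ℚ.* e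
    sub-* = solve 4 (λ a b c e →
      (a :* b) :- (c :* e) := a :* (b :- e) :+ (a :- c) :* e) refl

    +-sub : ∀ a b → b ℚ.+ (a ℚ.- b) ≡ a
    +-sub = solve 2 (λ a b → b :+ (a :- b) := a) refl

    add-sub : ∀ y e → (y ℚ.+ e) ℚ.- y ≡ e
    add-sub = solve 2 (λ y e → (y :+ e) :- y := e) refl

    neg-sub : ∀ x y → ℚ.- (x ℚ.- y) ≡ y ℚ.- x
    neg-sub = solve 2 (λ x y → :- (x :- y) := y :- x) refl

    swap-* : ∀ b e i → b ℚ.* (e ℚ.* i) ≡ e ℚ.* (b ℚ.* i)
    swap-* = solve 3 (λ b e i → b :* (e :* i) := e :* (b :* i)) refl

  sub≤ : ∀ {x y e} → x ℚ.≤ y ℚ.+ e → x ℚ.- y ℚ.≤ e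
  sub≤ {x} {y} {e} h = subst (x ℚ.- y ℚ.≤_) (add-sub y e) (ℚ.+-monoˡ-≤ (ℚ.- y) h)

  ∣-∣≤ : ∀ {x y e} → x ℚ.≤ y ℚ.+ e → y ℚ.≤ x ℚ.+ e → ∣ x ℚ.- y ∣ ℚ.≤ e
  ∣-∣≤ {x} {y} {e} h k with ℚ.∣p∣≡p∨∣p∣≡-p (x ℚ.- y)
  ... | inj₁ eq = subst (ℚ._≤ e) (sym eq) (sub≤ {x} {y} h)
  ... | inj₂ eq = subst (ℚ._≤ e) (sym (trans eq (neg-sub x y))) (sub≤ {y} {x} k)

  ∣*∣≤ : ∀ {p q a b} → ∣ p ∣ ℚ.≤ a → ∣ q ∣ ℚ.≤ b → ∣ p ℚ.* q ∣ ℚ.≤ a ℚ.* b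
  ∣*∣≤ {p} {q} {a} {b} p≤a q≤b =
    subst (ℚ._≤ a ℚ.* b) (sym (ℚ.∣p*q∣≡∣p∣*∣q∣ p q)) (ℚ.≤-trans
      (ℚ.*-monoʳ-≤-nonNeg ∣ q ∣ ⦃ ℚ.∣-∣-nonNeg q ⦄ p≤a)
      (ℚ.*-monoˡ-≤-nonNeg a ⦃ ℚ.nonNegative (ℚ.≤-trans (ℚ.0≤∣p∣ p) p≤a) ⦄ q≤b))

  /-mono-≤ : ∀ a b c e .⦃ _ : ℕ.NonZero b ⦄ .⦃ _ : ℕ.NonZero e ⦄ →
             a ℕ.* e ℕ.≤ c ℕ.* b → (+ a ℚ./ b) ℚ.≤ (+ c ℚ./ e)
  /-mono-≤ a (suc b) c (suc e) h = ℚ.toℚᵘ-cancel-≤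
    (ℚᵘ.≤-trans (ℚᵘ.≤-reflexive (ℚ.toℚᵘ-fromℚᵘ (mkℚᵘ (+ a) b)))
    (ℚᵘ.≤-trans (ℚᵘ.*≤* (subst₂ ℤ._≤_ (ℤ.pos-* a (suc e)) (ℤ.pos-* c (suc b)) (ℤ.+≤+ h)))
                (ℚᵘ.≤-reflexive (ℚᵘ.≃-sym (ℚ.toℚᵘ-fromℚᵘ (mkℚᵘ (+ c) e))))))

  /-+ : ∀ a c b .⦃ _ : ℕ.NonZero b ⦄ → (+ a ℚ./ b) ℚ.+ (+ c ℚ./ b) ≡ + (a ℕ.+ c) ℚ./ b
  /-+ a c (suc b) = ℚ.toℚᵘ-injective
    (ℚᵘ.≃-trans (ℚ.toℚᵘ-homo-+ (+ a ℚ./ suc b) (+ c ℚ./ suc b))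
    (ℚᵘ.≃-trans (ℚᵘ.+-cong (ℚ.toℚᵘ-fromℚᵘ (mkℚᵘ (+ a) b)) (ℚ.toℚᵘ-fromℚᵘ (mkℚᵘ (+ c) b)))
    (ℚᵘ.≃-trans (ℚᵘ.*≡* (lemma (+ a) (+ c) (+ suc b)))
                (ℚᵘ.≃-sym (ℚ.toℚᵘ-fromℚᵘ (mkℚᵘ (+ (a ℕ.+ c)) b))))))
    where
    open ℤSolver
    lemma : ∀ x y z → (x ℤ.* z ℤ.+ y ℤ.* z) ℤ.* z ≡ (x ℤ.+ y) ℤ.* (z ℤ.* z)
    lemma = solve 3 (λ x y z → (x :* z :+ y :* z) :* z := (x :+ y) :* (z :* z)) refl

  /-* : ∀ a c b e → (+ a ℚ./ suc b) ℚ.* (+ c ℚ./ suc e) ≡ + (a ℕ.* c) ℚ./ (suc b ℕ.* suc e)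
  /-* a c b e = ℚ.toℚᵘ-injective
    (ℚᵘ.≃-trans (ℚ.toℚᵘ-homo-* (+ a ℚ./ suc b) (+ c ℚ./ suc e))
    (ℚᵘ.≃-trans (ℚᵘ.*-cong (ℚ.toℚᵘ-fromℚᵘ (mkℚᵘ (+ a) b)) (ℚ.toℚᵘ-fromℚᵘ (mkℚᵘ (+ c) e)))
    (ℚᵘ.≃-trans (ℚᵘ.*≡* (cong (ℤ._* + (suc b ℕ.* suc e)) (sym (ℤ.pos-* a c))))
                (ℚᵘ.≃-sym (ℚ.toℚᵘ-fromℚᵘ (mkℚᵘ (+ (a ℕ.* c)) (e ℕ.+ b ℕ.* suc e)))))))

  archimedean : ∀ c ε → 0ℚ ℚ.< ε → ∃[ N ] ∀ k → N ℕ.≤ k → (+ c ℚ./ suc k) ℚ.≤ ε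
  archimedean c ε@(mkℚ (+ zero) q _) 0<ε = contradiction
    (subst (λ z → + 0 ℤ.< z) (ℤ.*-zeroˡ (+ 1)) (ℚ.drop-*<* 0<ε)) (ℤ.<-irrefl refl)
  archimedean c ε@(mkℚ (ℤ.-[1+ _ ]) q _) 0<ε with ℚ.drop-*<* 0<ε
  ... | ()
  archimedean c ε@(mkℚ (+ suc p) q _) 0<ε = c ℕ.* suc q , λ k N≤k →
    subst ((+ c ℚ./ suc k) ℚ.≤_) (ℚ.↥p/↧p≡p ε)
      (/-mono-≤ c (suc k) (suc p) (suc q)
        (ℕ.≤-trans N≤k (ℕ.≤-trans (ℕ.n≤1+n k) (ℕ.m≤m+n (suc k) (p ℕ.* suc k)))))

-- A real number is a Cauchy sequence of rationals; there is no quotient, so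
-- equality of reals is always _≈_.

IsCauchy : (ℕ → ℚ) → Set
IsCauchy x = ∀ ε → 0ℚ ℚ.< ε →
  ∃[ N ] ∀ j k → N ℕ.≤ j → N ℕ.≤ k → ∣ x j ℚ.- x k ∣ ℚ.≤ ε

record ℝ : Set where
  constructor mkℝ
  field
    seq    : ℕ → ℚ
    cauchy : IsCauchy seq

open ℝ public

infix 4 _≈_ _≤_ _<_
infixl 6 _+_
infixl 7 _*_

_≈_ : ℝ → ℝ → Set
x ≈ y = ∀ ε → 0ℚ ℚ.< ε → ∃[ N ] ∀ k → N ℕ.≤ k → ∣ seq x k ℚ.- seq y k ∣ ℚ.≤ ε

_≤_ : ℝ → ℝ → Set
x ≤ y = ∀ ε → 0ℚ ℚ.< ε → ∃[ N ] ∀ k → N ℕ.≤ k → seq x k ℚ.≤ seq y k ℚ.+ ε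

_<_ : ℝ → ℝ → Set
x < y = ∃[ ε ] 0ℚ ℚ.< ε × ∃[ N ] ∀ k → N ℕ.≤ k → seq x k ℚ.+ ε ℚ.≤ seq y k

abstract
  fromℚ-cauchy : ∀ q → IsCauchy (λ _ → q)
  fromℚ-cauchy q ε 0<ε = 0 , λ _ _ _ _ →
    subst (ℚ._≤ ε) (sym (cong ∣_∣ (ℚ.+-inverseʳ q))) (ℚ.<⇒≤ 0<ε)

fromℚ : ℚ → ℝ
fromℚ q = mkℝ (λ _ → q) (fromℚ-cauchy q)

fromℕ : ℕ → ℝ
fromℕ a = fromℚ (+ a ℚ./ 1)

0ℝ 1ℝ : ℝ
0ℝ = fromℚ 0ℚ
1ℝ = fromℚ 1ℚ

abstract
  +-cauchy : ∀ x y → IsCauchy (λ k → seq x k ℚ.+ seq y k)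
  +-cauchy x y ε 0<ε =
    let M , p = cauchy x (½ ℚ.* ε) (half>0 0<ε)
        N , q = cauchy y (½ ℚ.* ε) (half>0 0<ε)
    in M ℕ.⊔ N , λ j k N≤j N≤k →
      subst₂ ℚ._≤_ (cong ∣_∣ (sym (sub-+ (seq x j) (seq y j) (seq x k) (seq y k)))) (half-sum ε)
        (ℚ.≤-trans (ℚ.∣p+q∣≤∣p∣+∣q∣ (seq x j ℚ.- seq x k) (seq y j ℚ.- seq y k))
          (ℚ.+-mono-≤
            (p j k (ℕ.m⊔n≤o⇒m≤o M N N≤j) (ℕ.m⊔n≤o⇒m≤o M N N≤k))
            (q j k (ℕ.m⊔n≤o⇒n≤o M N N≤j) (ℕ.m⊔n≤o⇒n≤o M N N≤k))))

_+_ : ℝ → ℝ → ℝ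
x + y = mkℝ (λ k → seq x k ℚ.+ seq y k) (+-cauchy x y)

private
  bounded : ∀ x → ∃[ B ] 0ℚ ℚ.< B × ∃[ N ] ∀ k → N ℕ.≤ k → ∣ seq x k ∣ ℚ.≤ B
  bounded x with cauchy x 1ℚ 0<1
  ... | N , p = ∣ seq x N ∣ ℚ.+ 1ℚ
    , ℚ.+-mono-≤-< (ℚ.0≤∣p∣ (seq x N)) 0<1
    , N , λ k N≤k → subst (λ z → ∣ z ∣ ℚ.≤ ∣ seq x N ∣ ℚ.+ 1ℚ) (+-sub (seq x k) (seq x N))
      (ℚ.≤-trans (ℚ.∣p+q∣≤∣p∣+∣q∣ (seq x N) (seq x k ℚ.- seq x N))
        (ℚ.+-monoʳ-≤ ∣ seq x N ∣ (p k N N≤k ℕ.≤-refl)))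

  scaled : ∀ B → 0ℚ ℚ.< B → ∀ ε → 0ℚ ℚ.< ε → ∃[ δ ] 0ℚ ℚ.< δ × B ℚ.* δ ≡ ε
  scaled B 0<B ε 0<ε = ε ℚ.* B⁻¹
    , pos*pos 0<ε (ℚ.positive⁻¹ B⁻¹ ⦃ ℚ.1/pos⇒pos B ⦃ ℚ.positive 0<B ⦄ ⦄)
    , trans (swap-* B ε B⁻¹) (trans (cong (ε ℚ.*_) (ℚ.*-inverseʳ B ⦃ B≢0 ⦄)) (ℚ.*-identityʳ ε))
    where
    B≢0 = ℚ.pos⇒nonZero B ⦃ ℚ.positive 0<B ⦄
    B⁻¹ = (ℚ.1/ B) ⦃ B≢0 ⦄

abstract
  *-cauchy : ∀ x y → IsCauchy (λ k → seq x k ℚ.* seq y k)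
  *-cauchy x y ε 0<ε =
    let A , 0<A , K , ∣x∣≤A = bounded x
        B , 0<B , L , ∣y∣≤B = bounded y
        α , 0<α , Aα≡ = scaled A 0<A (½ ℚ.* ε) (half>0 0<ε)
        β , 0<β , Bβ≡ = scaled B 0<B (½ ℚ.* ε) (half>0 0<ε)
        M , p = cauchy x β 0<β
        N , q = cauchy y α 0<α
        R = (K ℕ.⊔ L) ℕ.⊔ (M ℕ.⊔ N)
        K≤R : K ℕ.≤ R
        K≤R = ℕ.≤-trans (ℕ.m≤m⊔n K L) (ℕ.m≤m⊔n (K ℕ.⊔ L) (M ℕ.⊔ N))
        L≤R : L ℕ.≤ R
        L≤R = ℕ.≤-trans (ℕ.m≤n⊔m K L) (ℕ.m≤m⊔n (K ℕ.⊔ L) (M ℕ.⊔ N))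
        M≤R : M ℕ.≤ R
        M≤R = ℕ.≤-trans (ℕ.m≤m⊔n M N) (ℕ.m≤n⊔m (K ℕ.⊔ L) (M ℕ.⊔ N))
        N≤R : N ℕ.≤ R
        N≤R = ℕ.≤-trans (ℕ.m≤n⊔m M N) (ℕ.m≤n⊔m (K ℕ.⊔ L) (M ℕ.⊔ N))
    in R , λ j k R≤j R≤k →
      subst₂ ℚ._≤_ (cong ∣_∣ (sym (sub-* (seq x j) (seq y j) (seq x k) (seq y k))))
        (trans (cong₂ ℚ._+_ Aα≡ (trans (ℚ.*-comm β B) Bβ≡)) (half-sum ε))
        (ℚ.≤-trans
          (ℚ.∣p+q∣≤∣p∣+∣q∣ (seq x j ℚ.* (seq y j ℚ.- seq y k)) ((seq x j ℚ.- seq x k) ℚ.* seq y k))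
          (ℚ.+-mono-≤
            (∣*∣≤ (∣x∣≤A j (ℕ.≤-trans K≤R R≤j))
                  (q j k (ℕ.≤-trans N≤R R≤j) (ℕ.≤-trans N≤R R≤k)))
            (∣*∣≤ (p j k (ℕ.≤-trans M≤R R≤j) (ℕ.≤-trans M≤R R≤k))
                  (∣y∣≤B k (ℕ.≤-trans L≤R R≤k)))))

_*_ : ℝ → ℝ → ℝ
x * y = mkℝ (λ k → seq x k ℚ.* seq y k) (*-cauchy x y)

-- ⌊ √ a ⌋
isqrt : ℕ → ℕ
isqrt zero    = 0
isqrt (suc a) = if (suc r ℕ.* suc r) ℕ.≤ᵇ suc a then suc r else r
  where r = isqrt a

isqrt-spec : ∀ a → isqrt a ℕ.* isqrt a ℕ.≤ a × a ℕ.< suc (isqrt a) ℕ.* suc (isqrt a)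
isqrt-spec zero    = z≤n , s≤s z≤n
isqrt-spec (suc a) with isqrt a | isqrt-spec a
... | r | lo , hi
  with suc r ℕ.* suc r ℕ.≤ᵇ suc a | ℕ.≤ᵇ-reflects-≤ (suc r ℕ.* suc r) (suc a)
... | _ | Relation.Nullary.ofʸ p =
  p , ℕ.≤-<-trans hi (ℕ.*-mono-< (ℕ.n<1+n (suc r)) (ℕ.n<1+n (suc r)))
... | _ | Relation.Nullary.ofⁿ ¬p = ℕ.≤-trans lo (ℕ.n≤1+n a) , ℕ.≰⇒> ¬p

private

  root : ℕ → ℕ → ℕ
  root a k = isqrt (a ℕ.* (suc k ℕ.* suc k))

  square-cancel-< : ∀ {x y} → x ℕ.* x ℕ.< y ℕ.* y → x ℕ.< y
  square-cancel-< x²<y² = ℕ.≰⇒> λ y≤x → ℕ.<⇒≱ x²<y² (ℕ.*-mono-≤ y≤x y≤x)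

  square-* : ∀ x y → (x ℕ.* y) ℕ.* (x ℕ.* y) ≡ (x ℕ.* x) ℕ.* (y ℕ.* y)
  square-* = solve 2 (λ x y → (x :* y) :* (x :* y) := (x :* x) :* (y :* y)) refl
    where open ℕSolver

  swap-ℕ* : ∀ a x y → (a ℕ.* x) ℕ.* y ≡ (a ℕ.* y) ℕ.* x
  swap-ℕ* = solve 3 (λ a x y → (a :* x) :* y := (a :* y) :* x) refl
    where open ℕSolver

  root-cross : ∀ a j k → root a j ℕ.* suc k ℕ.< suc (root a k) ℕ.* suc j
  root-cross a j k = square-cancel-< (begin-strict
    (root a j ℕ.* suc k) ℕ.* (root a j ℕ.* suc k)
      ≡⟨ square-* (root a j) (suc k) ⟩
    (root a j ℕ.* root a j) ℕ.* (suc k ℕ.* suc k)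
      ≤⟨ ℕ.*-monoˡ-≤ (suc k ℕ.* suc k) (proj₁ (isqrt-spec (a ℕ.* (suc j ℕ.* suc j)))) ⟩
    (a ℕ.* (suc j ℕ.* suc j)) ℕ.* (suc k ℕ.* suc k)
      ≡⟨ swap-ℕ* a (suc j ℕ.* suc j) (suc k ℕ.* suc k) ⟩
    (a ℕ.* (suc k ℕ.* suc k)) ℕ.* (suc j ℕ.* suc j)
      <⟨ ℕ.*-monoˡ-< (suc j ℕ.* suc j) (proj₂ (isqrt-spec (a ℕ.* (suc k ℕ.* suc k)))) ⟩
    (suc (root a k) ℕ.* suc (root a k)) ℕ.* (suc j ℕ.* suc j)
      ≡⟨ sym (square-* (suc (root a k)) (suc j)) ⟩
    (suc (root a k) ℕ.* suc j) ℕ.* (suc (root a k) ℕ.* suc j) ∎)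
    where open ℕ.≤-Reasoning

  root-close : ∀ a j k {ε} → (+ 1 ℚ./ suc k) ℚ.≤ ε →
               (+ root a j ℚ./ suc j) ℚ.≤ (+ root a k ℚ./ suc k) ℚ.+ ε
  root-close a j k 1/k≤ε = ℚ.≤-trans
    (subst ((+ root a j ℚ./ suc j) ℚ.≤_)
      (trans (cong (λ z → + z ℚ./ suc k) (ℕ.+-comm 1 (root a k))) (sym (/-+ (root a k) 1 (suc k))))
      (/-mono-≤ (root a j) (suc j) (suc (root a k)) (suc k) (ℕ.<⇒≤ (root-cross a j k))))
    (ℚ.+-monoʳ-≤ (+ root a k ℚ./ suc k) 1/k≤ε)

abstract
  √-cauchy : ∀ a → IsCauchy (λ k → + isqrt (a ℕ.* (suc k ℕ.* suc k)) ℚ./ suc k)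
  √-cauchy a ε 0<ε =
    let N , small = archimedean 1 ε 0<ε in
    N , λ j k N≤j N≤k → ∣-∣≤ (root-close a j k (small k N≤k)) (root-close a k j (small j N≤j))

-- The k-th approximation to √ a is ⌊ √ a · (k + 1) ⌋ / (k + 1).
√ : ℕ → ℝ
√ a = mkℝ (λ k → + isqrt (a ℕ.* (suc k ℕ.* suc k)) ℚ./ suc k) (√-cauchy a)

√-nonNegative : ∀ a → 0ℝ ≤ √ a
√-nonNegative a ε 0<ε = 0 , λ k _ →
  ℚ.+-mono-≤ (/-mono-≤ 0 1 (root a k) (suc k) z≤n) (ℚ.<⇒≤ 0<ε)

√-square : ∀ a → √ a * √ a ≈ fromℕ a
√-square a ε 0<ε with archimedean (suc (2 ℕ.* a)) ε 0<ε
... | N , small = N , λ k N≤k → subst (λ z → ∣ z ℚ.- (+ a ℚ./ 1) ∣ ℚ.≤ ε)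
    (sym (/-* (root a k) (root a k) k k))
    (∣-∣≤ (ℚ.≤-trans (below k) (ℚ.≤-trans (ℚ.≤-reflexive (sym (ℚ.+-identityʳ (+ a ℚ./ 1))))
            (ℚ.+-monoʳ-≤ (+ a ℚ./ 1) (ℚ.<⇒≤ 0<ε))))
          (ℚ.≤-trans (above k) (ℚ.+-monoʳ-≤ (+ (root a k ℕ.* root a k) ℚ./ (suc k ℕ.* suc k))
            (small k N≤k))))
  where
  below : ∀ k → (+ (root a k ℕ.* root a k) ℚ./ (suc k ℕ.* suc k)) ℚ.≤ (+ a ℚ./ 1)
  below k = /-mono-≤ (root a k ℕ.* root a k) (suc k ℕ.* suc k) a 1
    (subst (ℕ._≤ a ℕ.* (suc k ℕ.* suc k)) (sym (ℕ.*-identityʳ _))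
      (proj₁ (isqrt-spec (a ℕ.* (suc k ℕ.* suc k)))))

  root≤ : ∀ k → root a k ℕ.≤ a ℕ.* suc k
  root≤ k = ℕ.≤-pred (square-cancel-< (ℕ.≤-<-trans
    (proj₁ (isqrt-spec (a ℕ.* (suc k ℕ.* suc k))))
    (ℕ.≤-<-trans (subst (a ℕ.* (suc k ℕ.* suc k) ℕ.≤_) (sym (square-* a (suc k)))
                   (ℕ.*-monoˡ-≤ (suc k ℕ.* suc k) (a≤a² a)))
                 (ℕ.*-mono-< (ℕ.n<1+n (a ℕ.* suc k)) (ℕ.n<1+n (a ℕ.* suc k))))))
    where
    a≤a² : ∀ b → b ℕ.≤ b ℕ.* b
    a≤a² zero    = z≤n
    a≤a² (suc b) = ℕ.m≤m+n (suc b) (b ℕ.* suc b)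

  numerators : ∀ k → let r = root a k ; s = suc k in
               a ℕ.* (s ℕ.* s) ℕ.≤ r ℕ.* r ℕ.+ suc (2 ℕ.* a) ℕ.* s
  numerators k = begin
    a ℕ.* (s ℕ.* s)                    ≤⟨ ℕ.<⇒≤ (proj₂ (isqrt-spec (a ℕ.* (s ℕ.* s)))) ⟩
    suc r ℕ.* suc r                    ≡⟨ expand r ⟩
    r ℕ.* r ℕ.+ (1 ℕ.+ 2 ℕ.* r)        ≤⟨ ℕ.+-monoʳ-≤ (r ℕ.* r)
                                           (ℕ.+-mono-≤ {1} {s} (s≤s z≤n) (ℕ.*-monoʳ-≤ 2 (root≤ k))) ⟩
    r ℕ.* r ℕ.+ (s ℕ.+ 2 ℕ.* (a ℕ.* s)) ≡⟨ cong (λ z → r ℕ.* r ℕ.+ (s ℕ.+ z))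
                                           (sym (ℕ.*-assoc 2 a s)) ⟩
    r ℕ.* r ℕ.+ suc (2 ℕ.* a) ℕ.* s    ∎
    where
    r = root a k
    s = suc k
    open ℕ.≤-Reasoning
    expand : ∀ r → suc r ℕ.* suc r ≡ r ℕ.* r ℕ.+ (1 ℕ.+ 2 ℕ.* r)
    expand = solve 1 (λ r → (con 1 :+ r) :* (con 1 :+ r) := r :* r :+ (con 1 :+ con 2 :* r)) refl
      where open ℕSolver

  above : ∀ k → (+ a ℚ./ 1) ℚ.≤
          (+ (root a k ℕ.* root a k) ℚ./ (suc k ℕ.* suc k)) ℚ.+ (+ suc (2 ℕ.* a) ℚ./ suc k)
  above k = ℚ.≤-trans
    (/-mono-≤ a 1 (r ℕ.* r ℕ.+ c ℕ.* s) (s ℕ.* s)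
      (subst (a ℕ.* (s ℕ.* s) ℕ.≤_) (sym (ℕ.*-identityʳ _)) (numerators k)))
    (ℚ.≤-trans (ℚ.≤-reflexive (sym (/-+ (r ℕ.* r) (c ℕ.* s) (s ℕ.* s))))
      (ℚ.+-monoʳ-≤ (+ (r ℕ.* r) ℚ./ (s ℕ.* s))
        (/-mono-≤ (c ℕ.* s) (s ℕ.* s) c s (ℕ.≤-reflexive (ℕ.*-assoc c s s)))))
    where
    r = root a k
    s = suc k
    c = suc (2 ℕ.* a)

infix 9 _^3/2

_^3/2 : ℕ → ℝ
a ^3/2 = √ (a ℕ.^ 3)

Point : ℕ → Set
Point d = Vector ℝ d

infix 4 _≋_

_≋_ : Point d → Point d → Set
p ≋ q = ∀ i → p i ≈ q i

midpoint : Point d → Point d → Point d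
midpoint p q i = fromℚ ½ * (p i + q i)

∑ : Vector ℝ n → ℝ
∑ = foldr _+_ 0ℝ

ConvexHull : Pred (Point d) 0ℓ → Pred (Point d) 0ℓ
ConvexHull {d} S x =
  ∃[ r ] Σ[ y ∈ (Fin r → Point d) ] Σ[ w ∈ Vector ℝ r ]
    (∀ j → y j ∈ S) ×
    (∀ j → 0ℝ ≤ w j) ×
    ∑ w ≈ 1ℝ ×
    (∀ i → ∑ (λ j → w j * y j i) ≈ x i)

_∖_ : Pred (Point d) 0ℓ → Point d → Pred (Point d) 0ℓ
(S ∖ x) y = y ∈ S × ¬ (y ≋ x)

ConvexlyIndependent : Pred (Point d) 0ℓ → Set
ConvexlyIndependent S = ∀ x → x ∈ S → ¬ (x ∈ ConvexHull (S ∖ x))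

Image : ∀ {A : Set} → (A → Point d) → Pred (Point d) 0ℓ
Image f x = ∃[ a ] f a ≋ x

record PointSet (d n : ℕ) : Set where
  field
    point    : Fin n → Point d
    distinct : Injective _≡_ _≋_ point

open PointSet public

-- The unordered pair {i, j} of distinct indices is represented by its
-- increasing ordering.
Pair : ℕ → Set
Pair n = Σ[ (i , j) ∈ Fin n × Fin n ] i Fin.< j

pairMidpoint : PointSet d n → Pair n → Point d
pairMidpoint P ((i , j) , _) = midpoint (point P i) (point P j)

Selection : PointSet d n → Pred ℕ 0ℓ
Selection {n = n} P k = Σ[ pair ∈ (Fin k → Pair n) ]
  Injective _≡_ _≡_ pair ×
  Injective _≡_ _≋_ (pairMidpoint P ∘ pair) ×
  ConvexlyIndependent (Image (pairMidpoint P ∘ pair))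

IsMaximum : Pred ℕ 0ℓ → Pred ℕ 0ℓ
IsMaximum S m = m ∈ S × (∀ k → k ∈ S → k ℕ.≤ m)

-- IsE P k means E(P) = k, and IsExtremal d n m means E_d(n) = m.  Order and
-- equality of reals are undecidable, so these maxima are specified by a
-- relation instead of being computed; see extremal-exists below.

IsE : PointSet d n → ℕ → Set
IsE P = IsMaximum (Selection P)

IsExtremal : (d n : ℕ) → ℕ → Set
IsExtremal d n = IsMaximum (λ k → Σ[ P ∈ PointSet d n ] IsE P k)

IsMaximum-unique : ∀ {S k m} → IsMaximum S k → IsMaximum S m → k ≡ m
IsMaximum-unique (k∈S , ≤k) (m∈S , ≤m) = ℕ.≤-antisym (≤m _ k∈S) (≤k _ m∈S)

private

  maximum-exists : ∀ (S : Pred ℕ 0ℓ) B → (∀ k → k ∈ S → k ℕ.≤ B) →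
                   ∃ S → ¬ ¬ ∃ (IsMaximum S)
  maximum-exists S zero    bound (k , k∈S) no-max with bound k k∈S
  ... | z≤n = no-max (0 , k∈S , bound)
  maximum-exists S (suc B) bound k∈S no-max = B∉S λ B∈S → no-max (suc B , B∈S , bound)
    where
    B∉S : ¬ ¬ (suc B ∈ S)
    B∉S B∉S = maximum-exists S B
      (λ k k∈S → ℕ.≤-pred (ℕ.≤∧≢⇒< (bound k k∈S) λ { refl → B∉S k∈S })) k∈S no-max

  pair-≡ : ∀ (p q : Pair n) →
           Fin.combine (proj₁ (proj₁ p)) (proj₂ (proj₁ p)) ≡
           Fin.combine (proj₁ (proj₁ q)) (proj₂ (proj₁ q)) → p ≡ q
  pair-≡ ((i , j) , i<j) ((i′ , j′) , i′<j′) eq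
    with Fin.combine-injective i j i′ j′ eq
  ... | refl , refl = cong ((i , j) ,_) (ℕ.<-irrelevant i<j i′<j′)

  selection-bound : (P : PointSet d n) → ∀ k → Selection P k → k ℕ.≤ n ℕ.* n
  selection-bound {n = n} P k (pair , pair-injective , _) = Fin.injective⇒≤ {f = code} code-injective
    where
    code : Fin k → Fin (n ℕ.* n)
    code e = let (i , j) , _ = pair e in Fin.combine i j

    code-injective : Injective _≡_ _≡_ code
    code-injective {x} {y} eq = pair-injective (pair-≡ (pair x) (pair y) eq)

  E-exists : (P : PointSet d n) → ¬ ¬ ∃ (IsE P)
  E-exists P = maximum-exists (Selection P) _ (selection-bound P) (0 , (λ ()) , (λ { {()} }) , (λ { {()} }) , λ { _ (() , _) })

  fromℕ-injective-≤ : ∀ {a b} → fromℕ a ≈ fromℕ b → a ℕ.≤ b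
  fromℕ-injective-≤ {a} {b} a≈b = ℕ.≮⇒≥ λ b<a →
    let N , close = a≈b ½ (ℚ.positive⁻¹ ½)
        1≤a-b : 1ℚ ℚ.≤ (+ a ℚ./ 1) ℚ.- (+ b ℚ./ 1)
        1≤a-b = subst (ℚ._≤ (+ a ℚ./ 1) ℚ.- (+ b ℚ./ 1)) (add-sub (+ b ℚ./ 1) 1ℚ)
          (ℚ.+-monoˡ-≤ (ℚ.- (+ b ℚ./ 1)) (ℚ.≤-trans (ℚ.≤-reflexive (/-+ b 1 1))
            (/-mono-≤ (b ℕ.+ 1) 1 a 1 (ℕ.*-monoˡ-≤ 1 (subst (ℕ._≤ a) (ℕ.+-comm 1 b) b<a)))))
        a-b≤½ : (+ a ℚ./ 1) ℚ.- (+ b ℚ./ 1) ℚ.≤ ½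
        a-b≤½ = subst (ℚ._≤ ½)
          (ℚ.0≤p⇒∣p∣≡p (ℚ.≤-trans (ℚ.<⇒≤ 0<1) 1≤a-b)) (close N ℕ.≤-refl)
    in contradiction (ℚ.≤-trans 1≤a-b a-b≤½) 1≰½
    where
    1≰½ : ¬ (1ℚ ℚ.≤ ½)
    1≰½ (ℚ.*≤* (ℤ.+≤+ (s≤s ())))

  fromℕ-injective : ∀ {a b} → fromℕ a ≈ fromℕ b → a ≡ b
  fromℕ-injective {a} {b} a≈b = ℕ.≤-antisym (fromℕ-injective-≤ a≈b)
    (fromℕ-injective-≤ λ ε 0<ε → let N , close = a≈b ε 0<ε in N , λ k N≤k →
      subst (ℚ._≤ ε) (trans (sym (ℚ.∣-p∣≡∣p∣ ((+ a ℚ./ 1) ℚ.- (+ b ℚ./ 1))))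
        (cong ∣_∣ (neg-sub (+ a ℚ./ 1) (+ b ℚ./ 1)))) (close k N≤k))

line : ∀ d n → PointSet (suc d) n
line d n = record
  { point    = λ i _ → fromℕ (Fin.toℕ i)
  ; distinct = λ eq → Fin.toℕ-injective (fromℕ-injective (eq zero))
  }

-- E_d(n) has a value for every d ≥ 1.  The double negation reflects that E(P)
-- cannot be decided for an arbitrary configuration P of reals.
extremal-exists : ∀ d n → ¬ ¬ ∃ (IsExtremal (suc d) n)
extremal-exists d n no-max = E-exists (line d n) λ (k , E≡k) →
  maximum-exists _ (n ℕ.* n) (λ { k (P , σ , _) → selection-bound P k σ })
    (k , line d n , E≡k) no-max

{-# OPTIONS --safe #-}
module Submission where

-- Upper bound.  Join two points of P when their midpoint is selected.  If a
-- midpoint is a vertex of the convex hull of all the midpoints, the neighbours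
-- of a point are convexly independent, and in a five-clique no point of an edge
-- lies in the hull of the other three vertices.  So the Radon partition of a
-- five-clique in R³ splits off a single vertex p, its centre, which lies in the
-- tetrahedron of the others.  If p′ ≠ p were another common neighbour of these
-- four, the Radon partition of p′ with them would put p into the hull of p′ and
-- three vertices of the tetrahedron, all neighbours of the fourth one.  Hence
-- the centre of a five-clique is the only common neighbour of the other four.
-- Deleting these four vertices removes at most 3n − 5 edges of a graph on n
-- vertices, and if there is no five-clique a maximal clique can be deleted as in
-- Turán's theorem.  By induction 8 m ≤ 3 n² + 2 n for the number m of edges.
--
-- Lower bound.  The n points X² (1, 1, 1) − X e_s, with X = 1, …, n and s = X − 1
-- mod 3, have convexly independent midpoints over the pairs with distinct s.
--
-- Order on the reals is undecidable, so geometric arguments by cases take place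
-- under a double negation, which is harmless as their conclusions are negative.

import Algebra.Properties.CommutativeMonoid.Sum as CommutativeMonoidSum
import Algebra.Properties.Group as GroupProperties
import Algebra.Properties.Ring as RingProperties
import Algebra.Properties.Semiring.Sum as SemiringSum
import Algebra.Solver.Ring.NaturalCoefficients.Default as SemiringSolver
open import Algebra.Bundles using (CommutativeRing)
open import Data.Bool.Base using (Bool; true; false; T; if_then_else_; not; _∧_)
open import Data.Bool.Properties using (T?)
open import Data.Empty using (⊥; ⊥-elim)
open import Data.Fin.Base as Fin using (Fin; zero; suc; toℕ)
import Data.Fin.Properties as Fin
import Data.Integer.Properties as ℤ
open import Data.Integer.Solver using () renaming (module +-*-Solver to ℤSolver)
open import Data.List.Base using (List; []; _∷_; _++_; map; length; lookup; allFin; cartesianProduct; filter)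
import Data.List.Properties as List
open import Data.List.Membership.Propositional using (_∈_; find)
open import Data.List.Membership.Propositional.Properties
  using (∈-∃++; ∈-map⁻; ∈-allFin; ∈-cartesianProduct⁺; ∈-lookup; ∈-filter⁻)
open import Data.List.Relation.Binary.Permutation.Propositional as ↭ using (_↭_; ↭-sym; ↭-trans)
import Data.List.Relation.Binary.Permutation.Propositional.Properties as ↭
open import Data.List.Relation.Unary.All as All using (All; []; _∷_)
import Data.List.Relation.Unary.All.Properties as All
open import Data.List.Relation.Unary.AllPairs as AllPairs using (AllPairs; []; _∷_)
import Data.List.Relation.Unary.AllPairs.Properties as AllPairs
open import Data.List.Relation.Unary.Any as Any using (Any; here; there)
import Data.List.Relation.Unary.Any.Properties as Any
open import Data.List.Relation.Unary.Unique.Propositional using (Unique)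
import Data.List.Relation.Unary.Unique.Propositional.Properties as Unique
open import Data.Nat.Base as ℕ using (ℕ; zero; suc; s≤s; z≤n)
open import Data.Nat.DivMod using (_/_; m<n*o⇒m/o<n)
import Data.Nat.Properties as ℕ
open import Data.Nat.Solver using () renaming (module +-*-Solver to ℕSolver)
open import Data.Product.Base using (∃; ∃₂; ∃-syntax; _×_; _,_; proj₁; proj₂; swap)
import Data.Product.Properties as Product
open import Data.Rational.Base as ℚ using (ℚ; 0ℚ; 1ℚ; ½; ∣_∣)
import Data.Rational.Properties as ℚ
open import Data.Rational.Solver using () renaming (module +-*-Solver to ℚSolver)
open import Data.Rational.Unnormalised.Base as ℚᵘ using (mkℚᵘ)
import Data.Rational.Unnormalised.Properties as ℚᵘ
open import Data.Sum.Base as Sum using (_⊎_; inj₁; inj₂)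
open import Function.Base using (_∘_; id; _on_)
open import Level using (0ℓ)
open import Relation.Binary.Definitions using (DecidableEquality; Decidable)
open import Relation.Binary.PropositionalEquality as ≡
  using (_≡_; _≢_; refl; sym; trans; cong; cong₂; subst; subst₂)
open import Relation.Nullary using (¬_; Dec; yes; no; does; contradiction)
open import Relation.Nullary.Decidable using (_→-dec_; _⊎-dec_; ¬?; decidable-stable)
open import Relation.Unary using (Pred) renaming (_∈_ to _∈ₚ_)

-- The constant 3/8 is the Turán density of graphs without a five-clique. Five-cliques themselves
-- are not excluded, and deleting all five vertices of one would be too expensive, since an outside
-- vertex is only known to be adjacent to at most four of them. Keeping the centre saves the
-- density: every other remaining vertex misses one of the four deleted ones, so a deletion costs a
-- single edge more than it would without five-cliques. These extra edges add up to a linear error,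
-- and C = 1 suffices.
--
-- In the construction, a linear functional whose coefficients c add up to 1 takes the value X² -
-- c_s X at the point of parameter X and colour s. Each colour class is thus seen as a parabola, and
-- the minima of two of them can be placed independently. The third coefficient, forced by the sum,
-- is then negative, which moves the minimum of the third parabola out of the range X > 0. Three
-- colour classes of nearly equal size give the n²/3 pairs.

record OrderedField : Set₁ where
  field
    commutativeRing : CommutativeRing 0ℓ 0ℓ
  open CommutativeRing commutativeRing public
  field
    NonNeg Pos   : Carrier → Set
    NonNeg-resp  : ∀ {x y} → x ≈ y → NonNeg x → NonNeg y
    Pos-resp     : ∀ {x y} → x ≈ y → Pos x → Pos y
    NonNeg-0     : NonNeg 0#
    NonNeg-+     : ∀ {x y} → NonNeg x → NonNeg y → NonNeg (x + y)
    NonNeg-*     : ∀ {x y} → NonNeg x → NonNeg y → NonNeg (x * y)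
    Pos⇒NonNeg   : ∀ {x} → Pos x → NonNeg x
    Pos-+-NonNeg : ∀ {x y} → Pos x → NonNeg y → Pos (x + y)
    Pos-*        : ∀ {x y} → Pos x → Pos y → Pos (x * y)
    Pos-1        : Pos 1#
    ¬Pos-0       : ¬ Pos 0#
    -- Cauchy reals satisfy this only under a double negation. Hence `Pos` is not defined as a
    -- negation: it carries the information that `inverse` needs.
    trichotomy   : ∀ x → ¬ ¬ (x ≈ 0# ⊎ Pos x ⊎ Pos (- x))
    inverse      : ∀ {x} → Pos x → ∃[ y ] Pos y × x * y ≈ 1#

private
  variable
    A B : Set

-- The double-negation monad: `do` blocks distinguish cases by sign, and a proof of `⊥` leaves the
-- monad through `id`.
_>>=_ : ¬ ¬ A → (A → ¬ ¬ B) → ¬ ¬ B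
(m >>= f) k = m λ a → f a k

return : A → ¬ ¬ A
return a k = k a

-- Linear dependencies, Radon partitions and least ratios

module LinearAlgebra (F : OrderedField) where

  open OrderedField F hiding (zero) renaming (refl to ≈-refl; sym to ≈-sym; trans to ≈-trans)
  open RingProperties ring using (-‿distribˡ-*; -‿distribʳ-*; -‿involutive; -0#≈0#)
  open SemiringSolver commutativeSemiring
  open import Relation.Binary.Reasoning.Setoid setoid

  sumOf : (A → Carrier) → List A → Carrier
  sumOf f []      = 0#
  sumOf f (a ∷ L) = f a + sumOf f L

  comb : (A → Carrier) → List (Carrier × A) → Carrier
  comb f = sumOf (λ (w , a) → w * f a)

  weight : List (Carrier × A) → Carrier
  weight = sumOf proj₁

  sumOf-cong : ∀ {f g : A → Carrier} → (∀ a → f a ≈ g a) → ∀ L → sumOf f L ≈ sumOf g L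
  sumOf-cong f≈g []      = ≈-refl
  sumOf-cong f≈g (a ∷ L) = +-cong (f≈g a) (sumOf-cong f≈g L)

  sumOf-+ : ∀ (f g : A → Carrier) L → sumOf (λ a → f a + g a) L ≈ sumOf f L + sumOf g L
  sumOf-+ f g []      = ≈-sym (+-identityˡ 0#)
  sumOf-+ f g (a ∷ L) = ≈-trans (+-congˡ (sumOf-+ f g L))
    (solve 4 (λ a b c d → (a :+ b) :+ (c :+ d) := (a :+ c) :+ (b :+ d)) ≈-refl _ _ _ _)

  sumOf-*ˡ : ∀ c (f : A → Carrier) L → sumOf (λ a → c * f a) L ≈ c * sumOf f L
  sumOf-*ˡ c f []      = ≈-sym (zeroʳ c)
  sumOf-*ˡ c f (a ∷ L) = ≈-trans (+-congˡ (sumOf-*ˡ c f L)) (≈-sym (distribˡ c _ _))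

  sumOf-*ʳ : ∀ c (f : A → Carrier) L → sumOf (λ a → f a * c) L ≈ sumOf f L * c
  sumOf-*ʳ c f []      = ≈-sym (zeroˡ c)
  sumOf-*ʳ c f (a ∷ L) = ≈-trans (+-congˡ (sumOf-*ʳ c f L)) (≈-sym (distribʳ c _ _))

  sumOf-map : ∀ (f : B → Carrier) (g : A → B) L → sumOf f (map g L) ≡ sumOf (f ∘ g) L
  sumOf-map f g []      = ≡.refl
  sumOf-map f g (a ∷ L) = ≡.cong (f (g a) +_) (sumOf-map f g L)

  sumOf-++ : ∀ (f : A → Carrier) L M → sumOf f (L ++ M) ≈ sumOf f L + sumOf f M
  sumOf-++ f []      M = ≈-sym (+-identityˡ _)
  sumOf-++ f (a ∷ L) M = ≈-trans (+-congˡ (sumOf-++ f L M)) (≈-sym (+-assoc _ _ _))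

  sumOf-↭ : ∀ (f : A → Carrier) {L M} → L ↭ M → sumOf f L ≈ sumOf f M
  sumOf-↭ f ↭.refl          = ≈-refl
  sumOf-↭ f (↭.prep a p)    = +-congˡ (sumOf-↭ f p)
  sumOf-↭ f (↭.swap a b p)  = ≈-trans (+-congˡ (+-congˡ (sumOf-↭ f p)))
    (solve 3 (λ a b c → a :+ (b :+ c) := b :+ (a :+ c)) ≈-refl _ _ _)
  sumOf-↭ f (↭.trans p q)   = ≈-trans (sumOf-↭ f p) (sumOf-↭ f q)

  sumOf-≈0 : ∀ {f : A → Carrier} {L} → All (λ a → f a ≈ 0#) L → sumOf f L ≈ 0#
  sumOf-≈0 []        = ≈-refl
  sumOf-≈0 (e ∷ all) = ≈-trans (+-cong e (sumOf-≈0 all)) (+-identityˡ 0#)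

  sumOf-nonNeg : ∀ {f : A → Carrier} {L} → All (NonNeg ∘ f) L → NonNeg (sumOf f L)
  sumOf-nonNeg []        = NonNeg-0
  sumOf-nonNeg (p ∷ all) = NonNeg-+ p (sumOf-nonNeg all)

  sumOf-pos : ∀ {f : A → Carrier} {L} → All (NonNeg ∘ f) L → Any (Pos ∘ f) L → Pos (sumOf f L)
  sumOf-pos (_ ∷ all) (here p)  = Pos-+-NonNeg p (sumOf-nonNeg all)
  sumOf-pos (p ∷ all) (there q) = Pos-resp (+-comm _ _) (Pos-+-NonNeg (sumOf-pos all q) p)

  Apart0 : Carrier → Set
  Apart0 x = Pos x ⊎ Pos (- x)

  Apart0-1 : Apart0 1#
  Apart0-1 = inj₁ Pos-1

  Apart0-* : ∀ {x y} → Apart0 x → Apart0 y → Apart0 (x * y)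
  Apart0-* (inj₁ p) (inj₁ q) = inj₁ (Pos-* p q)
  Apart0-* (inj₁ p) (inj₂ q) = inj₂ (Pos-resp (≈-sym (-‿distribʳ-* _ _)) (Pos-* p q))
  Apart0-* (inj₂ p) (inj₁ q) = inj₂ (Pos-resp (≈-sym (-‿distribˡ-* _ _)) (Pos-* p q))
  Apart0-* (inj₂ p) (inj₂ q) = inj₁ (Pos-resp
    (≈-trans (≈-sym (-‿distribˡ-* _ _)) (≈-trans (-‿cong (≈-sym (-‿distribʳ-* _ _))) (-‿involutive _)))
    (Pos-* p q))

  pivot : ∀ (f : A → Carrier) L →
          ¬ ¬ (All (λ a → f a ≈ 0#) L ⊎ ∃₂ λ p M → L ↭ p ∷ M × Apart0 (f p))
  pivot f []      = return (inj₁ [])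
  pivot f (a ∷ L) = do
    inj₁ fa≈0 ← trichotomy (f a)
      where inj₂ apart → return (inj₂ (a , L , ↭.refl , apart))
    inj₁ all ← pivot f L
      where inj₂ (p , M , L↭p∷M , apart) →
              return (inj₂ (p , a ∷ M , ↭.trans (↭.prep a L↭p∷M) (↭.swap a p ↭.refl) , apart))
    return (inj₁ (fa≈0 ∷ all))

  -- One weight is apart from zero rather than merely nonzero, because its sign has to produce a
  -- strictly positive weight in a Radon partition. Weights belong to list entries, so points may
  -- coincide.
  Dependency : ∀ {d} → (A → Fin d → Carrier) → List A → Set
  Dependency h L = ∃[ M ] map proj₂ M ↭ L × Any (Apart0 ∘ proj₁) M × (∀ i → comb (λ a → h a i) M ≈ 0#)

  -- Gaussian elimination without division.
  dependency : ∀ d (h : A → Fin d → Carrier) L → d ℕ.< length L → ¬ ¬ Dependency h L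
  dependency zero h (a ∷ L) d<l =
    return (map (1# ,_) (a ∷ L) , ↭.↭-reflexive (≡.trans (≡.sym (List.map-∘ (a ∷ L))) (List.map-id (a ∷ L)))
           , here Apart0-1 , λ ())
  dependency (suc d) h L d<l = do
    inj₂ (p , L′ , L↭ , apart) ← pivot (λ a → h a zero) L
      where inj₁ all → do
              M , M↭L , apart , rel ← dependency d (λ a i → h a (suc i)) L (ℕ.<-trans (ℕ.n<1+n d) d<l)
              return (M , M↭L , apart , λ
                { zero    → sumOf-≈0 (All.map (λ e → ≈-trans (*-congˡ e) (zeroʳ _))
                              (All.map⁻ (↭.All-resp-↭ (↭-sym M↭L) all)))
                ; (suc i) → rel i })
    let c = h p zero
    -- Coordinate zero is cleared by multiplying with the pivot entry `c` and subtracting `h a zero`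
    -- times the pivot.
    M , M↭L′ , apart′ , rel ← dependency d
      (λ a i → c * h a (suc i) + (- h a zero) * h p (suc i)) L′
      (ℕ.≤-pred (≡.subst (suc d ℕ.<_) (↭.↭-length L↭) d<l))
    let S : Fin (suc d) → Carrier
        S i = comb (λ a → h a i) M
        scale = λ (w , a) → c * w , a
        scaled : ∀ i → comb (λ a → h a i) (map scale M) ≈ c * S i
        scaled i = begin
          comb (λ a → h a i) (map scale M)           ≡⟨ sumOf-map _ scale M ⟩
          sumOf (λ (w , a) → (c * w) * h a i) M       ≈⟨ sumOf-cong (λ _ → *-assoc _ _ _) M ⟩
          sumOf (λ (w , a) → c * (w * h a i)) M       ≈⟨ sumOf-*ˡ c _ M ⟩
          c * S i                                      ∎
        minus : sumOf (λ (w , a) → w * (- h a zero)) M ≈ - S zero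
        minus = begin
          sumOf (λ (w , a) → w * (- h a zero)) M           ≈⟨ sumOf-cong (λ _ → *-comm _ _) M ⟩
          sumOf (λ (w , a) → (- h a zero) * w) M           ≈⟨ sumOf-cong (λ _ → ≈-sym (-‿distribˡ-* _ _)) M ⟩
          sumOf (λ (w , a) → - (h a zero * w)) M           ≈⟨ sumOf-cong
                (λ _ → ≈-trans (-‿cong (≈-trans (*-comm _ _) (≈-sym (*-identityˡ _)))) (-‿distribˡ-* _ _)) M ⟩
          sumOf (λ (w , a) → (- 1#) * (w * h a zero)) M    ≈⟨ sumOf-*ˡ (- 1#) _ M ⟩
          (- 1#) * S zero                                   ≈⟨ ≈-sym (-‿distribˡ-* _ _) ⟩
          - (1# * S zero)                                   ≈⟨ -‿cong (*-identityˡ _) ⟩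
          - S zero                                          ∎
        eliminated : ∀ i → (- S zero) * h p (suc i) + c * S (suc i) ≈ 0#
        eliminated i = begin
          (- S zero) * h p (suc i) + c * S (suc i)         ≈⟨ +-comm _ _ ⟩
          c * S (suc i) + (- S zero) * h p (suc i)         ≈⟨ +-congˡ (*-congʳ (≈-sym minus)) ⟩
          c * S (suc i) + sumOf (λ (w , a) → w * (- h a zero)) M * h p (suc i)
            ≈⟨ +-cong (≈-sym (sumOf-*ˡ c _ M)) (≈-sym (sumOf-*ʳ _ _ M)) ⟩
          sumOf (λ (w , a) → c * (w * h a (suc i))) M + sumOf (λ (w , a) → w * (- h a zero) * h p (suc i)) M
            ≈⟨ ≈-sym (sumOf-+ _ _ M) ⟩
          sumOf (λ (w , a) → c * (w * h a (suc i)) + w * (- h a zero) * h p (suc i)) M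
            ≈⟨ sumOf-cong (λ _ → solve 5 (λ c w x y z → c :* (w :* x) :+ w :* y :* z
                  := w :* (c :* x :+ y :* z)) ≈-refl _ _ _ _ _) M ⟩
          sumOf (λ (w , a) → w * (c * h a (suc i) + (- h a zero) * h p (suc i))) M
            ≈⟨ rel i ⟩
          0# ∎
    -- Coordinate zero dictates the weight of the pivot. Scaling by `c`, itself apart from zero,
    -- preserves a weight apart from zero.
    return ( (- S zero , p) ∷ map scale M
           , ↭-trans (↭.prep p (↭-trans (↭.↭-reflexive (≡.sym (List.map-∘ M))) M↭L′)) (↭-sym L↭)
           , there (Any.map⁺ (Any.map (Apart0-* apart) apart′))
           , λ { zero    → begin
                   (- S zero) * c + comb (λ a → h a zero) (map scale M) ≈⟨ +-congˡ (scaled zero) ⟩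
                   (- S zero) * c + c * S zero                           ≈⟨ +-congˡ (*-comm _ _) ⟩
                   (- S zero) * c + S zero * c                           ≈⟨ ≈-sym (distribʳ c _ _) ⟩
                   (- S zero + S zero) * c                               ≈⟨ *-congʳ (-‿inverseˡ _) ⟩
                   0# * c                                                ≈⟨ zeroˡ c ⟩
                   0#                                                    ∎
               ; (suc i) → ≈-trans (+-congˡ (scaled (suc i))) (eliminated i) } )

  NonNegs : List (Carrier × A) → Set
  NonNegs = All (NonNeg ∘ proj₁)

  -- Weights are not normalised: in homogeneous coordinates, coordinate zero of `balanced` equates
  -- the two total weights, so a positive weight on either side suffices. Zero weights are allowed,
  -- so that both sides together exhaust `L`.
  record Radon {d} (h : A → Fin d → Carrier) (L : List A) : Set where
    field
      {left right} : List (Carrier × A)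
      partition    : map proj₂ left ++ map proj₂ right ↭ L
      left≥0       : NonNegs left
      right≥0      : NonNegs right
      nontrivial   : Any (Pos ∘ proj₁) left ⊎ Any (Pos ∘ proj₁) right
      balanced     : ∀ i → comb (λ a → h a i) left ≈ comb (λ a → h a i) right

  -- A dependency is sorted by the signs of its weights: negative terms change sides, vanishing ones
  -- stay on the left, and the weight apart from zero becomes positive on its side.
  radon : ∀ {d} (h : A → Fin d → Carrier) L → d ℕ.< length L → ¬ ¬ Radon h L
  radon {A = A} {d} h L d<l = do
    M , M↭L , apart , rel ← dependency d h L d<l
    P , N , p , P≥0 , N≥0 , positive , diff ← split M
    return record
      { partition = ↭-trans p M↭L ; left≥0 = P≥0 ; right≥0 = N≥0
      ; nontrivial = positive apart
      ; balanced = λ i → ≈-trans (diff i) (≈-trans (+-congʳ (rel i)) (+-identityˡ _)) }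
    where
    Split : List (Carrier × A) → Set
    Split M = ∃[ P ] ∃[ N ]
      map proj₂ P ++ map proj₂ N ↭ map proj₂ M × NonNegs P × NonNegs N ×
      (Any (Apart0 ∘ proj₁) M → Any (Pos ∘ proj₁) P ⊎ Any (Pos ∘ proj₁) N) ×
      (∀ i → comb (λ a → h a i) P ≈ comb (λ a → h a i) M + comb (λ a → h a i) N)

    split : ∀ M → ¬ ¬ Split M
    split [] = return ([] , [] , ↭.refl , [] , [] , (λ ()) , λ i → ≈-sym (+-identityˡ 0#))
    split ((w , a) ∷ M) = do
      P , N , p , P≥0 , N≥0 , positive , diff ← split M
      let toLeft : ∀ i → w * h a i + comb (λ a → h a i) P ≈ (w * h a i + comb (λ a → h a i) M) + comb (λ a → h a i) N
          toLeft i = ≈-trans (+-congˡ (diff i)) (≈-sym (+-assoc _ _ _))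
      inj₂ (inj₂ w<0) ← trichotomy w
        where
          inj₁ w≈0 → return
            ( (w , a) ∷ P , N , ↭.prep a p , NonNeg-resp (≈-sym w≈0) NonNeg-0 ∷ P≥0 , N≥0
            , (λ { (here (inj₁ w>0)) → inj₁ (here w>0)
                 ; (here (inj₂ w<0)) → ⊥-elim (¬Pos-0 (Pos-resp (≈-trans (-‿cong w≈0) -0#≈0#) w<0))
                 ; (there any)       → Sum.map₁ there (positive any) })
            , toLeft )
          inj₂ (inj₁ w>0) → return
            ( (w , a) ∷ P , N , ↭.prep a p , Pos⇒NonNeg w>0 ∷ P≥0 , N≥0
            , (λ _ → inj₁ (here w>0)) , toLeft )
      return
        ( P , (- w , a) ∷ N , ↭-trans (↭.shift a (map proj₂ P) (map proj₂ N)) (↭.prep a p)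
        , P≥0 , Pos⇒NonNeg w<0 ∷ N≥0 , (λ _ → inj₂ (here w<0))
        , λ i → begin
            comb (λ a → h a i) P ≈⟨ diff i ⟩
            comb (λ a → h a i) M + comb (λ a → h a i) N ≈⟨ +-congʳ (≈-sym (+-identityˡ _)) ⟩
            (0# + comb (λ a → h a i) M) + comb (λ a → h a i) N     ≈⟨ +-congʳ (+-congʳ (≈-sym (zeroˡ _))) ⟩
            (0# * h a i + comb (λ a → h a i) M) + comb (λ a → h a i) N ≈⟨ +-congʳ
                  (+-congʳ (*-congʳ (≈-sym (-‿inverseʳ w)))) ⟩
            ((w + - w) * h a i + comb (λ a → h a i) M) + comb (λ a → h a i) N
              ≈⟨ solve 5 (λ w v x m n → ((w :+ v) :* x :+ m) :+ n
                    := (w :* x :+ m) :+ (v :* x :+ n)) ≈-refl _ _ _ _ _ ⟩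
            (w * h a i + comb (λ a → h a i) M) + ((- w) * h a i + comb (λ a → h a i) N) ∎ )

  infix 4 _≼_

  -- The difference is kept as data because `differences` uses it as the weight of a vertex.
  _≼_ : Carrier → Carrier → Set
  x ≼ y = ∃[ d ] NonNeg d × y ≈ x + d

  ≼-total : ∀ x y → ¬ ¬ (x ≼ y ⊎ y ≼ x)
  ≼-total x y = do
    inj₂ (inj₁ d>0) ← trichotomy (y + - x)
      where
        inj₁ d≈0 → return (inj₁ (_ , NonNeg-resp (≈-sym d≈0) NonNeg-0 , difference x y))
        inj₂ (inj₂ -d>0) → return (inj₂ (_ , Pos⇒NonNeg -d>0 , (begin
          x                              ≈⟨ ≈-sym (+-identityʳ x) ⟩
          x + 0#                         ≈⟨ +-congˡ (≈-sym (-‿inverseʳ _)) ⟩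
          x + ((y + - x) + - (y + - x))  ≈⟨ ≈-sym (+-assoc _ _ _) ⟩
          (x + (y + - x)) + - (y + - x)  ≈⟨ +-congʳ (≈-sym (difference x y)) ⟩
          y + - (y + - x)                ∎)))
    return (inj₁ (_ , Pos⇒NonNeg d>0 , difference x y))
    where
    difference : ∀ x y → y ≈ x + (y + - x)
    difference x y = begin
      y               ≈⟨ ≈-sym (+-identityʳ y) ⟩
      y + 0#          ≈⟨ +-congˡ (≈-sym (-‿inverseʳ x)) ⟩
      y + (x + - x)   ≈⟨ solve 3 (λ x y z → y :+ (x :+ z) := x :+ (y :+ z)) ≈-refl x y (- x) ⟩
      x + (y + - x)   ∎

  -- The entry of least ratio f / g among those with g > 0.
  RatioMinimum : (f g : A → Carrier) → List A → Set
  RatioMinimum f g L = ∃₂ λ j R → L ↭ j ∷ R × Pos (g j) × All (λ k → f j * g k ≼ g j * f k) R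

  -- The pivot rule of the simplex method. Fractions are compared by cross-multiplication, so
  -- entries with vanishing `g` need no exception: they pass every comparison.
  ratio-minimum : ∀ (f g : A → Carrier) {L} → All (NonNeg ∘ f) L → All (NonNeg ∘ g) L →
                  ¬ ¬ (All (λ a → g a ≈ 0#) L ⊎ RatioMinimum f g L)
  ratio-minimum f g []       []       = return (inj₁ [])
  ratio-minimum f g {a ∷ L} (fa≥0 ∷ f≥0) (ga≥0 ∷ g≥0) = do
    inj₂ (inj₁ ga>0) ← trichotomy (g a)
      where
        inj₂ (inj₂ ga<0) → ⊥-elim (¬Pos-0 (Pos-resp (-‿inverseˡ (g a)) (Pos-+-NonNeg ga<0 ga≥0)))
        inj₁ ga≈0 → do
          inj₂ (j , R , p , gj>0 , min) ← ratio-minimum f g f≥0 g≥0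
            where inj₁ all → return (inj₁ (ga≈0 ∷ all))
          return (inj₂ ( j , a ∷ R , ↭.trans (↭.prep a p) (↭.swap a j ↭.refl) , gj>0
                       , zero-least j (Pos⇒NonNeg gj>0) fa≥0 ga≈0 ∷ min))
    inj₂ (j , R , p , gj>0 , min) ← ratio-minimum f g f≥0 g≥0
      where inj₁ all → return (inj₂ (a , L , ↭.refl , ga>0 ,
              All.zipWith (λ (fk≥0 , gk≈0) → zero-least a (Pos⇒NonNeg ga>0) fk≥0 gk≈0) (f≥0 , all)))
    inj₂ a-least ← ≼-total (f j * g a) (g j * f a)
      where inj₁ j-least → return (inj₂
              (j , a ∷ R , ↭.trans (↭.prep a p) (↭.swap a j ↭.refl) , gj>0 , j-least ∷ min))
    return (inj₂ ( a , j ∷ R , ↭.prep a p , ga>0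
                 , resp-≼ (*-comm _ _) (*-comm _ _) a-least
                   ∷ All.zipWith (λ (gk≥0 , least) → transfer gj>0 (Pos⇒NonNeg ga>0) gk≥0 a-least least)
                       (All.tail (↭.All-resp-↭ p g≥0) , min)))
    where
    resp-≼ : ∀ {x x′ y y′} → x ≈ x′ → y ≈ y′ → x ≼ y → x′ ≼ y′
    resp-≼ x≈x′ y≈y′ (d , d≥0 , eq) = d , d≥0 , ≈-trans (≈-sym y≈y′) (≈-trans eq (+-congʳ x≈x′))

    zero-least : ∀ j {k} → NonNeg (g j) → NonNeg (f k) → g k ≈ 0# → f j * g k ≼ g j * f k
    zero-least j {k} gj≥0 fk≥0 gk≈0 = _ , NonNeg-* gj≥0 fk≥0 , ≈-sym
      (≈-trans (+-congʳ (≈-trans (*-congˡ gk≈0) (zeroʳ _))) (+-identityˡ _))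

    -- Transitivity for cross-multiplied fractions: the two hypotheses chain to the conclusion
    -- multiplied by `gj`, which its inverse `r` then cancels.
    transfer : ∀ {fa ga fj gj fk gk} → Pos gj → NonNeg ga → NonNeg gk →
               gj * fa ≼ fj * ga → fj * gk ≼ gj * fk → fa * gk ≼ ga * fk
    transfer {fa} {ga} {fj} {gj} {fk} {gk} gj>0 ga≥0 gk≥0 (d , d≥0 , p) (e , e≥0 , q) =
      let r , r>0 , gj*r≈1 = inverse gj>0 in
      r * (ga * e + gk * d)
      , NonNeg-* (Pos⇒NonNeg r>0) (NonNeg-+ (NonNeg-* ga≥0 e≥0) (NonNeg-* gk≥0 d≥0))
      , (begin
        ga * fk                              ≈⟨ ≈-sym (≈-trans (*-congʳ gj*r≈1) (*-identityˡ _)) ⟩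
        (gj * r) * (ga * fk)
          ≈⟨ solve 4 (λ gj r ga fk → (gj :* r) :* (ga :* fk) := r :* (ga :* (gj :* fk))) ≈-refl _ _ _ _ ⟩
        r * (ga * (gj * fk))                 ≈⟨ *-congˡ (*-congˡ q) ⟩
        r * (ga * (fj * gk + e))
          ≈⟨ solve 5 (λ r ga fj gk e → r :* (ga :* (fj :* gk :+ e))
                := r :* (gk :* (fj :* ga) :+ ga :* e)) ≈-refl _ _ _ _ _ ⟩
        r * (gk * (fj * ga) + ga * e)        ≈⟨ *-congˡ (+-congʳ (*-congˡ p)) ⟩
        r * (gk * (gj * fa + d) + ga * e)
          ≈⟨ solve 7 (λ r gk gj fa d ga e → r :* (gk :* (gj :* fa :+ d) :+ ga :* e)
                        := (gj :* r) :* (fa :* gk) :+ r :* (ga :* e :+ gk :* d)) ≈-refl _ _ _ _ _ _ _ ⟩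
        (gj * r) * (fa * gk) + r * (ga * e + gk * d)
          ≈⟨ +-congʳ (≈-trans (*-congʳ gj*r≈1) (*-identityˡ _)) ⟩
        fa * gk + r * (ga * e + gk * d)      ∎)

AllPairs-resp-↭ : ∀ {R : A → A → Set} → (∀ {x y} → R x y → R y x) →
                  ∀ {L M} → L ↭ M → AllPairs R L → AllPairs R M
AllPairs-resp-↭ sym ↭.refl         all = all
AllPairs-resp-↭ sym (↭.prep x p)   (x≀ ∷ all) = ↭.All-resp-↭ p x≀ ∷ AllPairs-resp-↭ sym p all
AllPairs-resp-↭ sym (↭.swap x y p) ((xy ∷ x≀) ∷ y≀ ∷ all) =
  (sym xy ∷ ↭.All-resp-↭ p y≀) ∷ ↭.All-resp-↭ p x≀ ∷ AllPairs-resp-↭ sym p all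
AllPairs-resp-↭ sym (↭.trans p q)  all = AllPairs-resp-↭ sym q (AllPairs-resp-↭ sym p all)

-- Rigidity of five-cliques in the graph of selected pairs

module MidpointGraph (F : OrderedField) where

  open OrderedField F hiding (zero) renaming (refl to ≈-refl; sym to ≈-sym; trans to ≈-trans)
  open LinearAlgebra F

  -- Points of an affine 3-space are given by homogeneous coordinates h, of which
  -- the first is 1.  Midpoints are replaced by the sums h u + h v.
  module Rigidity
    {V : Set} (h : V → Fin 4 → Carrier) (unit : ∀ v → h v zero ≈ 1#)
    (_~_ : V → V → Set) (~-sym : ∀ {u v} → u ~ v → v ~ u) (~⇒≢ : ∀ {u v} → u ~ v → u ≢ v)
    -- The disjunction says that {u, v} and {s, t} differ as unordered pairs. Allowing any positive
    -- total weight `W` avoids normalising in the arguments below.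
    (exposed : ∀ {u v} → u ~ v → (L : List (Carrier × V × V)) →
       All (λ (w , s , t) → NonNeg w × s ~ t × (u ≢ s × u ≢ t ⊎ v ≢ s × v ≢ t)) L →
       ∀ {W} → Pos W →
       ¬ (∀ i → sumOf (λ (w , s , t) → w * (h s i + h t i)) L ≈ W * (h u i + h v i)))
    where

    open SemiringSolver commutativeSemiring
    open import Relation.Binary.Reasoning.Setoid setoid

    -- Vertices are read off labels because the second Radon partition is taken over the weighted
    -- vertices of the first, where each vertex carries two weights.
    module _ (vtx : A → V) where

      hull : List (Carrier × A) → Fin 4 → Carrier
      hull L i = comb (λ a → h (vtx a) i) L

      hull-weight : ∀ L → hull L zero ≈ weight L
      hull-weight = sumOf-cong (λ _ → ≈-trans (*-congˡ (unit _)) (*-identityʳ _))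

      edge-sum : ∀ c v L i → sumOf (λ (w , a) → (w * c) * (h v i + h (vtx a) i)) L
                             ≈ c * (weight L * h v i + hull L i)
      edge-sum c v L i = begin
        sumOf (λ (w , a) → (w * c) * (h v i + h (vtx a) i)) L
          ≈⟨ sumOf-cong (λ _ → solve 4 (λ w c x y → (w :* c) :* (x :+ y)
                := c :* (w :* x :+ w :* y)) ≈-refl _ _ _ _) L ⟩
        sumOf (λ (w , a) → c * (w * h v i + w * h (vtx a) i)) L
          ≈⟨ sumOf-*ˡ c _ L ⟩
        c * sumOf (λ (w , a) → w * h v i + w * h (vtx a) i) L
          ≈⟨ *-congˡ (sumOf-+ _ _ L) ⟩
        c * (sumOf (λ (w , a) → w * h v i) L + hull L i)
          ≈⟨ *-congˡ (+-congʳ (sumOf-*ʳ _ proj₁ L)) ⟩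
        c * (weight L * h v i + hull L i) ∎

      -- Coordinate zero shows that `L` has total weight `W`. Adding `W * h z i` to both sides then
      -- turns the combination into one of sums along edges at `z`, contradicting that the edge from
      -- `u` to `z` is exposed.
      neighbours-independent : ∀ {u z} → u ~ z → (L : List (Carrier × A)) →
        All (λ (w , a) → NonNeg w × vtx a ~ z × u ≢ vtx a) L →
        ∀ {W} → Pos W → ¬ (∀ i → hull L i ≈ W * h u i)
      neighbours-independent {u} {z} u~z L all {W} W>0 eq = exposed u~z
        (map (λ (w , a) → w * 1# , z , vtx a) L)
        (All.map⁺ (All.map (λ (w≥0 , a~z , u≢a) →
          NonNeg-* w≥0 (Pos⇒NonNeg Pos-1) , ~-sym a~z , inj₁ (~⇒≢ u~z , u≢a)) all))
        W>0 λ i → begin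
          sumOf (λ (w , s , t) → w * (h s i + h t i)) (map (λ (w , a) → w * 1# , z , vtx a) L)
            ≡⟨ sumOf-map _ _ L ⟩
          sumOf (λ (w , a) → (w * 1#) * (h z i + h (vtx a) i)) L
            ≈⟨ edge-sum 1# z L i ⟩
          1# * (weight L * h z i + hull L i)
            ≈⟨ *-identityˡ _ ⟩
          weight L * h z i + hull L i
            ≈⟨ +-cong (*-congʳ weight≈W) (eq i) ⟩
          W * h z i + W * h u i
            ≈⟨ solve 3 (λ w x y → w :* x :+ w :* y := w :* (y :+ x)) ≈-refl _ _ _ ⟩
          W * (h u i + h z i) ∎
        where
        weight≈W : weight L ≈ W
        weight≈W = ≈-trans (≈-sym (hull-weight L))
          (≈-trans (eq zero) (≈-trans (*-congˡ (unit u)) (*-identityʳ W)))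

      -- The point on the edge need not be its midpoint, so the weights are crossed: edges from `a`
      -- get the factor `β`, edges from `b` the factor `α`. The total is then symmetric, namely (α +
      -- β)² times the sum of `a` and `b`, and the edge would not be exposed.
      edge-avoids-hull : ∀ {α β a b} → NonNeg α → NonNeg β → Pos (α + β) → vtx a ~ vtx b →
        (L : List (Carrier × A)) → All (NonNeg ∘ proj₁) L →
        All (λ c → vtx a ~ vtx (proj₂ c)) L → All (λ c → vtx b ~ vtx (proj₂ c)) L →
        ¬ (∀ i → α * h (vtx a) i + β * h (vtx b) i ≈ hull L i)
      edge-avoids-hull {α} {β} {a} {b} α≥0 β≥0 α+β>0 a~b L L≥0 a~ b~ eq = exposed a~b
        (map (λ (w , c) → w * β , vtx a , vtx c) L ++ map (λ (w , c) → w * α , vtx b , vtx c) L)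
        (All.++⁺
          (All.map⁺ (All.zipWith (λ { (w≥0 , a~c , b~c) → NonNeg-* w≥0 β≥0 , a~c , inj₂ (~⇒≢ (~-sym a~b) , ~⇒≢ b~c) })
            (L≥0 , All.zip (a~ , b~))))
          (All.map⁺ (All.zipWith (λ { (w≥0 , a~c , b~c) → NonNeg-* w≥0 α≥0 , b~c , inj₁ (~⇒≢ a~b , ~⇒≢ a~c) })
            (L≥0 , All.zip (a~ , b~)))))
        (Pos-* α+β>0 α+β>0) λ i → begin
          sumOf _ (map (λ (w , c) → w * β , vtx a , vtx c) L ++ map (λ (w , c) → w * α , vtx b , vtx c) L)
            ≈⟨ sumOf-++ _ (map _ L) (map _ L) ⟩
          sumOf _ (map (λ (w , c) → w * β , vtx a , vtx c) L) + sumOf _ (map (λ (w , c) → w * α , vtx b , vtx c) L)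
            ≡⟨ ≡.cong₂ _+_ (sumOf-map _ _ L) (sumOf-map _ _ L) ⟩
          sumOf (λ (w , c) → (w * β) * (h (vtx a) i + h (vtx c) i)) L + sumOf
                (λ (w , c) → (w * α) * (h (vtx b) i + h (vtx c) i)) L
            ≈⟨ +-cong (edge-sum β (vtx a) L i) (edge-sum α (vtx b) L i) ⟩
          β * (weight L * h (vtx a) i + hull L i) + α * (weight L * h (vtx b) i + hull L i)
            ≈⟨ +-cong (*-congˡ (+-cong (*-congʳ weight≈) (≈-sym (eq i))))
                      (*-congˡ (+-cong (*-congʳ weight≈) (≈-sym (eq i)))) ⟩
          β * ((α + β) * h (vtx a) i + (α * h (vtx a) i + β * h (vtx b) i))
            + α * ((α + β) * h (vtx b) i + (α * h (vtx a) i + β * h (vtx b) i))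
            ≈⟨ solve 4 (λ α β x y → β :* ((α :+ β) :* x :+ (α :* x :+ β :* y)) :+ α
                  :* ((α :+ β) :* y :+ (α :* x :+ β :* y))
                         := ((α :+ β) :* (α :+ β)) :* (x :+ y)) ≈-refl _ _ _ _ ⟩
          ((α + β) * (α + β)) * (h (vtx a) i + h (vtx b) i) ∎
        where
        weight≈ : weight L ≈ α + β
        weight≈ = ≈-trans (≈-sym (hull-weight L)) (≈-trans (≈-sym (eq zero))
          (+-cong (≈-trans (*-congˡ (unit _)) (*-identityʳ α)) (≈-trans (*-congˡ (unit _)) (*-identityʳ β))))

      record Centre (L : List A) : Set where
        field
          {coefficient} : Carrier
          {centre}      : A
          {others}      : List (Carrier × A)
          positive      : Pos coefficient
          nonNegative   : NonNegs others
          covers        : centre ∷ map proj₂ others ↭ L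
          balance       : ∀ i → coefficient * h (vtx centre) i ≈ hull others i

      -- Of five entries one side has at most two. It is not empty, since both sides have the same
      -- positive total weight, and not an edge, by `edge-avoids-hull`; so it is the centre.
      radon-centre : ∀ {L} → length L ≡ 5 → AllPairs (_~_ on vtx) L → Radon (λ a → h (vtx a)) L → Centre L
      radon-centre {L} length≡5 adjacent r = cases (ℕ.≤-<-connex (length left) 2)
        where
        open Radon r

        small : ∀ {P N} → map proj₂ P ++ map proj₂ N ↭ L → NonNegs P → NonNegs N → Pos (weight P) →
                (∀ i → hull P i ≈ hull N i) → length P ℕ.≤ 2 → Centre L
        small {[]} _ _ _ 0>0 _ _ = ⊥-elim (¬Pos-0 0>0)
        small {(α , a) ∷ []} p _ N≥0 α>0 eq _ = record
          { positive = Pos-resp (+-identityʳ α) α>0 ; nonNegative = N≥0 ; covers = p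
          ; balance = λ i → ≈-trans (≈-sym (+-identityʳ _)) (eq i) }
        small {(α , a) ∷ (β , b) ∷ []} {N} p (α≥0 ∷ β≥0 ∷ []) N≥0 α+β>0 eq _
          with (a~b ∷ a~) ∷ b~ ∷ _ ← AllPairs-resp-↭ ~-sym (↭-sym p) adjacent =
          ⊥-elim (edge-avoids-hull α≥0 β≥0 (Pos-resp (+-congˡ (+-identityʳ β)) α+β>0) a~b
            N N≥0 (All.map⁻ a~) (All.map⁻ b~)
            λ i → ≈-trans (+-congˡ (≈-sym (+-identityʳ _))) (eq i))
        small {_ ∷ _ ∷ _ ∷ _} _ _ _ _ _ (s≤s (s≤s ()))

        weights-equal : weight left ≈ weight right
        weights-equal = ≈-trans (≈-sym (hull-weight left)) (≈-trans (balanced zero) (hull-weight right))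

        left>0 : Pos (weight left)
        left>0 with nontrivial
        ... | inj₁ any = sumOf-pos left≥0 any
        ... | inj₂ any = Pos-resp (≈-sym weights-equal) (sumOf-pos right≥0 any)

        lengths : length left ℕ.+ length right ≡ 5
        lengths = ≡.trans (≡.sym (≡.cong₂ ℕ._+_ (List.length-map proj₂ left) (List.length-map proj₂ right)))
          (≡.trans (≡.sym (List.length-++ (map proj₂ left))) (≡.trans (↭.↭-length partition) length≡5))

        cases : length left ℕ.≤ 2 ⊎ 2 ℕ.< length left → Centre L
        cases (inj₁ left≤2) = small partition left≥0 right≥0 left>0 balanced left≤2
        cases (inj₂ left>2) = small (↭-trans (↭.++-comm (map proj₂ right) (map proj₂ left)) partition)
          right≥0 left≥0 (Pos-resp weights-equal left>0) (λ i → ≈-sym (balanced i))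
          (ℕ.+-cancelˡ-≤ 3 _ _ (ℕ.≤-trans (ℕ.+-monoˡ-≤ (length right) left>2) (ℕ.≤-reflexive lengths)))

    private
      Weighted = Carrier × V

    -- The weights of `D` are the differences y μ - x ν. With `x` and `y` the two weights of the
    -- entry of least ratio, this is what remains after eliminating that entry from two
    -- combinations.
    differences : ∀ {x y} {R : List (Carrier × Weighted)} → All (λ (ν , μ , v) → x * ν ≼ y * μ) R →
      ∃[ D ] NonNegs D × map proj₂ D ≡ map (proj₂ ∘ proj₂) R ×
        (∀ i → x * hull proj₂ R i + hull id D i ≈ y * hull id (map proj₂ R) i)
    differences {x} {y} [] = [] , [] , ≡.refl , λ i → ≈-trans (+-identityʳ _) (≈-trans (zeroʳ x) (≈-sym (zeroʳ y)))
    differences {x} {y} {(ν , μ , v) ∷ R} ((d , d≥0 , eq) ∷ all) =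
      let D , D≥0 , vertices , rel = differences all in
      (d , v) ∷ D , d≥0 ∷ D≥0 , ≡.cong (v ∷_) vertices , λ i → begin
        x * (ν * h v i + hull proj₂ R i) + (d * h v i + hull id D i)
          ≈⟨ solve 6 (λ x ν u r d e → x :* (ν :* u :+ r) :+ (d :* u :+ e)
                := (x :* ν :+ d) :* u :+ (x :* r :+ e)) ≈-refl _ _ _ _ _ _ ⟩
        (x * ν + d) * h v i + (x * hull proj₂ R i + hull id D i)
          ≈⟨ +-cong (*-congʳ (≈-sym eq)) (rel i) ⟩
        (y * μ) * h v i + y * hull id (map proj₂ R) i
          ≈⟨ ≈-trans (+-congʳ (*-assoc _ _ _)) (≈-sym (distribˡ y _ _)) ⟩
        y * (μ * h v i + hull id (map proj₂ R) i) ∎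

    module _ {p p′ : V} (p′≢p : p′ ≢ p) {α : Carrier} (α>0 : Pos α) {N : List Weighted} (N≥0 : NonNegs N)
             (N-clique : AllPairs (_~_ on proj₂) N) (p~ : All ((p ~_) ∘ proj₂) N) (p′~ : All ((p′ ~_) ∘ proj₂) N)
             (p-inside : ∀ i → α * h p i ≈ hull id N i) where

      -- Substituting the expression for `q` into the one for `p` eliminates `q`. This puts `p` into
      -- the hull of `p′` and the rest of `N`, all of them neighbours of `q`, as is `p`.
      other-centre : ∀ {ω μ q ν N′} → (μ , q) ∷ map proj₂ N′ ↭ N → Pos ω → NonNeg ν → NonNegs N′ →
                     ¬ (∀ i → ω * h q i ≈ ν * h p′ i + hull proj₂ N′ i)
      other-centre {ω} {μ} {q} {ν} {N′} perm ω>0 ν≥0 N′≥0 q-inside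
        with μ≥0 ∷ μs≥0 ← ↭.All-resp-↭ (↭-sym perm) N≥0
           | q~ ∷ _      ← AllPairs-resp-↭ ~-sym (↭-sym perm) N-clique
           | p~q ∷ p~′   ← ↭.All-resp-↭ (↭-sym perm) p~
           | p′~q ∷ _    ← ↭.All-resp-↭ (↭-sym perm) p′~ =
        neighbours-independent id p~q
          ((μ * ν , p′) ∷ map (λ (ν , μ′ , v) → μ * ν + ω * μ′ , v) N′)
          ((NonNeg-* μ≥0 ν≥0 , p′~q , p′≢p ∘ ≡.sym)
           ∷ All.map⁺ (All.zipWith (λ ((ν≥0 , μ′≥0) , q~v , p~v) →
                NonNeg-+ (NonNeg-* μ≥0 ν≥0) (NonNeg-* (Pos⇒NonNeg ω>0) μ′≥0) , ~-sym q~v , ~⇒≢ p~v)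
              (All.zip (N′≥0 , All.map⁻ μs≥0) , All.zip (All.map⁻ q~ , All.map⁻ p~′))))
          (Pos-* ω>0 α>0) λ i → begin
            (μ * ν) * h p′ i + hull id (map (λ (ν , μ′ , v) → μ * ν + ω * μ′ , v) N′) i
              ≡⟨ ≡.cong (_ +_) (sumOf-map _ _ N′) ⟩
            (μ * ν) * h p′ i + sumOf (λ (ν , μ′ , v) → (μ * ν + ω * μ′) * h v i) N′
              ≈⟨ +-congˡ (sumOf-cong (λ _ → solve 5 (λ μ ν ω μ′ x → (μ :* ν :+ ω :* μ′) :* x
                    := μ :* (ν :* x) :+ ω :* (μ′ :* x)) ≈-refl _ _ _ _ _) N′) ⟩
            (μ * ν) * h p′ i + sumOf (λ (ν , μ′ , v) → μ * (ν * h v i) + ω * (μ′ * h v i)) N′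
              ≈⟨ +-congˡ (≈-trans (sumOf-+ _ _ N′) (+-cong (sumOf-*ˡ μ _ N′) (sumOf-*ˡ ω _ N′))) ⟩
            (μ * ν) * h p′ i + (μ * hull proj₂ N′ i + ω * sumOf (λ (ν , μ′ , v) → μ′ * h v i) N′)
              ≈⟨ solve 6 (λ μ ν x s ω t → (μ :* ν) :* x :+ (μ :* s :+ ω :* t)
                    := μ :* (ν :* x :+ s) :+ ω :* t) ≈-refl _ _ _ _ _ _ ⟩
            μ * (ν * h p′ i + hull proj₂ N′ i) + ω * sumOf (λ (ν , μ′ , v) → μ′ * h v i) N′
              ≈⟨ +-congʳ (*-congˡ (≈-sym (q-inside i))) ⟩
            μ * (ω * h q i) + ω * sumOf (λ (ν , μ′ , v) → μ′ * h v i) N′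
              ≈⟨ solve 4 (λ μ ω x t → μ :* (ω :* x) :+ ω :* t := ω :* (μ :* x :+ t)) ≈-refl _ _ _ _ ⟩
            ω * (μ * h q i + sumOf (λ (ν , μ′ , v) → μ′ * h v i) N′)
              ≡⟨ ≡.cong (λ s → ω * (μ * h q i + s)) (≡.sym (sumOf-map _ proj₂ N′)) ⟩
            ω * hull id ((μ , q) ∷ map proj₂ N′) i
              ≈⟨ *-congˡ (≈-trans (sumOf-↭ _ perm) (≈-sym (p-inside i))) ⟩
            ω * (α * h p i)
              ≈⟨ ≈-sym (*-assoc _ _ _) ⟩
            (ω * α) * h p i ∎

      -- If `p′` lies in the simplex as well, it subdivides the simplex into the hulls of `p′` with
      -- a facet, and `p` lies in one of them. The facet is the one opposite the vertex `q` with
      -- least μ / ν: eliminating `q` leaves weights ν μ_v - μ ν_v, which are nonnegative by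
      -- minimality.
      same-centre : ∀ {ω N′} → map proj₂ N′ ↭ N → Pos ω → NonNegs N′ →
                    ¬ (∀ i → ω * h p′ i ≈ hull proj₂ N′ i)
      same-centre {ω} {N′} perm ω>0 N′≥0 p′-inside = contradict id
        where
        contradict : ¬ ¬ ⊥
        contradict = do
          inj₂ ((ν , μ , q) , R , split , ν>0 , least) ←
              ratio-minimum (proj₁ ∘ proj₂) proj₁ (All.map⁻ (↭.All-resp-↭ (↭-sym perm) N≥0)) N′≥0
            -- If all `ν` vanish, coordinate zero makes the positive `ω` vanish too.
            where inj₁ all≈0 → λ _ → ¬Pos-0 (Pos-resp
                    (≈-trans (≈-sym (≈-trans (*-congˡ (unit p′)) (*-identityʳ ω)))
                      (≈-trans (p′-inside zero) (≈-trans (hull-weight proj₂ N′) (sumOf-≈0 all≈0))))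
                    ω>0)
          let perm′ : (μ , q) ∷ map proj₂ R ↭ N
              perm′ = ↭-trans (↭.map⁺ proj₂ (↭-sym split)) perm
              D , D≥0 , vertices , rel = differences least
              onD : ∀ {P : V → Set} → All (P ∘ proj₂) (map proj₂ R) → All (P ∘ proj₂) D
              onD {P} all = All.map⁻ (≡.subst (All P) (≡.sym vertices) (All.map⁺ (All.map⁻ all)))
              μ≥0 = All.head (↭.All-resp-↭ (↭-sym perm′) N≥0)
              p~R = ↭.All-resp-↭ (↭-sym perm′) p~
              p′~q = All.head (↭.All-resp-↭ (↭-sym perm′) p′~)
              q~R = AllPairs.head (AllPairs-resp-↭ ~-sym (↭-sym perm′) N-clique)
          return (neighbours-independent id (All.head p~R) ((μ * ω , p′) ∷ D)
            ((NonNeg-* μ≥0 (Pos⇒NonNeg ω>0) , p′~q , p′≢p ∘ ≡.sym)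
             ∷ All.zipWith (λ (d≥0 , q~v , p~v) → d≥0 , ~-sym q~v , ~⇒≢ p~v)
                 (D≥0 , All.zip (onD q~R , onD (All.tail p~R))))
            (Pos-* ν>0 α>0) λ i → begin
              (μ * ω) * h p′ i + hull id D i
                ≈⟨ +-congʳ (≈-trans (*-assoc _ _ _) (*-congˡ (≈-trans (p′-inside i) (sumOf-↭ _ split)))) ⟩
              μ * (ν * h q i + hull proj₂ R i) + hull id D i
                ≈⟨ solve 5 (λ μ ν x s d → μ :* (ν :* x :+ s) :+ d
                      := ν :* (μ :* x) :+ (μ :* s :+ d)) ≈-refl _ _ _ _ _ ⟩
              ν * (μ * h q i) + (μ * hull proj₂ R i + hull id D i)
                ≈⟨ +-congˡ (rel i) ⟩
              ν * (μ * h q i) + ν * hull id (map proj₂ R) i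
                ≈⟨ ≈-sym (distribˡ ν _ _) ⟩
              ν * hull id ((μ , q) ∷ map proj₂ R) i
                ≈⟨ *-congˡ (≈-trans (sumOf-↭ _ perm′) (≈-sym (p-inside i))) ⟩
              ν * (α * h p i)
                ≈⟨ ≈-sym (*-assoc _ _ _) ⟩
              (ν * α) * h p i ∎)

    -- Which vertex is the centre is known only under a double negation. Hence the form:
    -- replacements for all vertices at once are refuted, and only the one for the centre is used.
    five-clique-rigid : ∀ {L} → length L ≡ 5 → AllPairs _~_ L →
      ¬ (∀ {p} → p ∈ L → ∃[ p′ ] p′ ≢ p × (∀ {v} → v ∈ L → v ≢ p → p′ ~ v))
    five-clique-rigid {L} length≡5 clique replace = contradict id
      where
      replaced : Centre id L → ¬ ¬ ⊥
      contradict : ¬ ¬ ⊥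
      contradict = do
        r ← radon h L (ℕ.≤-reflexive (≡.sym length≡5))
        replaced (radon-centre id length≡5 clique r)

      -- The new vertex is either the centre of the second partition or one of its other entries,
      -- and each case has its own elimination. Its weight `0#` is a placeholder that makes it a
      -- weighted vertex like those of `N`.
      second : ∀ {p p′ α N} → p′ ≢ p → Pos α → NonNegs N → AllPairs (_~_ on proj₂) N →
               All ((p ~_) ∘ proj₂) N → All ((p′ ~_) ∘ proj₂) N → (∀ i → α * h p i ≈ hull id N i) →
               ¬ Centre proj₂ ((0# , p′) ∷ N)
      second p′≢p α>0 N≥0 clique p~ p′~ inside c = locate (↭.∈-resp-↭ (↭-sym covers) (here ≡.refl))
        where
        open Centre c
        locate : _ ∈ centre ∷ map proj₂ others → ⊥
        locate (here ≡.refl) =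
          same-centre p′≢p α>0 N≥0 clique p~ p′~ inside (↭.drop-∷ covers) positive nonNegative balance
        locate (there mem)
          with (ν , _) , mem′ , ≡.refl ← ∈-map⁻ proj₂ mem
          with xs , ys , eq ← ∈-∃++ mem′ =
          let perm = ↭-trans (↭.↭-reflexive eq) (↭.shift _ xs ys)
              weights≥0 = ↭.All-resp-↭ perm nonNegative
          in other-centre p′≢p α>0 N≥0 clique p~ p′~ inside
            (↭.drop-∷ (↭-trans (↭.swap _ _ ↭.refl) (↭-trans (↭.prep centre (↭-sym (↭.map⁺ proj₂ perm))) covers)))
            positive (All.head weights≥0) (All.tail weights≥0) (λ i → ≈-trans (balance i) (sumOf-↭ _ perm))

      replaced c = do
        r′ ← radon (h ∘ proj₂) L′ (ℕ.≤-reflexive (≡.sym length′))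
        return (second p′≢p positive nonNegative (AllPairs.map⁻ clique′) (All.map⁻ p~) (All.map⁻ p′~) balance
          (radon-centre proj₂ length′ (All.map⁻ p′~ ∷ AllPairs.map⁻ clique′) r′))
        where
        open Centre c
        reordered = AllPairs-resp-↭ ~-sym (↭-sym covers) clique
        p~ = AllPairs.head reordered
        clique′ = AllPairs.tail reordered
        p′ = proj₁ (replace (↭.∈-resp-↭ covers (here ≡.refl)))
        p′≢p = proj₁ (proj₂ (replace (↭.∈-resp-↭ covers (here ≡.refl))))
        p′~ : All (p′ ~_) (map proj₂ others)
        p′~ = All.tabulate λ v∈ → proj₂ (proj₂ (replace (↭.∈-resp-↭ covers (here ≡.refl))))
          (↭.∈-resp-↭ covers (there v∈)) (~⇒≢ (All.lookup p~ v∈) ∘ ≡.sym)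
        L′ = (0# , p′) ∷ others
        length′ : length L′ ≡ 5
        length′ = ≡.trans (≡.cong suc (≡.sym (List.length-map proj₂ others))) (≡.trans (↭.↭-length covers) length≡5)

-- Counting by sums over lists

module ListSums where

  open import Data.Nat.Base using (_+_; _*_; _≤_; _<_)

  total : (A → ℕ) → List A → ℕ
  total f []      = 0
  total f (a ∷ L) = f a + total f L

  total-cong : ∀ {f g : A → ℕ} → (∀ a → f a ≡ g a) → ∀ L → total f L ≡ total g L
  total-cong f≡g []      = refl
  total-cong f≡g (a ∷ L) = cong₂ _+_ (f≡g a) (total-cong f≡g L)

  total-++ : ∀ (f : A → ℕ) L M → total f (L ++ M) ≡ total f L + total f M
  total-++ f []      M = refl
  total-++ f (a ∷ L) M = trans (cong (f a +_) (total-++ f L M)) (sym (ℕ.+-assoc (f a) _ _))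

  total-+ : ∀ (f g : A → ℕ) L → total (λ a → f a + g a) L ≡ total f L + total g L
  total-+ f g []      = refl
  total-+ f g (a ∷ L) = trans (cong (f a + g a +_) (total-+ f g L))
    (solve 4 (λ a b c d → a :+ b :+ (c :+ d) := a :+ c :+ (b :+ d)) refl (f a) (g a) _ _)
    where open ℕSolver

  total-map : ∀ (f : B → ℕ) (g : A → B) L → total f (map g L) ≡ total (f ∘ g) L
  total-map f g []      = refl
  total-map f g (a ∷ L) = cong (f (g a) +_) (total-map f g L)

  total-↭ : ∀ (f : A → ℕ) {L M} → L ↭ M → total f L ≡ total f M
  total-↭ f ↭.refl          = refl
  total-↭ f (↭.prep a p)    = cong (f a +_) (total-↭ f p)
  total-↭ f (↭.swap a b p)  = trans (cong (λ t → f a + (f b + t)) (total-↭ f p))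
    (solve 3 (λ a b c → a :+ (b :+ c) := b :+ (a :+ c)) refl (f a) (f b) _)
    where open ℕSolver
  total-↭ f (↭.trans p q)   = trans (total-↭ f p) (total-↭ f q)

  total-≤ : ∀ (f : A → ℕ) {c L} → All (λ a → f a ≤ c) L → total f L ≤ c * length L
  total-≤ f []        = z≤n
  total-≤ f {c} (p ∷ all) = ℕ.≤-trans (ℕ.+-mono-≤ p (total-≤ f all)) (ℕ.≤-reflexive (sym (ℕ.*-suc c _)))

  double : (A → A → ℕ) → List A → List A → ℕ
  double e L M = total (λ a → total (e a) M) L

  double-comm : ∀ {e : A → A → ℕ} → (∀ a b → e a b ≡ e b a) → ∀ L M → double e L M ≡ double e M L
  double-comm e-sym []      []      = refl
  double-comm e-sym []      (b ∷ M) = double-comm e-sym [] M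
  double-comm {e = e} e-sym (a ∷ L) M = trans
    (cong₂ _+_ (total-cong (e-sym a) M) (double-comm e-sym L M))
    (sym (total-+ (λ b → e b a) (λ b → total (e b) L) M))

  double-↭ : ∀ (e : A → A → ℕ) {L M} → L ↭ M → double e L L ≡ double e M M
  double-↭ e {L} p = trans (total-cong (λ a → total-↭ (e a) p) L) (total-↭ _ p)

  double-++ : ∀ {e : A → A → ℕ} → (∀ a b → e a b ≡ e b a) → ∀ Q R →
              double e (Q ++ R) (Q ++ R) ≡ double e Q Q + (2 * double e R Q + double e R R)
  double-++ {e = e} e-sym Q R = begin
    double e (Q ++ R) (Q ++ R)
      ≡⟨ total-++ _ Q R ⟩
    double e Q (Q ++ R) + double e R (Q ++ R)
      ≡⟨ cong₂ _+_ (split Q) (split R) ⟩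
    (double e Q Q + double e Q R) + (double e R Q + double e R R)
      ≡⟨ cong (λ t → (double e Q Q + t) + (double e R Q + double e R R)) (double-comm e-sym Q R) ⟩
    (double e Q Q + double e R Q) + (double e R Q + double e R R)
      ≡⟨ solve 3 (λ q x r → (q :+ x) :+ (x :+ r) := q :+ (con 2 :* x :+ r)) refl (double e Q Q) (double e R Q)
            (double e R R) ⟩
    double e Q Q + (2 * double e R Q + double e R R) ∎
    where
    open ≡.≡-Reasoning
    open ℕSolver
    split : ∀ L → double e L (Q ++ R) ≡ double e L Q + double e L R
    split L = trans (total-cong (λ a → total-++ (e a) Q R) L) (total-+ _ _ L)

  total-cartesianProduct : ∀ (f : A × B → ℕ) L M →
    total f (cartesianProduct L M) ≡ total (λ a → total (λ b → f (a , b)) M) L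
  total-cartesianProduct f []      M = refl
  total-cartesianProduct f (a ∷ L) M = trans (total-++ f (map (a ,_) M) _)
    (cong₂ _+_ (total-map f (a ,_) M) (total-cartesianProduct f L M))

  length≤total : ∀ {f : A → ℕ} {L M} → Unique L → (∀ {a} → a ∈ L → a ∈ M) → All (λ a → 1 ≤ f a) L →
                 length L ≤ total f M
  length≤total [] _ [] = z≤n
  length≤total {f = f} {a ∷ L} {M} (a≢ ∷ unique) L⊆M (p ∷ all)
    with xs , ys , refl ← ∈-∃++ (L⊆M (here refl)) =
    ℕ.≤-trans (ℕ.+-mono-≤ p (length≤total unique L⊆rest all))
      (ℕ.≤-reflexive (sym (total-↭ f (↭.shift a xs ys))))
    where
    L⊆rest : ∀ {b} → b ∈ L → b ∈ xs ++ ys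
    L⊆rest b∈L with ↭.∈-resp-↭ (↭.shift a xs ys) (L⊆M (there b∈L))
    ... | here b≡a = contradiction (sym b≡a) (All.lookup a≢ b∈L)
    ... | there b∈ = b∈

-- A Turán type induction for graphs with rigid five-cliques

-- A five-clique is rigid when one of its vertices is the only common
-- neighbour of the other four.
module RigidFiveCliques
  {V : Set} (_≟_ : DecidableEquality V) (_~_ : V → V → Set) (_~?_ : Decidable _~_)
  (~-sym : ∀ {u v} → u ~ v → v ~ u) (~⇒≢ : ∀ {u v} → u ~ v → u ≢ v)
  (rigid : ∀ {L} → length L ≡ 5 → AllPairs _~_ L →
    ¬ (∀ {p} → p ∈ L → ∃[ p′ ] p′ ≢ p × (∀ {v} → v ∈ L → v ≢ p → p′ ~ v)))
  where

  open ListSums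
  open import Data.Nat.Base using (_+_; _*_; _≤_; _<_)

  edge : V → V → ℕ
  edge u v with u ~? v
  ... | yes _ = 1
  ... | no _  = 0

  edge-~ : ∀ {u v} → u ~ v → edge u v ≡ 1
  edge-~ {u} {v} u~v with u ~? v
  ... | yes _   = refl
  ... | no ¬u~v = contradiction u~v ¬u~v

  edge-≁ : ∀ {u v} → ¬ u ~ v → edge u v ≡ 0
  edge-≁ {u} {v} ¬u~v with u ~? v
  ... | yes u~v = contradiction u~v ¬u~v
  ... | no _    = refl

  edge≤1 : ∀ u v → edge u v ≤ 1
  edge≤1 u v with u ~? v
  ... | yes _ = s≤s z≤n
  ... | no _  = z≤n

  edge-sym : ∀ u v → edge u v ≡ edge v u
  edge-sym u v with u ~? v
  ... | yes u~v = sym (edge-~ (~-sym u~v))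
  ... | no ¬u~v = sym (edge-≁ (¬u~v ∘ ~-sym))

  degree≤ : ∀ v Q → total (edge v) Q ≤ length Q
  degree≤ v Q = ℕ.≤-trans (total-≤ (edge v) {1} {Q} (All.tabulate (λ {u} _ → edge≤1 v u)))
        (ℕ.≤-reflexive (ℕ.*-identityˡ _))

  degree< : ∀ v Q → ¬ All (v ~_) Q → total (edge v) Q < length Q
  degree< v []       ¬all = contradiction [] ¬all
  degree< v (u ∷ Q) ¬all with v ~? u
  ... | yes v~u = s≤s (degree< v Q (λ all → ¬all (v~u ∷ all)))
  ... | no _    = s≤s (degree≤ v Q)

  -- The double sum counts every edge twice, so this bounds eight times the number of edges.
  Sparse : List V → Set
  Sparse L = 4 * double edge L L ≤ 3 * (length L * length L) + 2 * length L

  private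
    -- Here c + 1 vertices are deleted, `r` remain and `x` edges run between them. The case c = 3 is
    -- an equality: the one additional edge costs 8, which the linear term repays with 2 for each of
    -- the four vertices. This is the origin of the coefficient 2 in `Sparse`.
    arithmetic : ∀ c r x → (c ≤ 2 × x ≤ c * r) ⊎ (c ≡ 3 × x ≤ c * r + 1) →
      4 * (c * suc c) + (8 * x + (3 * (r * r) + 2 * r)) ≤ 3 * ((suc c + r) * (suc c + r)) + 2 * (suc c + r)
    arithmetic c r x (inj₁ (c≤2 , x≤)) = ℕ.≤-trans (replace x≤) (slack c≤2)
      where
      open ℕSolver
      replace : ∀ {y} → x ≤ y → 4 * (c * suc c) + (8 * x + (3 * (r * r) + 2 * r))
                ≤ 4 * (c * suc c) + (8 * y + (3 * (r * r) + 2 * r))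
      replace x≤y = ℕ.+-monoʳ-≤ (4 * (c * suc c)) (ℕ.+-monoˡ-≤ (3 * (r * r) + 2 * r) (ℕ.*-monoʳ-≤ 8 x≤y))
      slack : c ≤ 2 → 4 * (c * suc c) + (8 * (c * r) + (3 * (r * r) + 2 * r))
              ≤ 3 * ((suc c + r) * (suc c + r)) + 2 * (suc c + r)
      slack z≤n = ℕ.≤-trans (ℕ.m≤m+n _ (5 + 6 * r)) (ℕ.≤-reflexive (solve 1 (λ r →
        (con 3 :* (r :* r) :+ con 2 :* r) :+ (con 5 :+ con 6 :* r)
        := con 3 :* ((con 1 :+ r) :* (con 1 :+ r)) :+ con 2 :* (con 1 :+ r)) refl r))
      slack (s≤s z≤n) = ℕ.≤-trans (ℕ.m≤m+n _ (8 + 4 * r)) (ℕ.≤-reflexive (solve 1 (λ r →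
        (con 8 :+ (con 8 :* (con 1 :* r) :+ (con 3 :* (r :* r) :+ con 2 :* r))) :+ (con 8 :+ con 4 :* r)
        := con 3 :* ((con 2 :+ r) :* (con 2 :+ r)) :+ con 2 :* (con 2 :+ r)) refl r))
      slack (s≤s (s≤s z≤n)) = ℕ.≤-trans (ℕ.m≤m+n _ (9 + 2 * r)) (ℕ.≤-reflexive (solve 1 (λ r →
        (con 24 :+ (con 8 :* (con 2 :* r) :+ (con 3 :* (r :* r) :+ con 2 :* r))) :+ (con 9 :+ con 2 :* r)
        := con 3 :* ((con 3 :+ r) :* (con 3 :+ r)) :+ con 2 :* (con 3 :+ r)) refl r))
    arithmetic .3 r x (inj₂ (refl , x≤)) = ℕ.≤-trans
      (ℕ.+-monoʳ-≤ 48 (ℕ.+-monoˡ-≤ (3 * (r * r) + 2 * r) (ℕ.*-monoʳ-≤ 8 x≤)))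
      (ℕ.≤-reflexive (solve 1 (λ r →
        con 48 :+ (con 8 :* (con 3 :* r :+ con 1) :+ (con 3 :* (r :* r) :+ con 2 :* r))
        := con 3 :* ((con 4 :+ r) :* (con 4 :+ r)) :+ con 2 :* (con 4 :+ r)) refl r))
      where open ℕSolver

  peel : ∀ {L} Q R c → L ↭ Q ++ R → length Q ≡ suc c →
         (c ≤ 2 × double edge R Q ≤ c * length R) ⊎ (c ≡ 3 × double edge R Q ≤ c * length R + 1) →
         Sparse R → Sparse L
  peel {L} Q R c p |Q|≡1+c bound sparse = begin
    4 * double edge L L
      ≡⟨ cong (4 *_) (trans (double-↭ edge p) (double-++ edge-sym Q R)) ⟩
    4 * (double edge Q Q + (2 * double edge R Q + double edge R R))
      ≡⟨ solve 3 (λ q x r → con 4 :* (q :+ (con 2 :* x :+ r)) := con 4 :* q :+ (con 8 :* x :+ con 4 :* r)) refl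
           (double edge Q Q) (double edge R Q) (double edge R R) ⟩
    4 * double edge Q Q + (8 * double edge R Q + 4 * double edge R R)
      ≤⟨ ℕ.+-mono-≤ (ℕ.*-monoʳ-≤ 4 inside) (ℕ.+-monoʳ-≤ (8 * double edge R Q) sparse) ⟩
    4 * (c * suc c) + (8 * double edge R Q + (3 * (length R * length R) + 2 * length R))
      ≤⟨ arithmetic c (length R) (double edge R Q) bound ⟩
    3 * ((suc c + length R) * (suc c + length R)) + 2 * (suc c + length R)
      ≡⟨ cong (λ l → 3 * (l * l) + 2 * l) (sym |L|≡) ⟩
    3 * (length L * length L) + 2 * length L ∎
    where
    open ℕ.≤-Reasoning
    open ℕSolver
    |L|≡ : length L ≡ suc c + length R
    |L|≡ = trans (↭.↭-length p) (trans (List.length-++ Q) (cong (_+ length R) |Q|≡1+c))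
    inside : double edge Q Q ≤ c * suc c
    inside = ℕ.≤-trans
      (total-≤ (λ a → total (edge a) Q) (All.tabulate λ {v} v∈Q → ℕ.≤-pred (ℕ.≤-trans
        -- A vertex of `Q` is not adjacent to itself, so its degree inside `Q` is at most `c`.
        (degree< v Q λ all → ~⇒≢ (All.lookup all v∈Q) refl) (ℕ.≤-reflexive |Q|≡1+c))))
      (ℕ.≤-reflexive (cong (c *_) |Q|≡1+c))

  unique-split : ∀ {L : List V} Q {R} → Unique L → L ↭ Q ++ R → Unique R
  unique-split Q {R} unique p = drop Q (AllPairs-resp-↭ (_∘ sym) p unique)
    where
    drop : ∀ Q → Unique (Q ++ R) → Unique R
    drop []      unique       = unique
    drop (_ ∷ Q) (_ ∷ unique) = drop Q unique

  private
    ↭-shorter : ∀ {L : List V} Q R {c N} → L ↭ Q ++ R → length Q ≡ suc c → length L ≤ suc N → length R ≤ N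
    ↭-shorter Q R {c} p |Q|≡ |L|≤ = ℕ.≤-trans (ℕ.m≤n+m (length R) c) (ℕ.≤-pred (ℕ.≤-trans
      (ℕ.≤-reflexive (sym (trans (↭.↭-length p) (trans (List.length-++ Q) (cong (_+ length R) |Q|≡))))) |L|≤))

  -- Adjacency is decidable and both lists are finite, so a search turns the negative statement
  -- `rigid` into an actual vertex: if the search failed, it would supply a replacement for every
  -- vertex of `Q`.
  find-rigid : ∀ L {Q} → length Q ≡ 5 → AllPairs _~_ Q →
    ∃[ p ] p ∈ Q × (∀ {p′} → p′ ∈ L → (∀ {v} → v ∈ Q → v ≢ p → p′ ~ v) → p′ ≡ p)
  find-rigid L {Q} |Q|≡5 clique with Any.any? (λ p → All.all? (λ p′ → Replaces? p p′ →-dec (p′ ≟ p)) L) Q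
    where
    Replaces? : ∀ p p′ → Dec (All (λ v → v ≢ p → p′ ~ v) Q)
    Replaces? p p′ = All.all? (λ v → ¬? (v ≟ p) →-dec (p′ ~? v)) Q
  ... | yes any = let p , p∈Q , only = find any in
    p , p∈Q , λ p′∈L adjacent → All.lookup only p′∈L (All.tabulate adjacent)
  ... | no none = ⊥-elim (rigid |Q|≡5 clique λ {p} p∈Q → replacement p (All.lookup (All.¬Any⇒All¬ Q none) p∈Q))
    where
    replacement : ∀ p → ¬ All (λ p′ → All (λ v → v ≢ p → p′ ~ v) Q → p′ ≡ p) L →
                  ∃[ p′ ] p′ ≢ p × (∀ {v} → v ∈ Q → v ≢ p → p′ ~ v)
    replacement p ¬all with find (All.¬All⇒Any¬ (λ p′ → All.all? (λ v → ¬? (v ≟ p) →-dec (p′ ~? v)) Q →-dec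
          (p′ ≟ p)) L ¬all)
    ... | p′ , _ , ¬only with All.all? (λ v → ¬? (v ≟ p) →-dec (p′ ~? v)) Q
    ...   | yes adjacent = p′ , (λ p′≡p → ¬only (λ _ → p′≡p)) , λ v∈Q v≢p → All.lookup adjacent v∈Q v≢p
    ...   | no ¬adjacent = ⊥-elim (¬only (λ adjacent → contradiction adjacent ¬adjacent))

  -- The rigid vertex `p` is kept and the other four are deleted. Only `p` is adjacent to all four;
  -- every other remaining vertex reaches at most three. This gives 4 + 3 r crossing edges for r + 1
  -- remaining vertices, hence the additional 1.
  peel-five-clique : ∀ {L Q R} → Unique L → L ↭ Q ++ R → length Q ≡ 5 → AllPairs _~_ Q →
    ∃₂ λ Q′ R′ → L ↭ Q′ ++ R′ × length Q′ ≡ 4 × double edge R′ Q′ ≤ 3 * length R′ + 1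
  peel-five-clique {L} {Q} {R} unique split |Q|≡5 clique
    with p , p∈Q , only ← find-rigid L |Q|≡5 clique
    with xs , ys , refl ← ∈-∃++ p∈Q =
    M , p ∷ R , split′ , ℕ.suc-injective (trans (sym (↭.↭-length Q↭)) |Q|≡5)
    , (begin
        total (edge p) M + double edge R M ≤⟨ ℕ.+-mono-≤ (degree≤ p M) (total-≤ (λ a → total (edge a) M) few) ⟩
        length M + 3 * length R            ≡⟨ cong (_+ 3 * length R) |M|≡4 ⟩
        4 + 3 * length R                   ≡⟨ solve 1 (λ r → con 4 :+ con 3 :* r
              := con 3 :* (con 1 :+ r) :+ con 1) refl (length R) ⟩
        3 * suc (length R) + 1             ∎)
    where
    open ℕ.≤-Reasoning
    open ℕSolver
    M = xs ++ ys
    Q↭ : xs ++ p ∷ ys ↭ p ∷ M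
    Q↭ = ↭.shift p xs ys
    |M|≡4 : length M ≡ 4
    |M|≡4 = ℕ.suc-injective (trans (sym (↭.↭-length Q↭)) |Q|≡5)
    split″ : L ↭ p ∷ M ++ R
    split″ = ↭-trans split (↭.++⁺ʳ R Q↭)
    split′ : L ↭ M ++ p ∷ R
    split′ = ↭-trans split″ (↭-sym (↭.shift p M R))
    few : All (λ v → total (edge v) M ≤ 3) R
    few = All.tabulate λ {v} v∈R → ℕ.≤-pred (ℕ.≤-trans
      (degree< v M λ v~M → All.lookup (AllPairs.head unique-pR) v∈R (sym (only
        (↭.∈-resp-↭ (↭-sym split′) (Any.++⁺ʳ M (there v∈R)))
        (λ u∈Q u≢p → All.lookup v~M (other (↭.∈-resp-↭ Q↭ u∈Q) u≢p)))))
      (ℕ.≤-reflexive |M|≡4))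
      where
      unique-pR : Unique (p ∷ R)
      unique-pR = unique-split M unique split′
      other : ∀ {u} → u ∈ p ∷ M → u ≢ p → u ∈ M
      other (here u≡p) u≢p = contradiction u≡p u≢p
      other (there u∈) _   = u∈

  sparse : ∀ L → Unique L → Sparse L
  sparse L = bounded (length L) L ℕ.≤-refl
    where
    bounded : ∀ N L → length L ≤ N → Unique L → Sparse L
    -- A clique is grown greedily, `k` being the number of vertices it lacks to reach four. If it
    -- stops growing, every vertex outside misses one of its members and sends at most `c` edges
    -- into it. If it grows beyond four, the resulting five-clique is peeled. `N` is the fuel for
    -- the recursion on shorter lists.
    extend : ∀ N {L} → length L ≤ suc N → Unique L → ∀ k c {Q R} → k + c ≡ 3 → L ↭ Q ++ R →
             length Q ≡ suc c → AllPairs _~_ Q → Sparse L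

    bounded N       []      _   _      = z≤n
    bounded (suc N) (v ∷ L) |L|≤ unique = extend N |L|≤ unique 3 0 {v ∷ []} refl ↭.refl refl ([] ∷ [])

    extend N {L} |L|≤ unique k c {Q} {R} k+c≡3 split |Q|≡ clique
      with Any.any? (λ v → All.all? (v ~?_) Q) R
    ... | no none = peel Q R c split |Q|≡ (bound k k+c≡3)
          (bounded N R (↭-shorter Q R split |Q|≡ |L|≤) (unique-split Q unique split))
      where
      few : double edge R Q ≤ c * length R
      few = total-≤ (λ a → total (edge a) Q) (All.map (λ {v} ¬all → ℕ.≤-pred
            (ℕ.≤-trans (degree< v Q ¬all) (ℕ.≤-reflexive |Q|≡))) (All.¬Any⇒All¬ R none))
      bound : ∀ k → k + c ≡ 3 → (c ≤ 2 × double edge R Q ≤ c * length R)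
            ⊎ (c ≡ 3 × double edge R Q ≤ c * length R + 1)
      bound zero    eq = inj₂ (eq , ℕ.≤-trans few (ℕ.m≤m+n _ 1))
      bound (suc j) eq = inj₁ (ℕ.≤-trans (ℕ.m≤n+m c j) (ℕ.≤-reflexive (ℕ.suc-injective eq)) , few)
    ... | yes any with v , v∈R , v~Q ← find any with xs , ys , refl ← ∈-∃++ v∈R =
      grow k k+c≡3
      where
      split′ : L ↭ (v ∷ Q) ++ (xs ++ ys)
      split′ = ↭-trans split (↭-trans (↭.++⁺ˡ Q (↭.shift v xs ys)) (↭.shift v Q (xs ++ ys)))
      grow : ∀ k → k + c ≡ 3 → Sparse L
      grow (suc j) eq = extend N |L|≤ unique j (suc c) (trans (ℕ.+-suc j c) eq) split′ (cong suc |Q|≡) (v~Q ∷ clique)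
      grow zero refl =
        let Q′ , R′ , p , |Q′|≡4 , few = peel-five-clique unique split′ (cong suc |Q|≡) (v~Q ∷ clique) in
        peel Q′ R′ 3 p |Q′|≡4 (inj₂ (refl , few)) (bounded N R′ (↭-shorter Q′ R′ p |Q′|≡4 |L|≤)
              (unique-split Q′ unique p))

-- From balanced edge sums to convex combinations of midpoints

module Normalisation (F : OrderedField) where

  open OrderedField F hiding (zero) renaming (refl to ≈-refl; sym to ≈-sym; trans to ≈-trans)
  open LinearAlgebra F

  module MidpointCombination
    {V : Set} {d : ℕ} (h : V → Fin (ℕ.suc d) → Carrier) (unit : ∀ v → h v zero ≈ 1#)
    {half} (halves : half * (1# + 1#) ≈ 1#)
    {L : List (Carrier × V × V)} {u v : V} {W W⁻¹ : Carrier} (inverse : W * W⁻¹ ≈ 1#)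
    (balance : ∀ i → sumOf (λ (w , s , t) → w * (h s i + h t i)) L ≈ W * (h u i + h v i))
    where

    open SemiringSolver commutativeSemiring
    open import Relation.Binary.Reasoning.Setoid setoid

    midpoints-balance : ∀ i → sumOf (λ (w , s , t) → (W⁻¹ * w) * (half * (h s i + h t i))) L ≈ half * (h u i + h v i)
    midpoints-balance i = begin
      sumOf (λ (w , s , t) → (W⁻¹ * w) * (half * (h s i + h t i))) L
        ≈⟨ sumOf-cong (λ _ → solve 4 (λ r w h x → (r :* w) :* (h :* x) := (r :* h) :* (w :* x)) ≈-refl _ _ _ _) L ⟩
      sumOf (λ (w , s , t) → (W⁻¹ * half) * (w * (h s i + h t i))) L
        ≈⟨ sumOf-*ˡ _ _ L ⟩
      (W⁻¹ * half) * sumOf (λ (w , s , t) → w * (h s i + h t i)) L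
        ≈⟨ *-congˡ (balance i) ⟩
      (W⁻¹ * half) * (W * (h u i + h v i))
        ≈⟨ solve 4 (λ r h w x → (r :* h) :* (w :* x) := (w :* r) :* (h :* x)) ≈-refl _ _ _ _ ⟩
      (W * W⁻¹) * (half * (h u i + h v i))
        ≈⟨ ≈-trans (*-congʳ inverse) (*-identityˡ _) ⟩
      half * (h u i + h v i) ∎

    -- This is coordinate zero of `midpoints-balance`, since every midpoint has coordinate zero
    -- equal to 1.
    weights-sum : sumOf (λ (w , _) → W⁻¹ * w) L ≈ 1#
    weights-sum = begin
      sumOf (λ (w , _) → W⁻¹ * w) L
        ≈⟨ sumOf-cong (λ (w , s , t) → ≈-sym (≈-trans (*-congˡ (half-unit s t)) (*-identityʳ _))) L ⟩
      sumOf (λ (w , s , t) → (W⁻¹ * w) * (half * (h s zero + h t zero))) L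
        ≈⟨ midpoints-balance zero ⟩
      half * (h u zero + h v zero)
        ≈⟨ half-unit u v ⟩
      1# ∎
      where
      half-unit : ∀ s t → half * (h s zero + h t zero) ≈ 1#
      half-unit s t = ≈-trans (*-congˡ (+-cong (unit s) (unit t))) halves

-- Separation of a point from a convex hull by a linear functional

module Separation (F : OrderedField) where

  open OrderedField F hiding (zero) renaming (refl to ≈-refl; sym to ≈-sym; trans to ≈-trans)
  open CommutativeMonoidSum +-commutativeMonoid using (sum; sum-cong-≋; ∑-distrib-+; ∑-comm)
  open SemiringSum semiring using (*-distribˡ-sum; *-distribʳ-sum)
  open GroupProperties +-group using (identityʳ-unique)
  open SemiringSolver commutativeSemiring
  open import Relation.Binary.Reasoning.Setoid setoid

  sum-nonNeg : ∀ {n} {f : Fin n → Carrier} → (∀ i → NonNeg (f i)) → NonNeg (sum f)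
  sum-nonNeg {zero}  f≥0 = NonNeg-0
  sum-nonNeg {suc n} f≥0 = NonNeg-+ (f≥0 zero) (sum-nonNeg (f≥0 ∘ suc))

  -- Applying the functional `c` to the combination gives a = a + δ + Σ w s, which is impossible. A
  -- gap `δ` common to all points makes it unnecessary to look for a positive weight. The copies
  -- `x₀` and `y₀` are the points where the functional can be computed; `x` and `y` only equal them
  -- as reals.
  separated : ∀ {d r} (c : Fin d → Carrier) {x x₀ : Fin d → Carrier} {y y₀ : Fin r → Fin d → Carrier}
        {w : Fin r → Carrier}
    {a δ} {b s : Fin r → Carrier} → (∀ i → x₀ i ≈ x i) → (∀ j i → y₀ j i ≈ y j i) →
    sum (λ i → c i * x₀ i) ≈ a → (∀ j → sum (λ i → c i * y₀ j i) ≈ b j) →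
    Pos δ → (∀ j → NonNeg (s j)) → (∀ j → b j ≈ (a + δ) + s j) →
    (∀ j → NonNeg (w j)) → sum w ≈ 1# → ¬ (∀ i → sum (λ j → w j * y j i) ≈ x i)
  separated {d} {r} c {x} {x₀} {y} {y₀} {w} {a} {δ} {b} {s} x₀≈x y₀≈y at-x₀ at-y₀ δ>0 s≥0 gap w≥0 total inside =
    ¬Pos-0 (Pos-resp (identityʳ-unique a _ (≈-sym balance))
      (Pos-+-NonNeg δ>0 (sum-nonNeg (λ j → NonNeg-* (w≥0 j) (s≥0 j)))))
    where
    balance : a ≈ a + (δ + sum (λ j → w j * s j))
    balance = begin
      a                                                   ≈⟨ ≈-sym at-x₀ ⟩
      sum (λ i → c i * x₀ i)                              ≈⟨ sum-cong-≋ (λ i → *-congˡ (x₀≈x i)) ⟩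
      sum (λ i → c i * x i)                               ≈⟨ sum-cong-≋ (λ i → *-congˡ (≈-sym (inside i))) ⟩
      sum (λ i → c i * sum (λ j → w j * y j i))           ≈⟨ sum-cong-≋
            (λ i → *-distribˡ-sum (c i) (λ j → w j * y j i)) ⟩
      sum (λ i → sum (λ j → c i * (w j * y j i)))         ≈⟨ ∑-comm (λ i j → c i * (w j * y j i)) ⟩
      sum (λ j → sum (λ i → c i * (w j * y j i)))
        ≈⟨ sum-cong-≋ (λ j → sum-cong-≋ (λ i → solve 3 (λ c w y → c :* (w :* y)
              := w :* (c :* y)) ≈-refl (c i) (w j) (y j i))) ⟩
      sum (λ j → sum (λ i → w j * (c i * y j i)))         ≈⟨ sum-cong-≋
            (λ j → ≈-sym (*-distribˡ-sum (w j) (λ i → c i * y j i))) ⟩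
      sum (λ j → w j * sum (λ i → c i * y j i))           ≈⟨ sum-cong-≋
            (λ j → *-congˡ (≈-trans (≈-trans (sum-cong-≋ (λ i → *-congˡ (≈-sym (y₀≈y j i)))) (at-y₀ j)) (gap j))) ⟩
      sum (λ j → w j * ((a + δ) + s j))                   ≈⟨ sum-cong-≋ (λ j → distribˡ (w j) (a + δ) (s j)) ⟩
      sum (λ j → w j * (a + δ) + w j * s j)               ≈⟨ ∑-distrib-+ (λ j → w j * (a + δ)) (λ j → w j * s j) ⟩
      sum (λ j → w j * (a + δ)) + sum (λ j → w j * s j)   ≈⟨ +-congʳ (≈-sym (*-distribʳ-sum (a + δ) w)) ⟩
      sum w * (a + δ) + sum (λ j → w j * s j)             ≈⟨ +-congʳ (≈-trans (*-congʳ total) (*-identityˡ _)) ⟩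
      (a + δ) + sum (λ j → w j * s j)                     ≈⟨ +-assoc _ _ _ ⟩
      a + (δ + sum (λ j → w j * s j))                     ∎

open import Data.Integer.Base as ℤ using (ℤ; +_)

-- Three colours and the number of bichromatic pairs

colour : ℕ → Fin 3
colour 0                   = zero
colour 1                   = suc zero
colour 2                   = suc (suc zero)
colour (suc (suc (suc k))) = colour k

module Count where

  open ListSums

  -- As a Boolean function of plain naturals it is invariant under shifting both arguments by 3
  -- definitionally, which the recursion in `mixedSum-step` relies on.
  bichromatic : ℕ → ℕ → Bool
  bichromatic i j = (i ℕ.<ᵇ j) ∧ not (does (colour i Fin.≟ colour j))

  indicator : Bool → ℕ
  indicator b = if b then 1 else 0

  mixed : ℕ → ℕ → ℕ
  mixed i j = indicator (bichromatic i j)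

  pairs : ∀ n → List (Fin n × Fin n)
  pairs n = filter (λ (i , j) → T? (bichromatic (toℕ i) (toℕ j))) (cartesianProduct (allFin n) (allFin n))

  length-filter : ∀ (b : A → Bool) L → length (filter (T? ∘ b) L) ≡ total (indicator ∘ b) L
  length-filter b []      = refl
  length-filter b (a ∷ L) with b a
  ... | true  = cong suc (length-filter b L)
  ... | false = length-filter b L

  mixedSum : ℕ → ℕ
  mixedSum n = double (λ i j → mixed (toℕ i) (toℕ j)) (allFin n) (allFin n)

  length-pairs : ∀ n → length (pairs n) ≡ mixedSum n
  length-pairs n = trans (length-filter _ (cartesianProduct (allFin n) (allFin n)))
    (total-cartesianProduct _ (allFin n) (allFin n))

  shift₃ : ∀ {n} → Fin n → Fin (3 ℕ.+ n)
  shift₃ i = suc (suc (suc i))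

  total-allFin : ∀ n (f : Fin (3 ℕ.+ n) → ℕ) → total f (allFin (3 ℕ.+ n)) ≡
    f zero ℕ.+ (f (suc zero) ℕ.+ (f (suc (suc zero)) ℕ.+ total (λ i → f (shift₃ i)) (allFin n)))
  total-allFin n f = cong (λ t → f zero ℕ.+ (f (suc zero) ℕ.+ (f (suc (suc zero)) ℕ.+ t)))
    (trans (cong (total f) (sym (List.map-tabulate {n = n} id shift₃))) (total-map f shift₃ (allFin n)))

  first-rows : ∀ j → mixed 0 (3 ℕ.+ j) ℕ.+ (mixed 1 (3 ℕ.+ j) ℕ.+ mixed 2 (3 ℕ.+ j)) ≡ 2
  first-rows j with colour j
  ... | zero          = refl
  ... | suc zero      = refl
  ... | suc (suc zero) = refl

  -- Three indices are added at the front. They form three pairs among themselves, and each later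
  -- index differs in colour from exactly two of them.
  mixedSum-step : ∀ n → mixedSum (3 ℕ.+ n) ≡ mixedSum n ℕ.+ (2 ℕ.* n ℕ.+ 3)
  mixedSum-step n = begin
    mixedSum (3 ℕ.+ n)
      ≡⟨ total-allFin n (λ i → row (toℕ i)) ⟩
    row 0 ℕ.+ (row 1 ℕ.+ (row 2 ℕ.+ total (λ i → row (3 ℕ.+ toℕ i)) (allFin n)))
      ≡⟨ cong₂ ℕ._+_ (total-allFin n (λ j → mixed 0 (toℕ j))) (cong₂ ℕ._+_ (total-allFin n (λ j → mixed 1 (toℕ j)))
           (cong₂ ℕ._+_ (total-allFin n (λ j → mixed 2 (toℕ j)))
             (total-cong (λ i → total-allFin n (λ j → mixed (3 ℕ.+ toℕ i) (toℕ j))) (allFin n)))) ⟩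
    suc (suc (rest 0)) ℕ.+ (suc (rest 1) ℕ.+ (rest 2 ℕ.+ mixedSum n))
      ≡⟨ solve 4 (λ a b c d → (con 2 :+ a) :+ ((con 1 :+ b) :+ (c :+ d)) := d :+ ((a :+ (b :+ c)) :+ con 3)) refl
           (rest 0) (rest 1) (rest 2) (mixedSum n) ⟩
    mixedSum n ℕ.+ ((rest 0 ℕ.+ (rest 1 ℕ.+ rest 2)) ℕ.+ 3)
      ≡⟨ cong (λ t → mixedSum n ℕ.+ (t ℕ.+ 3)) rests ⟩
    mixedSum n ℕ.+ (2 ℕ.* n ℕ.+ 3) ∎
    where
    open ≡.≡-Reasoning
    open ℕSolver
    row rest : ℕ → ℕ
    row k = total (λ j → mixed k (toℕ j)) (allFin (3 ℕ.+ n))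
    rest k = total (λ j → mixed k (3 ℕ.+ toℕ j)) (allFin n)
    constant : ∀ (L : List (Fin n)) → total (λ _ → 2) L ≡ 2 ℕ.* length L
    constant []      = refl
    constant (_ ∷ L) = trans (cong (2 ℕ.+_) (constant L)) (sym (ℕ.*-suc 2 (length L)))
    rests : rest 0 ℕ.+ (rest 1 ℕ.+ rest 2) ≡ 2 ℕ.* n
    rests = begin
      rest 0 ℕ.+ (rest 1 ℕ.+ rest 2)
        ≡⟨ cong (rest 0 ℕ.+_) (sym (total-+ _ _ (allFin n))) ⟩
      rest 0 ℕ.+ total (λ j → mixed 1 (3 ℕ.+ toℕ j) ℕ.+ mixed 2 (3 ℕ.+ toℕ j)) (allFin n)
        ≡⟨ sym (total-+ _ _ (allFin n)) ⟩
      total (λ j → mixed 0 (3 ℕ.+ toℕ j) ℕ.+ (mixed 1 (3 ℕ.+ toℕ j) ℕ.+ mixed 2 (3 ℕ.+ toℕ j))) (allFin n)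
        ≡⟨ total-cong (λ j → first-rows (toℕ j)) (allFin n) ⟩
      total (λ _ → 2) (allFin n)
        ≡⟨ trans (constant (allFin n)) (cong (2 ℕ.*_) (List.length-tabulate {n = n} id)) ⟩
      2 ℕ.* n ∎

  -- The form in which a bound on n² / 3 follows by division. Passing from n to n + 3 adds 6 n + 9
  -- to the left side and exactly as much to the right, so the slack of the three base cases
  -- persists.
  square<mixedSum : ∀ n → n ℕ.* n ℕ.< suc (mixedSum n) ℕ.* 3
  square<mixedSum 0 = s≤s z≤n
  square<mixedSum 1 = s≤s (s≤s z≤n)
  square<mixedSum 2 = s≤s (s≤s (s≤s (s≤s (s≤s z≤n))))
  square<mixedSum (suc (suc (suc n))) = begin-strict
    (3 ℕ.+ n) ℕ.* (3 ℕ.+ n)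
      ≡⟨ solve 1 (λ n → (con 3 :+ n) :* (con 3 :+ n) := n :* n :+ (con 6 :* n :+ con 9)) refl n ⟩
    n ℕ.* n ℕ.+ (6 ℕ.* n ℕ.+ 9)
      <⟨ ℕ.+-monoˡ-< (6 ℕ.* n ℕ.+ 9) (square<mixedSum n) ⟩
    suc (mixedSum n) ℕ.* 3 ℕ.+ (6 ℕ.* n ℕ.+ 9)
      ≡⟨ solve 2 (λ d n → (con 1 :+ d) :* con 3 :+ (con 6 :* n :+ con 9)
            := (con 1 :+ (d :+ (con 2 :* n :+ con 3))) :* con 3) refl (mixedSum n) n ⟩
    suc (mixedSum n ℕ.+ (2 ℕ.* n ℕ.+ 3)) ℕ.* 3
      ≡⟨ cong (λ t → suc t ℕ.* 3) (sym (mixedSum-step n)) ⟩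
    suc (mixedSum (3 ℕ.+ n)) ℕ.* 3 ∎
    where
    open ℕ.≤-Reasoning
    open ℕSolver

  third≤length-pairs : ∀ n → (n ℕ.* n) / 3 ℕ.≤ length (pairs n)
  third≤length-pairs n = ℕ.≤-pred (m<n*o⇒m/o<n
    (subst (λ l → n ℕ.* n ℕ.< suc l ℕ.* 3) (sym (length-pairs n)) (square<mixedSum n)))

  pairs-unique : ∀ n → Unique (pairs n)
  pairs-unique n = Unique.filter⁺ _ (Unique.cartesianProduct⁺ (Unique.allFin⁺ n) (Unique.allFin⁺ n))

  bichromatic⇒ : ∀ i j → T (bichromatic i j) → i ℕ.< j × colour i ≢ colour j
  bichromatic⇒ i j t with i ℕ.<ᵇ j in eq | colour i Fin.≟ colour j
  ... | true | no i≢j = ℕ.<ᵇ⇒< i j (subst T (sym eq) _) , i≢j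

  pairs-bichromatic : ∀ n {i j} → (i , j) ∈ pairs n → toℕ i ℕ.< toℕ j × colour (toℕ i) ≢ colour (toℕ j)
  pairs-bichromatic n {i} {j} ij∈ = bichromatic⇒ (toℕ i) (toℕ j)
    (proj₂ (∈-filter⁻ (λ (i , j) → T? (bichromatic (toℕ i) (toℕ j)))
          {xs = cartesianProduct (allFin n) (allFin n)} ij∈))

lookup-injective : ∀ {L : List A} → Unique L → ∀ {i j} → lookup L i ≡ lookup L j → i ≡ j
lookup-injective (a≢ ∷ unique) {zero}  {zero}  eq = refl
lookup-injective (a≢ ∷ unique) {zero}  {suc j} eq = contradiction eq (All.lookup a≢ (∈-lookup j))
lookup-injective (a≢ ∷ unique) {suc i} {zero}  eq = contradiction (sym eq) (All.lookup a≢ (∈-lookup i))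
lookup-injective (a≢ ∷ unique) {suc i} {suc j} eq = cong suc (lookup-injective unique eq)

-- The configuration for the lower bound and its separating functionals

-- The point with parameter X = k + 1 and colour s is X² (1, 1, 1) − X e_s.
coordinate : ℕ → Fin 3 → ℕ
coordinate k i = if does (colour k Fin.≟ i) then suc k ℕ.* k else suc k ℕ.* suc k

coordinate-ℤ : (x : ℤ) (s i : Fin 3) → ℤ
coordinate-ℤ x s i = if does (s Fin.≟ i) then x ℤ.* (x ℤ.- + 1) else x ℤ.* x

+coordinate : ∀ k i → + coordinate k i ≡ coordinate-ℤ (+ suc k) (colour k) i
+coordinate k i with does (colour k Fin.≟ i)
... | true  = ℤ.pos-* (suc k) k
... | false = ℤ.pos-* (suc k) (suc k)

infix 8 _∙_

_∙_ : (c x : Fin 3 → ℤ) → ℤ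
c ∙ x = c zero ℤ.* x zero ℤ.+ (c (suc zero) ℤ.* x (suc zero) ℤ.+ c (suc (suc zero)) ℤ.* x (suc (suc zero)))

∙-coordinate-ℤ : ∀ c x s → c ∙ coordinate-ℤ x s ≡
  x ℤ.* (x ℤ.* (c zero ℤ.+ (c (suc zero) ℤ.+ c (suc (suc zero)))) ℤ.- c s)
∙-coordinate-ℤ c x zero = solve 4 (λ x a b c →
    a :* (x :* (x :- con (+ 1))) :+ (b :* (x :* x) :+ c :* (x :* x)) := x :* (x :* (a :+ (b :+ c)) :- a))
    refl x (c zero) (c (suc zero)) (c (suc (suc zero)))
  where open ℤSolver
∙-coordinate-ℤ c x (suc zero) = solve 4 (λ x a b c →
    a :* (x :* x) :+ (b :* (x :* (x :- con (+ 1))) :+ c :* (x :* x)) := x :* (x :* (a :+ (b :+ c)) :- b))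
    refl x (c zero) (c (suc zero)) (c (suc (suc zero)))
  where open ℤSolver
∙-coordinate-ℤ c x (suc (suc zero)) = solve 4 (λ x a b c →
    a :* (x :* x) :+ (b :* (x :* x) :+ c :* (x :* (x :- con (+ 1)))) := x :* (x :* (a :+ (b :+ c)) :- c))
    refl x (c zero) (c (suc zero)) (c (suc (suc zero)))
  where open ℤSolver

-- For points of parameters P, Q and distinct colours s, t, the linear
-- functional with coefficients 2P, 2Q, 1 − 2P − 2Q in the directions s, t and
-- the third one has value X² − 2PX = (X − P)² − P² in colour s, similarly in
-- colour t, and is nonnegative on the third colour.  Hence it is minimised
-- only by the sum of these two points.
coefficients : (s t : Fin 3) (P Q : ℤ) → Fin 3 → ℤ
coefficients s t P Q i =
  if does (i Fin.≟ s) then + 2 ℤ.* P else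
  if does (i Fin.≟ t) then + 2 ℤ.* Q else
  + 1 ℤ.- + 2 ℤ.* P ℤ.- + 2 ℤ.* Q

-- This normalisation makes the quadratic part of the functional X² in all three colours.
coefficients-sum : ∀ s t P Q → s ≢ t → let c = coefficients s t P Q in
                   c zero ℤ.+ (c (suc zero) ℤ.+ c (suc (suc zero))) ≡ + 1
coefficients-sum = sums
  where
  open ℤSolver
  third : ∀ {n} (P Q : Polynomial n) → Polynomial n
  third P Q = con (+ 1) :- con (+ 2) :* P :- con (+ 2) :* Q
  sums : ∀ s t P Q → s ≢ t → let c = coefficients s t P Q in
         c zero ℤ.+ (c (suc zero) ℤ.+ c (suc (suc zero))) ≡ + 1
  sums zero zero P Q s≢t = contradiction refl s≢t
  sums zero (suc zero) P Q _ =
    solve 2 (λ P Q → con (+ 2) :* P :+ (con (+ 2) :* Q :+ third P Q) := con (+ 1)) refl P Q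
  sums zero (suc (suc zero)) P Q _ =
    solve 2 (λ P Q → con (+ 2) :* P :+ (third P Q :+ con (+ 2) :* Q) := con (+ 1)) refl P Q
  sums (suc zero) zero P Q _ =
    solve 2 (λ P Q → con (+ 2) :* Q :+ (con (+ 2) :* P :+ third P Q) := con (+ 1)) refl P Q
  sums (suc zero) (suc zero) P Q s≢t = contradiction refl s≢t
  sums (suc zero) (suc (suc zero)) P Q _ =
    solve 2 (λ P Q → third P Q :+ (con (+ 2) :* P :+ con (+ 2) :* Q) := con (+ 1)) refl P Q
  sums (suc (suc zero)) zero P Q _ =
    solve 2 (λ P Q → con (+ 2) :* Q :+ (third P Q :+ con (+ 2) :* P) := con (+ 1)) refl P Q
  sums (suc (suc zero)) (suc zero) P Q _ =
    solve 2 (λ P Q → third P Q :+ (con (+ 2) :* Q :+ con (+ 2) :* P) := con (+ 1)) refl P Q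
  sums (suc (suc zero)) (suc (suc zero)) P Q s≢t = contradiction refl s≢t

module Functional (p q : ℕ) (p≢q : colour p ≢ colour q) where

  P Q : ℤ
  P = + suc p
  Q = + suc q

  coefficient : Fin 3 → ℤ
  coefficient = coefficients (colour p) (colour q) P Q

  at : ℕ → ℤ
  at k = coefficient ∙ (λ i → + coordinate k i)

  coefficient-p : coefficient (colour p) ≡ + 2 ℤ.* P
  coefficient-p with colour p Fin.≟ colour p
  ... | yes _  = refl
  ... | no p≢p = contradiction refl p≢p

  coefficient-q : coefficient (colour q) ≡ + 2 ℤ.* Q
  coefficient-q with colour q Fin.≟ colour p
  ... | yes q≡p = contradiction (sym q≡p) p≢q
  ... | no _ with colour q Fin.≟ colour q
  ...   | yes _  = refl
  ...   | no q≢q = contradiction refl q≢q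

  coefficient-r : ∀ i → i ≢ colour p → i ≢ colour q → coefficient i ≡ + 1 ℤ.- + 2 ℤ.* P ℤ.- + 2 ℤ.* Q
  coefficient-r i i≢p i≢q with i Fin.≟ colour p
  ... | yes i≡p = contradiction i≡p i≢p
  ... | no _ with i Fin.≟ colour q
  ...   | yes i≡q = contradiction i≡q i≢q
  ...   | no _    = refl

  at≡ : ∀ k → at k ≡ + suc k ℤ.* (+ suc k ℤ.- coefficient (colour k))
  at≡ k = trans
    (cong₂ ℤ._+_ (term zero) (cong₂ ℤ._+_ (term (suc zero)) (term (suc (suc zero)))))
    (trans (∙-coordinate-ℤ coefficient (+ suc k) (colour k))
      (cong (λ x → + suc k ℤ.* (x ℤ.- coefficient (colour k)))
        (trans (cong (+ suc k ℤ.*_) (coefficients-sum (colour p) (colour q) P Q p≢q)) (ℤ.*-identityʳ (+ suc k)))))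
    where
    term : ∀ i → coefficient i ℤ.* + coordinate k i ≡ coefficient i ℤ.* coordinate-ℤ (+ suc k) (colour k) i
    term i = cong (coefficient i ℤ.*_) (+coordinate k i)

  square : ∀ i → i ℤ.* i ≡ + (ℤ.∣ i ∣ ℕ.* ℤ.∣ i ∣)
  square (+ n)          = sym (ℤ.pos-* n n)
  square ℤ.-[1+ n ]     = refl

  gap : ℕ → ℕ → ℕ
  gap k l = ℤ.∣ + suc k ℤ.- + suc l ∣ ℕ.* ℤ.∣ + suc k ℤ.- + suc l ∣

  gap≡0 : ∀ k l → gap k l ≡ 0 → k ≡ l
  gap≡0 k l eq with ℕ.m*n≡0⇒m≡0∨n≡0 ℤ.∣ + suc k ℤ.- + suc l ∣ eq
  ... | inj₁ z = ℕ.suc-injective (ℤ.+-injective (ℤ.i-j≡0⇒i≡j (+ suc k) (+ suc l) (ℤ.∣i∣≡0⇒i≡0 z)))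
  ... | inj₂ z = ℕ.suc-injective (ℤ.+-injective (ℤ.i-j≡0⇒i≡j (+ suc k) (+ suc l) (ℤ.∣i∣≡0⇒i≡0 z)))

  data Position (k : ℕ) : Set where
    like-p : colour k ≡ colour p → at k ≡ + gap k p ℤ.- P ℤ.* P → Position k
    like-q : colour k ≡ colour q → at k ≡ + gap k q ℤ.- Q ℤ.* Q → Position k
    other  : ∀ e → at k ≡ + e → Position k

  position : ∀ k → Position k
  position k with colour k Fin.≟ colour p | colour k Fin.≟ colour q
  ... | yes k≡p | _ = like-p k≡p (trans (at≡ k) (trans
          (cong (λ c → + suc k ℤ.* (+ suc k ℤ.- c)) (trans (cong coefficient k≡p) coefficient-p))
          (trans (solve 2 (λ x p → x :* (x :- con (+ 2) :* p) := (x :- p) :* (x :- p) :- p :* p) refl (+ suc k) P)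
            (cong (ℤ._- P ℤ.* P) (square (+ suc k ℤ.- P))))))
    where open ℤSolver
  ... | no _ | yes k≡q = like-q k≡q (trans (at≡ k) (trans
          (cong (λ c → + suc k ℤ.* (+ suc k ℤ.- c)) (trans (cong coefficient k≡q) coefficient-q))
          (trans (solve 2 (λ x p → x :* (x :- con (+ 2) :* p) := (x :- p) :* (x :- p) :- p :* p) refl (+ suc k) Q)
            (cong (ℤ._- Q ℤ.* Q) (square (+ suc k ℤ.- Q))))))
    where open ℤSolver
  -- The witness is X (X - 1 + 2P + 2Q), with X - 1 written as `k` so that it is visibly a natural
  -- number.
  ... | no k≢p | no k≢q = other (suc k ℕ.* (k ℕ.+ 2 ℕ.* suc p ℕ.+ 2 ℕ.* suc q)) (trans (at≡ k) (trans
          (cong (λ c → + suc k ℤ.* (+ suc k ℤ.- c)) (coefficient-r (colour k) k≢p k≢q))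
          (trans (solve 3 (λ y p q → (con (+ 1) :+ y) :*
                ((con (+ 1) :+ y) :- (con (+ 1) :- con (+ 2) :* p :- con (+ 2) :* q))
                              := (con (+ 1) :+ y) :* (y :+ con (+ 2) :* p :+ con (+ 2) :* q)) refl (+ k) P Q)
            (sym (trans (ℤ.pos-* (suc k) _) (cong (+ suc k ℤ.*_)
                  (cong₂ (λ a b → + k ℤ.+ a ℤ.+ b) (ℤ.pos-* 2 (suc p)) (ℤ.pos-* 2 (suc q)))))))))
    where open ℤSolver

  minimum : ℤ
  minimum = ℤ.- (P ℤ.* P ℤ.+ Q ℤ.* Q)

  at-p : at p ℤ.+ at q ≡ minimum
  at-p = trans (cong₂ ℤ._+_
      (trans (at≡ p) (cong (λ c → P ℤ.* (P ℤ.- c)) coefficient-p))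
      (trans (at≡ q) (cong (λ c → Q ℤ.* (Q ℤ.- c)) coefficient-q)))
    (solve 2 (λ p q → p :* (p :- con (+ 2) :* p) :+ q :* (q :- con (+ 2) :* q) := :- (p :* p :+ q :* q)) refl P Q)
    where open ℤSolver

  nonzero : ∀ e → e ≢ 0 → ∀ {x} → x ≡ minimum ℤ.+ + e → ∃[ e ] x ≡ minimum ℤ.+ + suc e
  nonzero zero    e≢0 _  = contradiction refl e≢0
  nonzero (suc e) _   eq = e , eq

  -- All values are integers, so a value above the minimum exceeds it by at least 1. The form
  -- `suc e` thus gives a gap independent of `k` and `l`.
  excess : ∀ k l → k ℕ.< l → colour k ≢ colour l → p ℕ.< q → ¬ (k ≡ p × l ≡ q) →
           ∃[ e ] at k ℤ.+ at l ≡ minimum ℤ.+ + suc e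
  excess k l k<l k≢l p<q kl≢pq with position k | position l
  ... | like-p k≡p _ | like-p l≡p _ = contradiction (trans k≡p (sym l≡p)) k≢l
  ... | like-q k≡q _ | like-q l≡q _ = contradiction (trans k≡q (sym l≡q)) k≢l
  ... | like-p _ a | like-q _ b = nonzero (gap k p ℕ.+ gap l q)
        (λ z → kl≢pq (gap≡0 k p (ℕ.m+n≡0⇒m≡0 (gap k p) z) , gap≡0 l q (ℕ.m+n≡0⇒n≡0 (gap k p) z)))
        (trans (cong₂ ℤ._+_ a b) (solve 4 (λ a b p q → (a :- p) :+ (b :- q)
              := :- (p :+ q) :+ (a :+ b)) refl (+ gap k p) (+ gap l q) (P ℤ.* P) (Q ℤ.* Q)))
    where open ℤSolver
  ... | like-q _ a | like-p _ b = nonzero (gap k q ℕ.+ gap l p)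
        -- Vanishing gaps would mean k = q and l = p, against the two orderings.
        (λ z → ℕ.<-asym p<q (≡.subst₂ ℕ._<_ (gap≡0 k q (ℕ.m+n≡0⇒m≡0 (gap k q) z))
              (gap≡0 l p (ℕ.m+n≡0⇒n≡0 (gap k q) z)) k<l))
        (trans (cong₂ ℤ._+_ a b) (solve 4 (λ a b p q → (a :- q) :+ (b :- p)
              := :- (p :+ q) :+ (a :+ b)) refl (+ gap k q) (+ gap l p) (P ℤ.* P) (Q ℤ.* Q)))
    where open ℤSolver
  -- Only -P² can occur here, so Q² is left over as surplus; `q + q * suc q` is Q² - 1. The
  -- remaining cases leave over P², or both squares.
  ... | like-p _ a | other e b = q ℕ.+ q ℕ.* suc q ℕ.+ (gap k p ℕ.+ e) ,
        trans (cong₂ ℤ._+_ a b) (solve 4 (λ a b p q → (a :- p) :+ b := :- (p :+ q) :+ (q :+ (a :+ b))) refl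
              (+ gap k p) (+ e) (P ℤ.* P) (Q ℤ.* Q))
    where open ℤSolver
  ... | other e b | like-p _ a = q ℕ.+ q ℕ.* suc q ℕ.+ (gap l p ℕ.+ e) ,
        trans (cong₂ ℤ._+_ b a) (solve 4 (λ a b p q → b :+ (a :- p) := :- (p :+ q) :+ (q :+ (a :+ b))) refl
              (+ gap l p) (+ e) (P ℤ.* P) (Q ℤ.* Q))
    where open ℤSolver
  ... | like-q _ a | other e b = p ℕ.+ p ℕ.* suc p ℕ.+ (gap k q ℕ.+ e) ,
        trans (cong₂ ℤ._+_ a b) (solve 4 (λ a b p q → (a :- q) :+ b := :- (p :+ q) :+ (p :+ (a :+ b))) refl
              (+ gap k q) (+ e) (P ℤ.* P) (Q ℤ.* Q))
    where open ℤSolver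
  ... | other e b | like-q _ a = p ℕ.+ p ℕ.* suc p ℕ.+ (gap l q ℕ.+ e) ,
        trans (cong₂ ℤ._+_ b a) (solve 4 (λ a b p q → b :+ (a :- q) := :- (p :+ q) :+ (p :+ (a :+ b))) refl
              (+ gap l q) (+ e) (P ℤ.* P) (Q ℤ.* Q))
    where open ℤSolver
  ... | other e a | other f b = p ℕ.+ p ℕ.* suc p ℕ.+ (suc q ℕ.* suc q ℕ.+ (e ℕ.+ f)) ,
        trans (cong₂ ℤ._+_ a b) (solve 4 (λ a b p q → a :+ b := :- (p :+ q) :+ (p :+ (q :+ (a :+ b)))) refl
              (+ e) (+ f) (P ℤ.* P) (Q ℤ.* Q))
    where open ℤSolver

open import Defs

-- The Cauchy reals as an ordered field

module ℚLemmas where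
  open ℚSolver

  half-sum : ∀ ε → ½ ℚ.* ε ℚ.+ ½ ℚ.* ε ≡ ε
  half-sum ε = trans (sym (ℚ.*-distribʳ-+ ε ½ ½)) (ℚ.*-identityˡ ε)

  *-pos : ∀ {p q} → 0ℚ ℚ.< p → 0ℚ ℚ.< q → 0ℚ ℚ.< p ℚ.* q
  *-pos {p} {q} 0<p 0<q = ℚ.positive⁻¹ (p ℚ.* q)
    ⦃ ℚ.pos*pos⇒pos p ⦃ ℚ.positive 0<p ⦄ q ⦃ ℚ.positive 0<q ⦄ ⦄

  half>0 : ∀ {ε} → 0ℚ ℚ.< ε → 0ℚ ℚ.< ½ ℚ.* ε
  half>0 = *-pos (ℚ.positive⁻¹ ½)

  0<1 : 0ℚ ℚ.< 1ℚ
  0<1 = ℚ.positive⁻¹ 1ℚ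

  *-mono-≤ : ∀ {p q r s} → 0ℚ ℚ.≤ p → 0ℚ ℚ.≤ s → p ℚ.≤ q → r ℚ.≤ s → p ℚ.* r ℚ.≤ q ℚ.* s
  *-mono-≤ {p} {q} {r} {s} 0≤p 0≤s p≤q r≤s = ℚ.≤-trans
    (ℚ.*-monoˡ-≤-nonNeg p ⦃ ℚ.nonNegative 0≤p ⦄ r≤s)
    (ℚ.*-monoʳ-≤-nonNeg s ⦃ ℚ.nonNegative 0≤s ⦄ p≤q)

  *-nonNeg : ∀ {p q} → 0ℚ ℚ.≤ p → 0ℚ ℚ.≤ q → 0ℚ ℚ.≤ p ℚ.* q
  *-nonNeg {p} {q} 0≤p 0≤q = subst (ℚ._≤ p ℚ.* q) (ℚ.*-zeroʳ p)
    (ℚ.*-monoˡ-≤-nonNeg p ⦃ ℚ.nonNegative 0≤p ⦄ 0≤q)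

  p≤∣p∣ : ∀ p → p ℚ.≤ ∣ p ∣
  p≤∣p∣ p with ℚ.≤-total 0ℚ p
  ... | inj₁ 0≤p = ℚ.≤-reflexive (sym (ℚ.0≤p⇒∣p∣≡p 0≤p))
  ... | inj₂ p≤0 = ℚ.≤-trans p≤0 (ℚ.0≤∣p∣ p)

  0≤neg : ∀ {p} → p ℚ.≤ 0ℚ → 0ℚ ℚ.≤ ℚ.- p
  0≤neg = ℚ.neg-antimono-≤

  0≤q-p : ∀ {p q} → p ℚ.≤ q → 0ℚ ℚ.≤ q ℚ.- p
  0≤q-p {p} {q} p≤q = subst (ℚ._≤ q ℚ.- p) (ℚ.+-inverseʳ p) (ℚ.+-monoˡ-≤ (ℚ.- p) p≤q)

  0<q-p : ∀ {p q} → p ℚ.< q → 0ℚ ℚ.< q ℚ.- p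
  0<q-p {p} {q} p<q = subst (ℚ._< q ℚ.- p) (ℚ.+-inverseʳ p) (ℚ.+-monoˡ-< (ℚ.- p) p<q)

  by-difference : ∀ {p q r} → 0ℚ ℚ.≤ r → q ℚ.- p ≡ r → p ℚ.≤ q
  by-difference {p} {q} {r} 0≤r eq = subst₂ ℚ._≤_ (ℚ.+-identityˡ p) (lemma q p)
    (ℚ.+-monoˡ-≤ p (subst (0ℚ ℚ.≤_) (sym eq) 0≤r))
    where
    lemma : ∀ q p → (q ℚ.- p) ℚ.+ p ≡ q
    lemma = solve 2 (λ q p → (q :- p) :+ p := q) refl

  -- Real nonnegativity only bounds the approximations from below by -δ. If one factor is
  -- nonnegative, the other is shifted by `δ` at a cost of at most `B * δ`; two nonpositive factors
  -- have a nonnegative product anyway.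
  *-lower-bound : ∀ {x y δ B} → 0ℚ ℚ.≤ x ℚ.+ δ → 0ℚ ℚ.≤ y ℚ.+ δ → 0ℚ ℚ.≤ δ →
                  ∣ x ∣ ℚ.≤ B → ∣ y ∣ ℚ.≤ B → 0ℚ ℚ.≤ x ℚ.* y ℚ.+ B ℚ.* δ
  *-lower-bound {x} {y} {δ} {B} hx hy hδ ∣x∣≤B ∣y∣≤B with ℚ.≤-total 0ℚ x | ℚ.≤-total 0ℚ y
  ... | _ | inj₁ 0≤y = by-difference
    (ℚ.+-mono-≤ (*-nonNeg hx 0≤y) (*-nonNeg (0≤q-p (ℚ.≤-trans (p≤∣p∣ y) ∣y∣≤B)) hδ))
    (solve 4 (λ x y δ B → (x :* y :+ B :* δ) :- con 0ℚ := (x :+ δ) :* y :+ (B :- y) :* δ) refl x y δ B)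
  ... | inj₁ 0≤x | inj₂ _ = by-difference
    (ℚ.+-mono-≤ (*-nonNeg hy 0≤x) (*-nonNeg (0≤q-p (ℚ.≤-trans (p≤∣p∣ x) ∣x∣≤B)) hδ))
    (solve 4 (λ x y δ B → (x :* y :+ B :* δ) :- con 0ℚ := (y :+ δ) :* x :+ (B :- x) :* δ) refl x y δ B)
  ... | inj₂ x≤0 | inj₂ y≤0 = by-difference
    (ℚ.+-mono-≤ (*-nonNeg (0≤neg x≤0) (0≤neg y≤0))
      (*-nonNeg (ℚ.≤-trans (ℚ.0≤∣p∣ x) ∣x∣≤B) hδ))
    (solve 4 (λ x y δ B → (x :* y :+ B :* δ) :- con 0ℚ := (:- x) :* (:- y) :+ B :* δ) refl x y δ B)

module ℝField where
  open ℚLemmas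

  Eventually : (ℕ → Set) → Set
  Eventually P = ∃[ N ] ∀ k → N ℕ.≤ k → P k

  both : ∀ {P Q} → Eventually P → Eventually Q → Eventually (λ k → P k × Q k)
  both (M , p) (N , q) = M ℕ.⊔ N , λ k N≤k →
    p k (ℕ.m⊔n≤o⇒m≤o M N N≤k) , q k (ℕ.m⊔n≤o⇒n≤o M N N≤k)

  ev-map : ∀ {P Q : ℕ → Set} → (∀ k → P k → Q k) → Eventually P → Eventually Q
  ev-map f (N , p) = N , λ k N≤k → f k (p k N≤k)

  -- Equality of reals unfolds to `Null` of the termwise difference, so congruences reduce to sums
  -- and bounded multiples of null sequences.
  Null : (ℕ → ℚ) → Set
  Null s = ∀ ε → 0ℚ ℚ.< ε → Eventually (λ k → ∣ s k ∣ ℚ.≤ ε)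

  Bounded : (ℕ → ℚ) → Set
  Bounded s = ∃[ B ] 0ℚ ℚ.< B × Eventually (λ k → ∣ s k ∣ ℚ.≤ B)

  null-resp : ∀ {s t} → (∀ k → s k ≡ t k) → Null s → Null t
  null-resp s≡t null ε 0<ε =
    ev-map (λ k → subst (λ z → ∣ z ∣ ℚ.≤ ε) (s≡t k)) (null ε 0<ε)

  null-0 : Null (λ _ → 0ℚ)
  null-0 ε 0<ε = 0 , λ _ _ → ℚ.<⇒≤ 0<ε

  null-neg : ∀ {s} → Null s → Null (λ k → ℚ.- s k)
  null-neg {s} null ε 0<ε =
    ev-map (λ k → subst (ℚ._≤ ε) (sym (ℚ.∣-p∣≡∣p∣ (s k)))) (null ε 0<ε)

  null-+ : ∀ {s t} → Null s → Null t → Null (λ k → s k ℚ.+ t k)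
  null-+ {s} {t} ns nt ε 0<ε =
    ev-map (λ { k (p , q) → ℚ.≤-trans (ℚ.∣p+q∣≤∣p∣+∣q∣ (s k) (t k))
                  (subst (_ ℚ.≤_) (half-sum ε) (ℚ.+-mono-≤ p q)) })
           (both (ns (½ ℚ.* ε) (half>0 0<ε)) (nt (½ ℚ.* ε) (half>0 0<ε)))

  scaled : ∀ B → 0ℚ ℚ.< B → ∀ ε → 0ℚ ℚ.< ε → ∃[ δ ] 0ℚ ℚ.< δ × B ℚ.* δ ≡ ε
  scaled B 0<B ε 0<ε = ε ℚ.* B⁻¹
    , *-pos 0<ε (ℚ.positive⁻¹ B⁻¹ ⦃ ℚ.1/pos⇒pos B ⦃ ℚ.positive 0<B ⦄ ⦄)
    , trans (solve 3 (λ b e i → b :* (e :* i) := e :* (b :* i)) refl B ε B⁻¹)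
        (trans (cong (ε ℚ.*_) (ℚ.*-inverseʳ B ⦃ B≢0 ⦄)) (ℚ.*-identityʳ ε))
    where
    open ℚSolver
    B≢0 = ℚ.pos⇒nonZero B ⦃ ℚ.positive 0<B ⦄
    B⁻¹ = (ℚ.1/ B) ⦃ B≢0 ⦄

  null-* : ∀ {b s} → Bounded b → Null s → Null (λ k → b k ℚ.* s k)
  null-* {b} {s} (B , 0<B , bound) null ε 0<ε =
    let δ , 0<δ , Bδ≡ε = scaled B 0<B ε 0<ε in
    ev-map (λ { k (p , q) → subst₂ ℚ._≤_ (sym (ℚ.∣p*q∣≡∣p∣*∣q∣ (b k) (s k))) Bδ≡ε
                  (*-mono-≤ (ℚ.0≤∣p∣ (b k)) (ℚ.<⇒≤ 0<δ) p q) })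
           (both bound (null δ 0<δ))

  bounded : ∀ x → Bounded (seq x)
  bounded x with cauchy x 1ℚ 0<1
  ... | N , p = ∣ seq x N ∣ ℚ.+ 1ℚ
    , ℚ.+-mono-≤-< (ℚ.0≤∣p∣ (seq x N)) 0<1
    , N , λ k N≤k → subst (λ z → ∣ z ∣ ℚ.≤ ∣ seq x N ∣ ℚ.+ 1ℚ) (+-sub (seq x k) (seq x N))
      (ℚ.≤-trans (ℚ.∣p+q∣≤∣p∣+∣q∣ (seq x N) (seq x k ℚ.- seq x N))
        (ℚ.+-monoʳ-≤ ∣ seq x N ∣ (p k N N≤k ℕ.≤-refl)))
    where
    open ℚSolver
    +-sub : ∀ a b → b ℚ.+ (a ℚ.- b) ≡ a
    +-sub = solve 2 (λ a b → b :+ (a :- b) := a) refl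

  pointwise : ∀ x y → (∀ k → seq x k ≡ seq y k) → x ≈ y
  pointwise x y x≡y = null-resp
    (λ k → sym (trans (cong (ℚ._- seq y k) (x≡y k)) (ℚ.+-inverseʳ (seq y k)))) null-0

  abstract
    neg-cauchy : ∀ x → IsCauchy (λ k → ℚ.- seq x k)
    neg-cauchy x ε 0<ε = let N , p = cauchy x ε 0<ε in N , λ j k N≤j N≤k →
      subst (ℚ._≤ ε) (trans (sym (ℚ.∣-p∣≡∣p∣ (seq x j ℚ.- seq x k)))
                            (cong ∣_∣ (ℚ.neg-distrib-+ (seq x j) (ℚ.- seq x k))))
        (p j k N≤j N≤k)

  infix 8 -ℝ_

  -ℝ_ : ℝ → ℝ
  -ℝ x = mkℝ (λ k → ℚ.- seq x k) (neg-cauchy x)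

  ≈-refl : ∀ {x} → x ≈ x
  ≈-refl {x} = pointwise x x (λ _ → refl)

  module _ where
    open ℚSolver

    ≈-sym : ∀ {x y} → x ≈ y → y ≈ x
    ≈-sym {x} {y} x≈y = null-resp
      (λ k → solve 2 (λ x y → :- (x :- y) := y :- x) refl (seq x k) (seq y k)) (null-neg x≈y)

    ≈-trans : ∀ {x y z} → x ≈ y → y ≈ z → x ≈ z
    ≈-trans {x} {y} {z} x≈y y≈z = null-resp
      (λ k → solve 3 (λ x y z → (x :- y) :+ (y :- z) := x :- z) refl (seq x k) (seq y k) (seq z k))
      (null-+ x≈y y≈z)

    +-cong : ∀ {x x′ y y′} → x ≈ x′ → y ≈ y′ → x + y ≈ x′ + y′
    +-cong {x} {x′} {y} {y′} p q = null-resp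
      (λ k → solve 4 (λ x x′ y y′ → (x :- x′) :+ (y :- y′) := (x :+ y) :- (x′ :+ y′)) refl
        (seq x k) (seq x′ k) (seq y k) (seq y′ k))
      (null-+ p q)

    *-cong : ∀ {x x′ y y′} → x ≈ x′ → y ≈ y′ → x * y ≈ x′ * y′
    *-cong {x} {x′} {y} {y′} p q = null-resp
      (λ k → solve 4 (λ x x′ y y′ → x :* (y :- y′) :+ y′ :* (x :- x′) := (x :* y) :- (x′ :* y′)) refl
        (seq x k) (seq x′ k) (seq y k) (seq y′ k))
      (null-+ (null-* (bounded x) q) (null-* (bounded y′) p))

    neg-cong : ∀ {x y} → x ≈ y → -ℝ x ≈ -ℝ y
    neg-cong {x} {y} p = null-resp
      (λ k → solve 2 (λ x y → :- (x :- y) := (:- x) :- (:- y)) refl (seq x k) (seq y k)) (null-neg p)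

  ring : CommutativeRing 0ℓ 0ℓ
  ring = record
    { Carrier = ℝ ; _≈_ = _≈_ ; _+_ = _+_ ; _*_ = _*_ ; -_ = -ℝ_ ; 0# = 0ℝ ; 1# = 1ℝ
    ; isCommutativeRing = record
      { isRing = record
        { +-isAbelianGroup = record
          { isGroup = record
            { isMonoid = record
              { isSemigroup = record
                { isMagma = record
                  { isEquivalence = record
                    { refl  = λ {x} → ≈-refl {x}
                    ; sym   = λ {x} {y} → ≈-sym {x} {y}
                    ; trans = λ {x} {y} {z} → ≈-trans {x} {y} {z} }
                  ; ∙-cong = λ {x} {x′} {y} {y′} → +-cong {x} {x′} {y} {y′} }
                ; assoc = λ x y z → pointwise (x + y + z) (x + (y + z))
                      (λ k → ℚ.+-assoc (seq x k) (seq y k) (seq z k)) }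
              ; identity = (λ x → pointwise (0ℝ + x) x (λ k → ℚ.+-identityˡ (seq x k)))
                         , (λ x → pointwise (x + 0ℝ) x (λ k → ℚ.+-identityʳ (seq x k))) }
            ; inverse = (λ x → pointwise (-ℝ x + x) 0ℝ (λ k → ℚ.+-inverseˡ (seq x k)))
                      , (λ x → pointwise (x + -ℝ x) 0ℝ (λ k → ℚ.+-inverseʳ (seq x k)))
            ; ⁻¹-cong = λ {x} {y} → neg-cong {x} {y} }
          ; comm = λ x y → pointwise (x + y) (y + x) (λ k → ℚ.+-comm (seq x k) (seq y k)) }
        ; *-cong = λ {x} {x′} {y} {y′} → *-cong {x} {x′} {y} {y′}
        ; *-assoc = λ x y z → pointwise (x * y * z) (x * (y * z)) (λ k → ℚ.*-assoc (seq x k) (seq y k) (seq z k))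
        ; *-identity = (λ x → pointwise (1ℝ * x) x (λ k → ℚ.*-identityˡ (seq x k)))
                     , (λ x → pointwise (x * 1ℝ) x (λ k → ℚ.*-identityʳ (seq x k)))
        ; distrib = (λ x y z → pointwise (x * (y + z)) (x * y + x * z)
              (λ k → ℚ.*-distribˡ-+ (seq x k) (seq y k) (seq z k)))
                  , (λ x y z → pointwise ((y + z) * x) (y * x + z * x)
                        (λ k → ℚ.*-distribʳ-+ (seq x k) (seq y k) (seq z k))) }
      ; *-comm = λ x y → pointwise (x * y) (y * x) (λ k → ℚ.*-comm (seq x k) (seq y k)) } }

  private
    0≤-weaken : ∀ {x δ} → 0ℚ ℚ.≤ x → 0ℚ ℚ.≤ δ → 0ℚ ℚ.≤ x ℚ.+ δ
    0≤-weaken = ℚ.+-mono-≤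

  nonNeg-resp : ∀ {x y} → x ≈ y → 0ℝ ≤ x → 0ℝ ≤ y
  nonNeg-resp {x} {y} x≈y 0≤x ε 0<ε = ev-map
    (λ { k (p , q) → by-difference (ℚ.+-mono-≤ p (0≤q-p (ℚ.≤-trans (p≤∣p∣ _) q)))
      (trans (cong (λ e → seq y k ℚ.+ e ℚ.- 0ℚ) (sym (half-sum ε)))
        (solve 4 (λ x y e e′ → (y :+ (e :+ e′)) :- con 0ℚ := (x :+ e) :+ (e′ :- (x :- y))) refl
                (seq x k) (seq y k) (½ ℚ.* ε) (½ ℚ.* ε))) })
    (both (0≤x _ (half>0 0<ε)) (x≈y _ (half>0 0<ε)))
    where open ℚSolver

  nonNeg-+ : ∀ {x y} → 0ℝ ≤ x → 0ℝ ≤ y → 0ℝ ≤ x + y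
  nonNeg-+ {x} {y} 0≤x 0≤y ε 0<ε = ev-map
    (λ { k (p , q) → by-difference (ℚ.+-mono-≤ p q)
      (trans (cong (λ e → seq x k ℚ.+ seq y k ℚ.+ e ℚ.- 0ℚ) (sym (half-sum ε)))
        (solve 4 (λ x y e e′ → (x :+ y :+ (e :+ e′)) :- con 0ℚ := (x :+ e) :+ (y :+ e′)) refl
                (seq x k) (seq y k) (½ ℚ.* ε) (½ ℚ.* ε))) })
    (both (0≤x _ (half>0 0<ε)) (0≤y _ (half>0 0<ε)))
    where open ℚSolver

  nonNeg-* : ∀ {x y} → 0ℝ ≤ x → 0ℝ ≤ y → 0ℝ ≤ x * y
  nonNeg-* {x} {y} 0≤x 0≤y ε 0<ε =
    let A , 0<A , ∣x∣≤A = bounded x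
        B , 0<B , ∣y∣≤B = bounded y
        δ , 0<δ , ABδ≡ε = scaled (A ℚ.+ B) (ℚ.+-mono-< 0<A 0<B) ε 0<ε
    in ev-map (λ { k ((p , q) , (a , b)) → subst (λ e → 0ℚ ℚ.≤ seq x k ℚ.* seq y k ℚ.+ e) ABδ≡ε
                  (*-lower-bound p q (ℚ.<⇒≤ 0<δ)
                     (ℚ.≤-trans a (ℚ.≤-trans (ℚ.≤-reflexive (sym (ℚ.+-identityʳ A))) (ℚ.+-monoʳ-≤ A (ℚ.<⇒≤ 0<B))))
                     (ℚ.≤-trans b (ℚ.≤-trans (ℚ.≤-reflexive (sym (ℚ.+-identityˡ B))) (ℚ.+-monoˡ-≤ B (ℚ.<⇒≤ 0<A))))) })
         (both (both (0≤x δ 0<δ) (0≤y δ 0<δ)) (both ∣x∣≤A ∣y∣≤B))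

  pos-resp : ∀ {x y} → x ≈ y → 0ℝ < x → 0ℝ < y
  pos-resp {x} {y} x≈y (ε , 0<ε , 0<x) = ½ ℚ.* ε , half>0 0<ε , ev-map
    (λ { k (p , q) → by-difference (ℚ.+-mono-≤ (0≤q-p p) (0≤q-p (ℚ.≤-trans (p≤∣p∣ _) q)))
      (trans (solve 4 (λ x y e e′ → y :- (con 0ℚ :+ e) := (x :- (con 0ℚ :+ (e :+ e′))) :+ (e′ :- (x :- y))) refl
                (seq x k) (seq y k) (½ ℚ.* ε) (½ ℚ.* ε))
             (cong (λ e → (seq x k ℚ.- (0ℚ ℚ.+ e)) ℚ.+ (½ ℚ.* ε ℚ.- (seq x k ℚ.- seq y k))) (half-sum ε))) })
    (both 0<x (x≈y _ (half>0 0<ε)))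
    where open ℚSolver

  pos⇒nonNeg : ∀ {x} → 0ℝ < x → 0ℝ ≤ x
  pos⇒nonNeg {x} (δ , 0<δ , p) ε 0<ε = ev-map
    (λ k q → 0≤-weaken (ℚ.≤-trans (ℚ.<⇒≤ (subst (0ℚ ℚ.<_) (sym (ℚ.+-identityˡ δ)) 0<δ)) q) (ℚ.<⇒≤ 0<ε)) p

  pos-+ : ∀ {x y} → 0ℝ < x → 0ℝ ≤ y → 0ℝ < x + y
  pos-+ {x} {y} (ε , 0<ε , 0<x) 0≤y = ½ ℚ.* ε , half>0 0<ε , ev-map
    (λ { k (p , q) → by-difference (ℚ.+-mono-≤ (0≤q-p p) q)
      (trans (solve 4 (λ x y e e′ → (x :+ y) :- (con 0ℚ :+ e) := (x :- (con 0ℚ :+ (e :+ e′))) :+ (y :+ e′)) refl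
                (seq x k) (seq y k) (½ ℚ.* ε) (½ ℚ.* ε))
             (cong (λ e → (seq x k ℚ.- (0ℚ ℚ.+ e)) ℚ.+ (seq y k ℚ.+ ½ ℚ.* ε)) (half-sum ε))) })
    (both 0<x (0≤y _ (half>0 0<ε)))
    where open ℚSolver

  pos-* : ∀ {x y} → 0ℝ < x → 0ℝ < y → 0ℝ < x * y
  pos-* {x} {y} (δ , 0<δ , p) (ε , 0<ε , q) = δ ℚ.* ε , *-pos 0<δ 0<ε , ev-map
    (λ { k (a , b) → subst (ℚ._≤ seq x k ℚ.* seq y k) (sym (ℚ.+-identityˡ (δ ℚ.* ε)))
       (*-mono-≤ (ℚ.<⇒≤ 0<δ) (ℚ.≤-trans (ℚ.<⇒≤ 0<ε) (drop b)) (drop a) (drop b)) })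
    (both p q)
    where
    drop : ∀ {a b} → 0ℚ ℚ.+ a ℚ.≤ b → a ℚ.≤ b
    drop {a} = subst (ℚ._≤ _) (ℚ.+-identityˡ a)

  pos-1 : 0ℝ < 1ℝ
  pos-1 = 1ℚ , 0<1 , 0 , λ _ _ → ℚ.≤-refl

  ¬pos-0 : ¬ (0ℝ < 0ℝ)
  ¬pos-0 (ε , 0<ε , N , p) = ℚ.<-irrefl refl
    (ℚ.<-≤-trans 0<ε (subst (ℚ._≤ 0ℚ) (ℚ.+-identityˡ ε) (p N ℕ.≤-refl)))

  -- Rational comparison is decidable. Whenever an approximation that is accurate to ½ ε exceeds ½ ε
  -- in absolute value, the sign of `x` is settled. If no sign holds, all such approximations are
  -- small and x ≈ 0.
  tri : ∀ x → ¬ ¬ (x ≈ 0ℝ ⊎ 0ℝ < x ⊎ 0ℝ < -ℝ x)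
  tri x no-case = no-case (inj₁ x≈0)
    where
    open ℚSolver
    x≈0 : x ≈ 0ℝ
    x≈0 ε 0<ε with cauchy x (½ ℚ.* ε) (half>0 0<ε)
    ... | N , close with ℚ._≤?_ ∣ seq x N ∣ (½ ℚ.* ε)
    ...   | yes small = N , λ k N≤k → ℚ.≤-trans
      (subst₂ ℚ._≤_ (cong ∣_∣ (solve 2 (λ a b → (a :- b) :+ b := a :- con 0ℚ) refl (seq x k) (seq x N))) refl
        (ℚ.∣p+q∣≤∣p∣+∣q∣ (seq x k ℚ.- seq x N) (seq x N)))
      (subst (_ ℚ.≤_) (half-sum ε) (ℚ.+-mono-≤ (close k N N≤k ℕ.≤-refl) small))
    ...   | no large with ℚ.≤-total 0ℚ (seq x N)
    ...     | inj₁ 0≤xN = contradiction (inj₂ (inj₁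
        (∣ seq x N ∣ ℚ.- ½ ℚ.* ε , gap , N , λ k N≤k → by-difference
          (0≤q-p (ℚ.≤-trans (p≤∣p∣ _) (close N k ℕ.≤-refl N≤k)))
          (trans (cong (λ z → seq x k ℚ.- (0ℚ ℚ.+ (z ℚ.- ½ ℚ.* ε))) (ℚ.0≤p⇒∣p∣≡p 0≤xN))
            (solve 3 (λ a b e → a :- (con 0ℚ :+ (b :- e)) := e :- (b :- a)) refl (seq x k) (seq x N)
                  (½ ℚ.* ε)))))) no-case
      where gap = 0<q-p (ℚ.≰⇒> large)
    ...     | inj₂ xN≤0 = contradiction (inj₂ (inj₂
        (∣ seq x N ∣ ℚ.- ½ ℚ.* ε , gap , N , λ k N≤k → by-difference
          (0≤q-p (ℚ.≤-trans (p≤∣p∣ _) (close k N N≤k ℕ.≤-refl)))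
          (trans (cong (λ z → ℚ.- seq x k ℚ.- (0ℚ ℚ.+ (z ℚ.- ½ ℚ.* ε)))
                   (trans (sym (ℚ.∣-p∣≡∣p∣ (seq x N))) (ℚ.0≤p⇒∣p∣≡p (0≤neg xN≤0))))
            (solve 3 (λ a b e → :- a :- (con 0ℚ :+ (:- b :- e)) := e :- (a :- b)) refl (seq x k) (seq x N)
                  (½ ℚ.* ε)))))) no-case
      where gap = 0<q-p (ℚ.≰⇒> large)

  -- The default 0 makes the termwise reciprocal of a sequence total; a positive real may have
  -- finitely many approximations that vanish.
  recip : ℚ → ℚ
  recip q with q ℚ.≟ 0ℚ
  ... | yes _  = 0ℚ
  ... | no q≢0 = (ℚ.1/ q) ⦃ ℚ.≢-nonZero q≢0 ⦄

  recip-inverse : ∀ {q} → 0ℚ ℚ.< q → q ℚ.* recip q ≡ 1ℚ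
  recip-inverse {q} 0<q with q ℚ.≟ 0ℚ
  ... | yes refl = contradiction 0<q (ℚ.<-irrefl refl)
  ... | no q≢0   = ℚ.*-inverseʳ q ⦃ ℚ.≢-nonZero q≢0 ⦄

  recip-cancel : ∀ {q} → 0ℚ ℚ.< q → ∀ r → q ℚ.* recip q ℚ.* r ≡ r
  recip-cancel 0<q r = trans (cong (ℚ._* r) (recip-inverse 0<q)) (ℚ.*-identityˡ r)

  recip-pos : ∀ {q} → 0ℚ ℚ.< q → 0ℚ ℚ.< recip q
  recip-pos {q} 0<q = ℚ.≰⇒> λ r≤0 → ℚ.<-irrefl refl (ℚ.<-≤-trans 0<1
    (subst₂ ℚ._≤_ (recip-inverse 0<q) (ℚ.*-zeroʳ q)
      (ℚ.*-monoˡ-≤-nonNeg q ⦃ ℚ.nonNegative (ℚ.<⇒≤ 0<q) ⦄ r≤0)))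

  recip-anti : ∀ {p q} → 0ℚ ℚ.< p → p ℚ.≤ q → recip q ℚ.≤ recip p
  recip-anti {p} {q} 0<p p≤q = by-difference
    (*-nonNeg (0≤q-p p≤q) (*-nonNeg (ℚ.<⇒≤ (recip-pos 0<p)) (ℚ.<⇒≤ (recip-pos 0<q))))
    (trans (sym (cong₂ ℚ._-_
        (recip-cancel 0<q (recip p)) (recip-cancel 0<p (recip q))))
      (solve 4 (λ p q r s → q :* s :* r :- p :* r :* s := (q :- p) :* (r :* s)) refl p q (recip p) (recip q)))
    where
    open ℚSolver
    0<q = ℚ.<-≤-trans 0<p p≤q

  recip-difference : ∀ {p q} → 0ℚ ℚ.< p → 0ℚ ℚ.< q →
                     recip p ℚ.- recip q ≡ (recip p ℚ.* recip q) ℚ.* (q ℚ.- p)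
  recip-difference {p} {q} 0<p 0<q = trans (sym (cong₂ ℚ._-_
        (recip-cancel 0<q (recip p)) (recip-cancel 0<p (recip q))))
      (solve 4 (λ p q r s → q :* s :* r :- p :* r :* s := (r :* s) :* (q :- p)) refl p q (recip p) (recip q))
    where open ℚSolver

  -- Eventually the approximations stay above `ε`, so taking reciprocals magnifies their differences
  -- at most by (1/ε)². An upper bound for `x` makes the inverse positive.
  inv : ∀ {x} → 0ℝ < x → ∃[ y ] 0ℝ < y × x * y ≈ 1ℝ
  inv {x} (ε , 0<ε , N , ε≤x) = y , y-pos , xy≈1
    where
    bound : ∀ k → N ℕ.≤ k → ε ℚ.≤ seq x k
    bound k N≤k = subst (ℚ._≤ seq x k) (ℚ.+-identityˡ ε) (ε≤x k N≤k)

    xpos : ∀ k → N ℕ.≤ k → 0ℚ ℚ.< seq x k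
    xpos k N≤k = ℚ.<-≤-trans 0<ε (bound k N≤k)

    r = recip ε

    abstract
      inv-cauchy : IsCauchy (λ k → recip (seq x k))
      inv-cauchy η 0<η =
        let δ , 0<δ , rrδ≡η = scaled (r ℚ.* r) (*-pos (recip-pos 0<ε) (recip-pos 0<ε)) η 0<η
            M , close = cauchy x δ 0<δ
        in N ℕ.⊔ M , λ j k NM≤j NM≤k →
          let N≤j = ℕ.m⊔n≤o⇒m≤o N M NM≤j
              N≤k = ℕ.m⊔n≤o⇒m≤o N M NM≤k
              0≤rj = ℚ.<⇒≤ (recip-pos (xpos j N≤j))
              0≤rk = ℚ.<⇒≤ (recip-pos (xpos k N≤k))
              0≤r  = ℚ.<⇒≤ (recip-pos 0<ε)
          in subst₂ ℚ._≤_
            (trans (cong (ℚ._* ∣ seq x k ℚ.- seq x j ∣) (sym (ℚ.0≤p⇒∣p∣≡p (*-nonNeg 0≤rj 0≤rk))))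
              (trans (sym (ℚ.∣p*q∣≡∣p∣*∣q∣ (recip (seq x j) ℚ.* recip (seq x k)) (seq x k ℚ.- seq x j)))
                (cong ∣_∣ (sym (recip-difference (xpos j N≤j) (xpos k N≤k))))))
            rrδ≡η
            (*-mono-≤ (*-nonNeg 0≤rj 0≤rk) (ℚ.<⇒≤ 0<δ)
              (*-mono-≤ 0≤rj 0≤r (recip-anti 0<ε (bound j N≤j)) (recip-anti 0<ε (bound k N≤k)))
              (close k j (ℕ.m⊔n≤o⇒n≤o N M NM≤k) (ℕ.m⊔n≤o⇒n≤o N M NM≤j)))

    y : ℝ
    y = mkℝ (λ k → recip (seq x k)) inv-cauchy

    y-pos : 0ℝ < y
    y-pos = let B , 0<B , M , x≤B = bounded x in
      recip B , recip-pos 0<B , N ℕ.⊔ M , λ k NM≤k → subst (ℚ._≤ seq y k) (sym (ℚ.+-identityˡ (recip B)))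
        (recip-anti (xpos k (ℕ.m⊔n≤o⇒m≤o N M NM≤k))
          (ℚ.≤-trans (p≤∣p∣ (seq x k)) (x≤B k (ℕ.m⊔n≤o⇒n≤o N M NM≤k))))

    xy≈1 : x * y ≈ 1ℝ
    xy≈1 η 0<η = N , λ k N≤k → subst (λ z → ∣ z ℚ.- 1ℚ ∣ ℚ.≤ η) (sym (recip-inverse (xpos k N≤k))) (ℚ.<⇒≤ 0<η)

  orderedField : OrderedField
  orderedField = record
    { commutativeRing = ring
    ; NonNeg       = 0ℝ ≤_
    ; Pos          = 0ℝ <_
    ; NonNeg-resp  = λ {x} {y} → nonNeg-resp {x} {y}
    ; Pos-resp     = λ {x} {y} → pos-resp {x} {y}
    ; NonNeg-0     = λ ε 0<ε → 0 , λ _ _ → 0≤-weaken ℚ.≤-refl (ℚ.<⇒≤ 0<ε)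
    ; NonNeg-+     = λ {x} {y} → nonNeg-+ {x} {y}
    ; NonNeg-*     = λ {x} {y} → nonNeg-* {x} {y}
    ; Pos⇒NonNeg   = λ {x} → pos⇒nonNeg {x}
    ; Pos-+-NonNeg = λ {x} {y} → pos-+ {x} {y}
    ; Pos-*        = λ {x} {y} → pos-* {x} {y}
    ; Pos-1        = pos-1
    ; ¬Pos-0       = ¬pos-0
    ; trichotomy   = tri
    ; inverse      = λ {x} → inv {x}
    }

open ℚLemmas
open ℝField

-- The upper bound for a selection of midpoints

module Bound {n m} (P : PointSet 3 n) (σ : Selection P m) where

  open ListSums
  open LinearAlgebra orderedField using (sumOf)

  pair = proj₁ σ
  pair-injective = proj₁ (proj₂ σ)
  midpoint-injective = proj₁ (proj₂ (proj₂ σ))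
  convex = proj₂ (proj₂ (proj₂ σ))

  ends : Fin m → Fin n × Fin n
  ends = proj₁ ∘ pair

  _~_ : Fin n → Fin n → Set
  u ~ v = ∃[ e ] (ends e ≡ (u , v) ⊎ ends e ≡ (v , u))

  _~?_ : Decidable _~_
  u ~? v = Fin.any? λ e → (ends e ≟ (u , v)) ⊎-dec (ends e ≟ (v , u))
    where _≟_ = Product.≡-dec Fin._≟_ Fin._≟_

  ~-sym : ∀ {u v} → u ~ v → v ~ u
  ~-sym (e , eq) = e , Sum.swap eq

  ordered : ∀ e → proj₁ (ends e) ≢ proj₂ (ends e)
  ordered e = Fin.<⇒≢ (proj₂ (pair e))

  ~⇒≢ : ∀ {u v} → u ~ v → u ≢ v
  ~⇒≢ (e , inj₁ eq) ≡.refl = ordered e (≡.trans (≡.cong proj₁ eq) (≡.sym (≡.cong proj₂ eq)))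
  ~⇒≢ (e , inj₂ eq) ≡.refl = ordered e (≡.trans (≡.cong proj₁ eq) (≡.sym (≡.cong proj₂ eq)))

  h : Fin n → Fin 4 → ℝ
  h v zero    = 1ℝ
  h v (suc i) = point P v i

  h-unit : ∀ v → h v zero ≈ 1ℝ
  h-unit v = ≈-refl {1ℝ}

  ends-avoid : ∀ {u v s t : Fin n} {p} → p ≡ (u , v) ⊎ p ≡ (v , u) → p ≡ (s , t) ⊎ p ≡ (t , s) →
               ¬ (u ≢ s × u ≢ t ⊎ v ≢ s × v ≢ t)
  ends-avoid (inj₁ ≡.refl) (inj₁ ≡.refl) = Sum.[ (λ (a , _) → a ≡.refl) , (λ (_ , b) → b ≡.refl) ]
  ends-avoid (inj₁ ≡.refl) (inj₂ ≡.refl) = Sum.[ (λ (_ , b) → b ≡.refl) , (λ (a , _) → a ≡.refl) ]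
  ends-avoid (inj₂ ≡.refl) (inj₁ ≡.refl) = Sum.[ (λ (_ , b) → b ≡.refl) , (λ (a , _) → a ≡.refl) ]
  ends-avoid (inj₂ ≡.refl) (inj₂ ≡.refl) = Sum.[ (λ (a , _) → a ≡.refl) , (λ (_ , b) → b ≡.refl) ]

  midpoint-comm : ∀ (p q : Point 3) → midpoint p q ≋ midpoint q p
  midpoint-comm p q i = *-cong {fromℚ ½} {fromℚ ½} {p i + q i} {q i + p i} (≈-refl {fromℚ ½})
    (OrderedField.+-comm orderedField (p i) (q i))

  pairMidpoint≋ : ∀ e {u v} → ends e ≡ (u , v) ⊎ ends e ≡ (v , u) →
                  pairMidpoint P (pair e) ≋ midpoint (point P u) (point P v)
  pairMidpoint≋ e {u} {v} (inj₁ eq) = ≡.subst (λ (s , t) → midpoint (point P s) (point P t) ≋ midpoint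
        (point P u) (point P v))
    (≡.sym eq) (λ i → ≈-refl {midpoint (point P u) (point P v) i})
  pairMidpoint≋ e {u} {v} (inj₂ eq) = ≡.subst (λ (s , t) → midpoint (point P s) (point P t) ≋ midpoint
        (point P u) (point P v))
    (≡.sym eq) (midpoint-comm (point P v) (point P u))

  ∑≡sumOf : ∀ {A : Set} (f : A → ℝ) L → ∑ (f ∘ lookup L) ≡ sumOf f L
  ∑≡sumOf f []      = ≡.refl
  ∑≡sumOf f (a ∷ L) = ≡.cong (λ s → f a + s) (∑≡sumOf f L)

  -- Division by `W` turns the balanced edge sums into a convex combination of selected midpoints,
  -- which convex independence forbids.
  exposed : ∀ {u v} → u ~ v → (L : List (ℝ × Fin n × Fin n)) →
    All (λ (w , s , t) → 0ℝ ≤ w × s ~ t × (u ≢ s × u ≢ t ⊎ v ≢ s × v ≢ t)) L →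
    ∀ {W} → 0ℝ < W →
    ¬ (∀ i → sumOf (λ (w , s , t) → w * (h s i + h t i)) L ≈ W * (h u i + h v i))
  exposed {u} {v} (e , ends-e) L all {W} W>0 balance =
    convex x (e , pairMidpoint≋ e ends-e)
      ( length L , (λ j → mid (lookup L j)) , (λ j → weight (lookup L j))
      , (λ j → member (lookup L j) (All.lookup all (∈-lookup j)))
      , (λ j → nonNeg-* {W⁻¹} {proj₁ (lookup L j)} (pos⇒nonNeg {W⁻¹} W⁻¹>0) (proj₁ (All.lookup all (∈-lookup j))))
      , ≡.subst (_≈ 1ℝ) (≡.sym (∑≡sumOf weight L)) weights-sum
      , λ i → ≡.subst (_≈ x i) (≡.sym (∑≡sumOf (λ a → weight a * mid a i) L)) (midpoints-balance (suc i)) )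
    where
    W⁻¹ = proj₁ (inv {W} W>0)
    W⁻¹>0 = proj₁ (proj₂ (inv {W} W>0))
    WW⁻¹≈1 = proj₂ (proj₂ (inv {W} W>0))
    halves : fromℚ ½ * (1ℝ + 1ℝ) ≈ 1ℝ
    halves = pointwise (fromℚ ½ * (1ℝ + 1ℝ)) 1ℝ (λ _ → ≡.refl)
    open Normalisation orderedField using (module MidpointCombination)
    open MidpointCombination h h-unit {fromℚ ½} halves {L} {u} {v} {W} {W⁻¹} WW⁻¹≈1 balance
    x : Point 3
    x = midpoint (point P u) (point P v)
    mid : ℝ × Fin n × Fin n → Point 3
    mid (_ , s , t) = midpoint (point P s) (point P t)
    weight : ℝ × Fin n × Fin n → ℝ
    weight (w , _) = W⁻¹ * w
    member : ∀ a → (let w , s , t = a in 0ℝ ≤ w × s ~ t × (u ≢ s × u ≢ t ⊎ v ≢ s × v ≢ t)) → mid a ∈ₚ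
          (Image (pairMidpoint P ∘ pair) ∖ x)
    member (w , s , t) (_ , (e′ , ends-e′) , avoids) = (e′ , pairMidpoint≋ e′ ends-e′) , λ mid≋x →
      -- Selected pairs with equal midpoints coincide, so a different pair has its midpoint outside
      -- the removed point.
      let same = midpoint-injective λ i → ≈-trans {pairMidpoint P (pair e′) i} {mid (w , s , t) i}
            {pairMidpoint P (pair e) i}
                   (pairMidpoint≋ e′ ends-e′ i)
                   (≈-trans {mid (w , s , t) i} {x i} {pairMidpoint P (pair e) i} (mid≋x i)
                         (≈-sym {pairMidpoint P (pair e) i} {x i} (pairMidpoint≋ e ends-e i)))
      in ends-avoid ends-e (≡.subst (λ e → ends e ≡ (s , t) ⊎ ends e ≡ (t , s)) same ends-e′) avoids

  open MidpointGraph orderedField using (module Rigidity)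
  open Rigidity h h-unit _~_ ~-sym ~⇒≢ exposed using (five-clique-rigid)
  open RigidFiveCliques Fin._≟_ _~_ _~?_ ~-sym ~⇒≢ five-clique-rigid using (edge; edge-~; sparse)

  -- Both orientations of every selected pair, to match the double sum over ordered pairs.
  arcs : List (Fin n × Fin n)
  arcs = map ends (allFin m) ++ map (swap ∘ ends) (allFin m)

  arcs-unique : Unique arcs
  arcs-unique = Unique.++⁺ {xs = map ends (allFin m)} {map (swap ∘ ends) (allFin m)}
    (Unique.map⁺ ends-injective (Unique.allFin⁺ m))
    (Unique.map⁺ (ends-injective ∘ ≡.cong swap) (Unique.allFin⁺ m))
    λ (p , q) → disjoint (∈-map⁻ ends p) (∈-map⁻ (swap ∘ ends) q)
    where
    ends-injective : ∀ {e e′} → ends e ≡ ends e′ → e ≡ e′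
    ends-injective {e} {e′} eq = pair-injective (pair-≡ (pair e) (pair e′) eq)
      where
      pair-≡ : ∀ (p q : Pair n) → proj₁ p ≡ proj₁ q → p ≡ q
      pair-≡ (_ , i<j) (_ , i<j′) ≡.refl = ≡.cong (_ ,_) (ℕ.<-irrelevant i<j i<j′)
    disjoint : ∀ {a} → ∃ (λ e → e ∈ allFin m × a ≡ ends e) → ¬ ∃ (λ e → e ∈ allFin m × a ≡ swap (ends e))
    disjoint (e , _ , ≡.refl) (e′ , _ , eq) = ℕ.<-asym (proj₂ (pair e))
      (≡.subst₂ Fin._<_ (≡.sym (≡.cong proj₂ eq)) (≡.sym (≡.cong proj₁ eq)) (proj₂ (pair e′)))

  arcs-edges : All (λ (u , v) → 1 ℕ.≤ edge u v) arcs
  arcs-edges = All.++⁺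
    (All.map⁺ {xs = allFin m} (All.tabulate λ {e} _ → ℕ.≤-reflexive (≡.sym (edge-~ (e , inj₁ ≡.refl)))))
    (All.map⁺ {xs = allFin m} (All.tabulate λ {e} _ → ℕ.≤-reflexive (≡.sym (edge-~ (e , inj₂ ≡.refl)))))

  selection-bound : 8 ℕ.* m ℕ.≤ 3 ℕ.* (n ℕ.* n) ℕ.+ 2 ℕ.* n
  selection-bound = begin
    8 ℕ.* m                                ≡⟨ ℕ.*-assoc 4 2 m ⟩
    4 ℕ.* (m ℕ.+ (m ℕ.+ 0))                ≡⟨ ≡.cong (4 ℕ.*_) (≡.sym |arcs|) ⟩
    4 ℕ.* length arcs                      ≤⟨ ℕ.*-monoʳ-≤ 4 (length≤total arcs-unique
                                                (λ {a} _ → ∈-cartesianProduct⁺ (∈-allFin (proj₁ a))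
                                                      (∈-allFin (proj₂ a))) arcs-edges) ⟩
    4 ℕ.* total (λ (u , v) → edge u v) (cartesianProduct (allFin n) (allFin n))
                                           ≡⟨ ≡.cong (4 ℕ.*_) (total-cartesianProduct _ (allFin n) (allFin n)) ⟩
    4 ℕ.* double edge (allFin n) (allFin n) ≤⟨ sparse (allFin n) (Unique.allFin⁺ n) ⟩
    3 ℕ.* (length (allFin n) ℕ.* length (allFin n)) ℕ.+ 2 ℕ.* length (allFin n)
                                           ≡⟨ ≡.cong (λ l → 3 ℕ.* (l ℕ.* l) ℕ.+ 2 ℕ.* l)
                                                 (List.length-tabulate {n = n} (λ i → i)) ⟩
    3 ℕ.* (n ℕ.* n) ℕ.+ 2 ℕ.* n            ∎
    where
    open ℕ.≤-Reasoning
    |arcs| : length arcs ≡ m ℕ.+ (m ℕ.+ 0)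
    |arcs| = ≡.trans (List.length-++ (map ends (allFin m)))
      (≡.cong₂ ℕ._+_ (each ends) (≡.trans (each (swap ∘ ends)) (≡.sym (ℕ.+-identityʳ m))))
      where
      each : ∀ (f : Fin m → Fin n × Fin n) → length (map f (allFin m)) ≡ m
      each f = ≡.trans (List.length-map f (allFin m)) (List.length-tabulate (λ i → i))

open Count

-- Realising the construction over the reals

ι : ℤ → ℚ
ι z = z ℚ./ 1

ι-homo-+ : ∀ a b → ι (a ℤ.+ b) ≡ ι a ℚ.+ ι b
ι-homo-+ a b = ℚ.toℚᵘ-injective
  (ℚᵘ.≃-trans (ℚ.toℚᵘ-fromℚᵘ (mkℚᵘ (a ℤ.+ b) 0))
  (ℚᵘ.≃-trans (ℚᵘ.*≡* (solve 2 (λ a b → (a :+ b) :* con (+ 1)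
        := (a :* con (+ 1) :+ b :* con (+ 1)) :* con (+ 1)) refl a b))
  (ℚᵘ.≃-sym (ℚᵘ.≃-trans (ℚ.toℚᵘ-homo-+ (ι a) (ι b))
    (ℚᵘ.+-cong (ℚ.toℚᵘ-fromℚᵘ (mkℚᵘ a 0)) (ℚ.toℚᵘ-fromℚᵘ (mkℚᵘ b 0)))))))
  where open ℤSolver

ι-homo-* : ∀ a b → ι (a ℤ.* b) ≡ ι a ℚ.* ι b
ι-homo-* a b = ℚ.toℚᵘ-injective
  (ℚᵘ.≃-trans (ℚ.toℚᵘ-fromℚᵘ (mkℚᵘ (a ℤ.* b) 0))
  (ℚᵘ.≃-sym (ℚᵘ.≃-trans (ℚ.toℚᵘ-homo-* (ι a) (ι b))
    (ℚᵘ.*-cong (ℚ.toℚᵘ-fromℚᵘ (mkℚᵘ a 0)) (ℚ.toℚᵘ-fromℚᵘ (mkℚᵘ b 0))))))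

/-mono-≤ : ∀ a b c e .⦃ _ : ℕ.NonZero b ⦄ .⦃ _ : ℕ.NonZero e ⦄ →
           a ℕ.* e ℕ.≤ c ℕ.* b → (+ a ℚ./ b) ℚ.≤ (+ c ℚ./ e)
/-mono-≤ a (suc b) c (suc e) h = ℚ.toℚᵘ-cancel-≤
  (ℚᵘ.≤-trans (ℚᵘ.≤-reflexive (ℚ.toℚᵘ-fromℚᵘ (mkℚᵘ (+ a) b)))
  (ℚᵘ.≤-trans (ℚᵘ.*≤* (subst₂ ℤ._≤_ (ℤ.pos-* a (suc e)) (ℤ.pos-* c (suc b)) (ℤ.+≤+ h)))
              (ℚᵘ.≤-reflexive (ℚᵘ.≃-sym (ℚ.toℚᵘ-fromℚᵘ (mkℚᵘ (+ c) e))))))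

0≤ι : ∀ a → 0ℚ ℚ.≤ ι (+ a)
0≤ι a = /-mono-≤ 0 1 a 1 z≤n

ι-injective : ∀ {a b} → ι (+ a) ≡ ι (+ b) → a ≡ b
ι-injective {a} {b} eq = ℤ.+-injective (trans (sym (ℤ.*-identityʳ (+ a)))
  (trans (drop (ℚᵘ.≃-trans (ℚᵘ.≃-sym (ℚ.toℚᵘ-fromℚᵘ (mkℚᵘ (+ a) 0)))
    (ℚᵘ.≃-trans (ℚᵘ.≃-reflexive (cong ℚ.toℚᵘ eq)) (ℚ.toℚᵘ-fromℚᵘ (mkℚᵘ (+ b) 0))))) (ℤ.*-identityʳ (+ b))))
  where
  drop : ∀ {p q} → p ℚᵘ.≃ q → ℚᵘ.↥ p ℤ.* ℚᵘ.↧ q ≡ ℚᵘ.↥ q ℤ.* ℚᵘ.↧ p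
  drop (ℚᵘ.*≡* e) = e

fromℚ-injective : ∀ {p q} → fromℚ p ≈ fromℚ q → p ≡ q
fromℚ-injective {p} {q} p≈q with ∣ p ℚ.- q ∣ ℚ.≤? 0ℚ
... | yes small = trans (solve 2 (λ p q → p := (p :- q) :+ q) refl p q)
    (trans (cong (ℚ._+ q) (ℚ.∣p∣≡0⇒p≡0 (p ℚ.- q) (ℚ.≤-antisym small (ℚ.0≤∣p∣ (p ℚ.- q))))) (ℚ.+-identityˡ q))
  where open ℚSolver
... | no large = let N , close = p≈q (½ ℚ.* D) (half>0 D>0) in
  contradiction (ℚ.≤-<-trans (close N ℕ.≤-refl) half<) (ℚ.<-irrefl refl)
  where
  D = ∣ p ℚ.- q ∣
  D>0 : 0ℚ ℚ.< D
  D>0 = ℚ.≰⇒> large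
  half< : ½ ℚ.* D ℚ.< D
  half< = subst₂ ℚ._<_ (ℚ.+-identityʳ (½ ℚ.* D)) (half-sum D) (ℚ.+-monoʳ-< (½ ℚ.* D) (half>0 D>0))

avoiding : ∀ (s t : Fin 3) → ∃[ i ] s ≢ i × t ≢ i
avoiding zero             zero             = suc zero , (λ ()) , (λ ())
avoiding zero             (suc zero)       = suc (suc zero) , (λ ()) , (λ ())
avoiding zero             (suc (suc zero)) = suc zero , (λ ()) , (λ ())
avoiding (suc zero)       zero             = suc (suc zero) , (λ ()) , (λ ())
avoiding (suc zero)       (suc zero)       = zero , (λ ()) , (λ ())
avoiding (suc zero)       (suc (suc zero)) = zero , (λ ()) , (λ ())
avoiding (suc (suc zero)) zero             = suc zero , (λ ()) , (λ ())
avoiding (suc (suc zero)) (suc zero)       = zero , (λ ()) , (λ ())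
avoiding (suc (suc zero)) (suc (suc zero)) = zero , (λ ()) , (λ ())

square-injective : ∀ {a b} → a ℕ.* a ≡ b ℕ.* b → a ≡ b
square-injective {a} {b} eq = ℕ.≤-antisym (cancel (ℕ.≤-reflexive eq)) (cancel (ℕ.≤-reflexive (sym eq)))
  where
  cancel : ∀ {a b} → a ℕ.* a ℕ.≤ b ℕ.* b → a ℕ.≤ b
  cancel a²≤b² = ℕ.≮⇒≥ λ b<a → ℕ.<⇒≱ (ℕ.*-mono-< b<a b<a) a²≤b²

-- In a direction avoiding both colours the coordinates are the plain squares X², which determine
-- the parameters.
coordinates-injective : ∀ k l → (∀ i → coordinate k i ≡ coordinate l i) → k ≡ l
coordinates-injective k l eq with i , k≢i , l≢i ← avoiding (colour k) (colour l) =
  ℕ.suc-injective (square-injective (trans (sym (off k k≢i)) (trans (eq i) (off l l≢i))))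
  where
  off : ∀ k {i} → colour k ≢ i → coordinate k i ≡ suc k ℕ.* suc k
  off k {i} k≢i with colour k Fin.≟ i
  ... | yes k≡i = contradiction k≡i k≢i
  ... | no _    = refl

ι-∙ : ∀ c x → ι (c ∙ x) ≡ ι (c zero) ℚ.* ι (x zero) ℚ.+
  (ι (c (suc zero)) ℚ.* ι (x (suc zero)) ℚ.+ ι (c (suc (suc zero))) ℚ.* ι (x (suc (suc zero))))
ι-∙ c x = trans (ι-homo-+ (c zero ℤ.* x zero) _) (cong₂ ℚ._+_ (ι-homo-* (c zero) (x zero))
  (trans (ι-homo-+ (c (suc zero) ℤ.* x (suc zero)) (c (suc (suc zero)) ℤ.* x (suc (suc zero))))
    (cong₂ ℚ._+_ (ι-homo-* (c (suc zero)) (x (suc zero))) (ι-homo-* (c (suc (suc zero))) (x (suc (suc zero)))))))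

ι-∙-midpoint : ∀ c x y →
  ι (c zero) ℚ.* (½ ℚ.* (ι (x zero) ℚ.+ ι (y zero))) ℚ.+
  (ι (c (suc zero)) ℚ.* (½ ℚ.* (ι (x (suc zero)) ℚ.+ ι (y (suc zero)))) ℚ.+
  (ι (c (suc (suc zero))) ℚ.* (½ ℚ.* (ι (x (suc (suc zero))) ℚ.+ ι (y (suc (suc zero))))) ℚ.+ 0ℚ))
  ≡ ½ ℚ.* ι (c ∙ x ℤ.+ c ∙ y)
ι-∙-midpoint c x y = trans
  (solve 10 (λ h a b c x y z u v w →
    a :* (h :* (x :+ u)) :+ (b :* (h :* (y :+ v)) :+ (c :* (h :* (z :+ w)) :+ con 0ℚ))
    := h :* ((a :* x :+ (b :* y :+ c :* z)) :+ (a :* u :+ (b :* v :+ c :* w)))) refl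
    ½ (ι (c zero)) (ι (c (suc zero))) (ι (c (suc (suc zero))))
    (ι (x zero)) (ι (x (suc zero))) (ι (x (suc (suc zero))))
    (ι (y zero)) (ι (y (suc zero))) (ι (y (suc (suc zero)))))
  (cong (½ ℚ.*_) (sym (trans (ι-homo-+ (c ∙ x) (c ∙ y)) (cong₂ ℚ._+_ (ι-∙ c x) (ι-∙ c y)))))
  where open ℚSolver

unit-combination : ∀ x → 1ℝ * x + 0ℝ ≈ x
unit-combination x = pointwise (1ℝ * x + 0ℝ) x λ k → trans (ℚ.+-identityʳ (1ℚ ℚ.* seq x k)) (ℚ.*-identityˡ (seq x k))

module Construction (n : ℕ) where

  location : ℕ → Point 3
  location k i = fromℕ (coordinate k i)

  points : PointSet 3 n
  points = record
    { point    = location ∘ toℕ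
    ; distinct = λ {k} {l} eq → Fin.toℕ-injective
        (coordinates-injective (toℕ k) (toℕ l) λ i → ι-injective (fromℚ-injective (eq i)))
    }

  size : ℕ
  size = length (pairs n)

  ends : Fin size → Fin n × Fin n
  ends = lookup (pairs n)

  ends-bichromatic : ∀ e → let k , l = ends e in toℕ k ℕ.< toℕ l × colour (toℕ k) ≢ colour (toℕ l)
  ends-bichromatic e = pairs-bichromatic n (∈-lookup e)

  pair : Fin size → Pair n
  pair e = ends e , proj₁ (ends-bichromatic e)

  centre : Fin size → Point 3
  centre e = pairMidpoint points (pair e)

  module _ (e : Fin size) where

    private
      p = toℕ (proj₁ (ends e))
      q = toℕ (proj₂ (ends e))

    open Functional p q (proj₂ (ends-bichromatic e))

    functional : Fin 3 → ℝ
    functional i = fromℚ (ι (coefficient i))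

    functional-centre : ∀ b → let k , l = ends b in
      ∑ (λ i → functional i * centre b i) ≈ fromℚ (½ ℚ.* ι (at (toℕ k) ℤ.+ at (toℕ l)))
    functional-centre b = pointwise (∑ (λ i → functional i * centre b i)) (fromℚ (½ ℚ.* ι (at k ℤ.+ at l)))
      λ _ → ι-∙-midpoint coefficient (λ i → + coordinate k i) (λ i → + coordinate l i)
      where
      k = toℕ (proj₁ (ends b))
      l = toℕ (proj₂ (ends b))

    -- The points `y` are given through indices different from `e`, not as points different from the
    -- centre. So the lemma also yields injectivity of the midpoints, before that is known.
    centre-exposed : ∀ {x} → centre e ≋ x → ∀ {r} {y : Fin r → Point 3} {w : Fin r → ℝ} →
      (∀ j → ∃[ b ] b ≢ e × centre b ≋ y j) → (∀ j → 0ℝ ≤ w j) → ∑ w ≈ 1ℝ →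
      ¬ (∀ i → ∑ (λ j → w j * y j i) ≈ x i)
    centre-exposed {x} e≋x {r} {y} {w} others = Separation.separated orderedField functional
      {x} {centre e} {y} {centre ∘ b} {w} {fromℚ (½ ℚ.* ι minimum)} {fromℚ ½}
      {λ j → fromℚ (½ ℚ.* ι (at (k j) ℤ.+ at (l j)))} {λ j → fromℚ (½ ℚ.* ι (+ surplus j))}
      e≋x (λ j → proj₂ (proj₂ (others j)))
      (subst (λ t → ∑ (λ i → functional i * centre e i) ≈ fromℚ (½ ℚ.* ι t)) at-p (functional-centre e))
      (λ j → functional-centre (b j))
      -- The sum of the values at two points exceeds the minimum by at least 1, and the midpoint
      -- halves this.
      (½ , ℚ.positive⁻¹ ½ , 0 , λ _ _ → ℚ.≤-refl)
      (λ j ε 0<ε → 0 , λ _ _ → ℚ.+-mono-≤ (*-nonNeg (ℚ.<⇒≤ (ℚ.positive⁻¹ ½)) (0≤ι (surplus j))) (ℚ.<⇒≤ 0<ε))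
      (λ j → pointwise (fromℚ (½ ℚ.* ι (at (k j) ℤ.+ at (l j))))
            ((fromℚ (½ ℚ.* ι minimum) + fromℚ ½) + fromℚ (½ ℚ.* ι (+ surplus j))) (λ _ → gap≡ j))
      where
      open ℚSolver
      b : Fin r → Fin size
      b j = proj₁ (others j)
      k l : Fin r → ℕ
      k j = toℕ (proj₁ (ends (b j)))
      l j = toℕ (proj₂ (ends (b j)))
      excess′ : ∀ j → ∃[ s ] at (k j) ℤ.+ at (l j) ≡ minimum ℤ.+ + suc s
      excess′ j = excess (k j) (l j) (proj₁ (ends-bichromatic (b j))) (proj₂ (ends-bichromatic (b j)))
        (proj₁ (ends-bichromatic e)) λ (k≡p , l≡q) → proj₁ (proj₂ (others j))
          (lookup-injective (pairs-unique n) (cong₂ _,_ (Fin.toℕ-injective k≡p) (Fin.toℕ-injective l≡q)))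
      surplus : Fin r → ℕ
      surplus j = proj₁ (excess′ j)
      gap≡ : ∀ j → ½ ℚ.* ι (at (k j) ℤ.+ at (l j)) ≡ (½ ℚ.* ι minimum ℚ.+ ½) ℚ.+ ½ ℚ.* ι (+ surplus j)
      gap≡ j = trans (cong (λ t → ½ ℚ.* ι t) (proj₂ (excess′ j)))
        (trans (cong (½ ℚ.*_) (trans (ι-homo-+ minimum (+ suc (surplus j)))
              (cong (ι minimum ℚ.+_) (ι-homo-+ (+ 1) (+ surplus j)))))
          (solve 2 (λ m s → con ½ :* (m :+ (con 1ℚ :+ s)) := (con ½ :* m :+ con ½) :+ con ½ :* s) refl
                (ι minimum) (ι (+ surplus j))))

  selection : Selection points size
  selection = pair , (λ {e} {b} eq → lookup-injective (pairs-unique n) (cong proj₁ eq)) ,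
        (λ {e} {b} → centre-injective {e} {b}) , independent
    where
    centre-injective : ∀ {e b} → centre e ≋ centre b → e ≡ b
    centre-injective {e} {b} e≋b = decidable-stable (e Fin.≟ b) λ e≢b →
      -- A coinciding centre with another index would be a convex combination with a single term of
      -- weight 1.
      centre-exposed e {centre b} e≋b {1} {λ _ → centre b} {λ _ → 1ℝ}
      (λ _ → b , e≢b ∘ sym , λ i → ≈-refl {centre b i})
      (λ _ → pos⇒nonNeg {1ℝ} pos-1) (pointwise (1ℝ + 0ℝ) 1ℝ (λ _ → refl))
      (λ i → unit-combination (centre b i))
    independent : ConvexlyIndependent (Image (pairMidpoint points ∘ pair))
    independent x (e , e≋x) (r , y , w , y∈ , w≥0 , total , inside) =
      centre-exposed e {x} e≋x {r} {y} {w} (λ j → let (b , b≋y) , y≇x = y∈ j in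
        b , (λ { refl → y≇x (λ i → ≈-trans {y j i} {centre b i} {x i} (≈-sym {centre b i} {y j i} (b≋y i))
              (e≋x i)) }) , b≋y)
        w≥0 total inside

-- The two bounds on the extremal number

maximum-exists : ∀ (S : Pred ℕ 0ℓ) B → (∀ k → k ∈ₚ S → k ℕ.≤ B) → ∀ {k} → k ∈ₚ S → ¬ ¬ ∃ (IsMaximum S)
maximum-exists S B bound k∈S = climb B k∈S (ℕ.m≤m+n B _)
  where
  -- Unless `k` is a maximum there is a larger member, and `N` bounds how often this can be
  -- repeated.
  climb : ∀ N {k} → k ∈ₚ S → B ℕ.≤ N ℕ.+ k → ¬ ¬ ∃ (IsMaximum S)
  climb N {k} k∈S B≤N+k none = none (k , k∈S , λ l l∈S → ℕ.≮⇒≥ λ k<l → higher N B≤N+k l∈S k<l)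
    where
    higher : ∀ N → B ℕ.≤ N ℕ.+ k → ∀ {l} → l ∈ₚ S → ¬ (k ℕ.< l)
    higher zero    B≤k l∈S k<l = ℕ.<⇒≱ k<l (ℕ.≤-trans (bound _ l∈S) B≤k)
    higher (suc N) B≤  l∈S k<l = climb N l∈S
      (ℕ.≤-trans B≤ (ℕ.≤-trans (ℕ.≤-reflexive (sym (ℕ.+-suc N k))) (ℕ.+-monoʳ-≤ N k<l))) none

-- An extremal number is compared only with maxima, so the constructed selection has to be played
-- against a maximum for the same points. That maximum exists under a double negation, with the
-- upper bound as the bound on sizes; as the goal is a decidable inequality, this suffices.
extremal-lower : ∀ n m → IsExtremal 3 n m → (n ℕ.* n) / 3 ℕ.≤ m
extremal-lower n m (_ , largest) = ℕ.≮⇒≥ λ m<third →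
  maximum-exists (Selection points) (3 ℕ.* (n ℕ.* n) ℕ.+ 2 ℕ.* n)
    (λ k σ → ℕ.≤-trans (ℕ.m≤n*m k 8) (Bound.selection-bound points σ)) selection
    λ (k , max) → ℕ.<⇒≱ m<third (ℕ.≤-trans (third≤length-pairs n)
      (ℕ.≤-trans (proj₂ max size selection) (largest k (points , max))))
  where open Construction n

-- From n² ≤ n³, the number n s has a square of at most n³ s² and so is at most the integer root.
-- The inequality holds for each approximation without an error term.
linear≤^3/2 : ∀ {n} → 1 ℕ.≤ n → ∀ k → ι (+ n) ℚ.≤ seq (n ^3/2) k
linear≤^3/2 {n} 1≤n k = /-mono-≤ n 1 root s
  (ℕ.≤-trans ns≤root (ℕ.≤-reflexive (sym (ℕ.*-identityʳ root))))
  where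
  s = suc k
  root = isqrt (n ℕ.^ 3 ℕ.* (s ℕ.* s))
  square≤ : (n ℕ.* s) ℕ.* (n ℕ.* s) ℕ.≤ n ℕ.^ 3 ℕ.* (s ℕ.* s)
  square≤ = begin
    (n ℕ.* s) ℕ.* (n ℕ.* s)                ≡⟨ solve 2 (λ n s → (n :* s) :* (n :* s)
          := con 1 :* ((n :* n) :* (s :* s))) refl n s ⟩
    1 ℕ.* ((n ℕ.* n) ℕ.* (s ℕ.* s))        ≤⟨ ℕ.*-monoˡ-≤ ((n ℕ.* n) ℕ.* (s ℕ.* s)) 1≤n ⟩
    n ℕ.* ((n ℕ.* n) ℕ.* (s ℕ.* s))        ≡⟨ solve 2 (λ n s → n :* ((n :* n) :* (s :* s))
          := (n :* (n :* (n :* con 1))) :* (s :* s)) refl n s ⟩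
    n ℕ.^ 3 ℕ.* (s ℕ.* s)                  ∎
    where
    open ℕ.≤-Reasoning
    open ℕSolver
  ns≤root : n ℕ.* s ℕ.≤ root
  ns≤root = ℕ.≮⇒≥ λ root<ns → ℕ.<⇒≱ (proj₂ (isqrt-spec (n ℕ.^ 3 ℕ.* (s ℕ.* s))))
    (ℕ.≤-trans (ℕ.*-mono-≤ root<ns root<ns) square≤)

extremal-upper : ∀ n → 1 ℕ.≤ n → ∀ m → IsExtremal 3 n m →
  fromℕ m ≤ fromℚ (+ 3 ℚ./ 8) * fromℕ (n ℕ.* n) + 1ℝ * n ^3/2
extremal-upper n 1≤n m ((P , σ , _) , _) ε 0<ε = 0 , λ k _ → begin
  ι (+ m)                                ≤⟨ by-difference (*-nonNeg eighth≥0 (0≤ι slack)) difference ⟩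
  main ℚ.+ ι (+ n)                       ≤⟨ ℚ.+-monoʳ-≤ main (linear≤^3/2 1≤n k) ⟩
  main ℚ.+ seq (n ^3/2) k                ≡⟨ cong (main ℚ.+_) (sym (ℚ.*-identityˡ (seq (n ^3/2) k))) ⟩
  main ℚ.+ 1ℚ ℚ.* seq (n ^3/2) k         ≡⟨ sym (ℚ.+-identityʳ (main ℚ.+ 1ℚ ℚ.* seq (n ^3/2) k)) ⟩
  main ℚ.+ 1ℚ ℚ.* seq (n ^3/2) k ℚ.+ 0ℚ  ≤⟨ ℚ.+-monoʳ-≤ (main ℚ.+ 1ℚ ℚ.* seq (n ^3/2) k) (ℚ.<⇒≤ 0<ε) ⟩
  main ℚ.+ 1ℚ ℚ.* seq (n ^3/2) k ℚ.+ ε   ∎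
  where
  open ℚ.≤-Reasoning
  main eighth : ℚ
  main = (+ 3 ℚ./ 8) ℚ.* ι (+ (n ℕ.* n))
  eighth = + 1 ℚ./ 8
  eighth≥0 : 0ℚ ℚ.≤ eighth
  eighth≥0 = ℚ.<⇒≤ (ℚ.positive⁻¹ eighth)
  -- Relaxing 2 n to 8 n leaves exactly n after division by 8, hence C = 1.
  bound : 8 ℕ.* m ℕ.≤ 3 ℕ.* (n ℕ.* n) ℕ.+ 8 ℕ.* n
  bound = ℕ.≤-trans (Bound.selection-bound P σ) (ℕ.+-monoʳ-≤ (3 ℕ.* (n ℕ.* n)) (ℕ.*-monoˡ-≤ n (s≤s (s≤s (z≤n {6})))))
  slack : ℕ
  slack = 3 ℕ.* (n ℕ.* n) ℕ.+ 8 ℕ.* n ℕ.∸ 8 ℕ.* m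
  balance : ι (+ 8) ℚ.* ι (+ m) ℚ.+ ι (+ slack) ≡ ι (+ 3) ℚ.* ι (+ (n ℕ.* n)) ℚ.+ ι (+ 8) ℚ.* ι (+ n)
  balance = begin-equality
    ι (+ 8) ℚ.* ι (+ m) ℚ.+ ι (+ slack)                 ≡⟨ cong (ℚ._+ ι (+ slack)) (ι-* 8 m) ⟩
    ι (+ (8 ℕ.* m)) ℚ.+ ι (+ slack)                      ≡⟨ sym (ι-homo-+ (+ (8 ℕ.* m)) (+ slack)) ⟩
    ι (+ (8 ℕ.* m ℕ.+ slack))                            ≡⟨ cong (λ t → ι (+ t)) (ℕ.m+[n∸m]≡n bound) ⟩
    ι (+ (3 ℕ.* (n ℕ.* n) ℕ.+ 8 ℕ.* n))                  ≡⟨ ι-homo-+ (+ (3 ℕ.* (n ℕ.* n))) (+ (8 ℕ.* n)) ⟩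
    ι (+ (3 ℕ.* (n ℕ.* n))) ℚ.+ ι (+ (8 ℕ.* n))          ≡⟨ sym (cong₂ ℚ._+_ (ι-* 3 (n ℕ.* n)) (ι-* 8 n)) ⟩
    ι (+ 3) ℚ.* ι (+ (n ℕ.* n)) ℚ.+ ι (+ 8) ℚ.* ι (+ n)  ∎
    where
    ι-* : ∀ a b → ι (+ a) ℚ.* ι (+ b) ≡ ι (+ (a ℕ.* b))
    ι-* a b = trans (sym (ι-homo-* (+ a) (+ b))) (cong ι (sym (ℤ.pos-* a b)))
  difference : ((+ 3 ℚ./ 8) ℚ.* ι (+ (n ℕ.* n)) ℚ.+ ι (+ n)) ℚ.- ι (+ m) ≡ eighth ℚ.* ι (+ slack)
  difference = begin-equality
    ((+ 3 ℚ./ 8) ℚ.* N ℚ.+ x) ℚ.- M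
      ≡⟨ solve 3 (λ N x M → (con (+ 3 ℚ./ 8) :* N :+ x) :- M
           := con eighth :* ((con (ι (+ 3)) :* N :+ con (ι (+ 8)) :* x) :- con (ι (+ 8)) :* M)) refl N x M ⟩
    eighth ℚ.* ((ι (+ 3) ℚ.* N ℚ.+ ι (+ 8) ℚ.* x) ℚ.- ι (+ 8) ℚ.* M)
      ≡⟨ cong (λ t → eighth ℚ.* (t ℚ.- ι (+ 8) ℚ.* M)) (sym balance) ⟩
    eighth ℚ.* ((ι (+ 8) ℚ.* M ℚ.+ ι (+ slack)) ℚ.- ι (+ 8) ℚ.* M)
      ≡⟨ cong (eighth ℚ.*_) (solve 2 (λ a s → (a :+ s) :- a := s) refl (ι (+ 8) ℚ.* M) (ι (+ slack))) ⟩
    eighth ℚ.* ι (+ slack) ∎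
    where
    open ℚSolver
    N = ι (+ (n ℕ.* n))
    x = ι (+ n)
    M = ι (+ m)

theorem6 : ∃[ C ] 0ℝ < C ×
    (∀ (n : ℕ) → 1 ℕ.≤ n → ∀ m → IsExtremal 3 n m →
    ((n ℕ.* n) / 3 ℕ.≤ m) ×
    (fromℕ m ≤ fromℚ (+ 3 ℚ./ 8) * fromℕ (n ℕ.* n) + C * n ^3/2))
theorem6 = 1ℝ , pos-1 , λ n 1≤n m extremal →
  extremal-lower n m extremal , extremal-upper n 1≤n m extremal
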